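{- Let $0<c<1/3$. There is a number $N_0=N_0(c)$ such that the following holds for every real $N\ge N_0$. If $S$ is a finite set of (distinct) integers $n>N$ such that \[ \sum_{n\in S}\frac1n\le c\,\frac{\log N\,\log\log\log N}{\log\log N}, \] then $\delta^-(S)>0$.
   Context: For a finite set $S$ of positive integers and a choice of an integer $r(n)$ for each $n\in S$, consider the set of integers that are not in the union of the residue classes $r(n)\pmod n$, $n\in S$. This set is a union of residue classes modulo $\mathrm{lcm}(S)$ and so has an asymptotic density. $\delta^-(S)$ denotes the minimum of this density over all choices of the integers $r(n)$, $n\in S$ (one residue class for each modulus $n\in S$). -}

module Defs where

open import Data.Nat.Base as ℕ using (ℕ; zero; suc; s≤s)
import Data.Nat.Properties as ℕP
open import Data.Integer.Base as ℤ using (ℤ; +_)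
import Data.Integer.Properties as ℤP
open import Data.Integer.Divisibility.Signed using (_∣_; _∣?_)
open import Data.Rational.Base
open import Data.Rational.Properties
open import Data.Rational.Solver using (module +-*-Solver)
import Data.Rational.Unnormalised.Base as ℚᵘ
import Data.Rational.Unnormalised.Properties as ℚᵘP
open import Data.List.Base as List using (List; length; filter; upTo; foldr)
open import Data.List.Relation.Unary.All as All using (All; reduce)
open import Data.List.Relation.Unary.Unique.Propositional using (Unique)
open import Data.Product.Base using (∃; _×_; _,_)
open import Data.Sum.Base using (inj₁; inj₂)
open import Data.Empty using (⊥-elim)
open import Relation.Nullary using (¬_; yes; no)
open import Relation.Nullary.Decidable using (¬?)
open import Relation.Unary using (Pred; Decidable)
open import Relation.Binary.PropositionalEquality
  using (_≡_; refl; sym; trans; cong; cong₂; subst; subst₂)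
open import Level using (0ℓ)

------------------------------------------------------------------------
-- Real numbers as Cauchy sequences of rationals.

Cauchy : (ℕ → ℚ) → Set
Cauchy s = ∀ ε → 0ℚ < ε → ∃ λ M → ∀ m n → M ℕ.≤ m → M ℕ.≤ n → ∣ s m - s n ∣ ≤ ε

record ℝ : Set where
  constructor mkℝ
  field
    seq    : ℕ → ℚ
    cauchy : Cauchy seq

open ℝ public

infix 4 _≤ℝ_ _<ℝ_ _⟶_

_≤ℝ_ : ℝ → ℝ → Set
x ≤ℝ y = ∀ ε → 0ℚ < ε → ∃ λ M → ∀ n → M ℕ.≤ n → seq x n ≤ seq y n + ε

_<ℝ_ : ℝ → ℝ → Set
x <ℝ y = ∃ λ ε → 0ℚ < ε × ∃ λ M → ∀ n → M ℕ.≤ n → seq x n + ε ≤ seq y n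

-- A sequence of rationals s converges to a real x iff s n - seq x n → 0,
-- since seq x itself converges to x.
_⟶_ : (ℕ → ℚ) → ℝ → Set
s ⟶ x = ∀ ε → 0ℚ < ε → ∃ λ M → ∀ n → M ℕ.≤ n → ∣ s n - seq x n ∣ ≤ ε

fromℚ : ℚ → ℝ
fromℚ p = mkℝ (λ _ → p) λ ε 0<ε →
  0 , λ _ _ _ _ → subst (_≤ ε) (sym (cong ∣_∣ (+-inverseʳ p))) (<⇒≤ 0<ε)

0ℝ : ℝ
0ℝ = fromℚ 0ℚ

ι : ℕ → ℚ
ι n = + n / 1

fromℕ : ℕ → ℝ
fromℕ n = fromℚ (ι n)

-- The value 0 at 0 is a convention without effect on the reals defined below:
-- it is only ever taken at finitely many terms of a sequence.
recip : ℚ → ℚ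
recip p with p ≟ 0ℚ
... | yes _  = 0ℚ
... | no p≢0 = (1/ p) {{≢-nonZero p≢0}}

sumTo : ℕ → (ℕ → ℚ) → ℚ
sumTo zero    f = 0ℚ
sumTo (suc n) f = sumTo n f + f n

-- Left Riemann sum of ∫ₐᵇ f with suc k intervals of equal (signed) length.
riemann : (ℚ → ℚ) → ℚ → ℚ → ℕ → ℚ
riemann f a b k = sumTo (suc k) λ i → h * f (a + ι i * h)
  where h = (b - a) * (+ 1 / suc k)

module RealLemmas where
  open +-*-Solver

  inv : ℕ → ℚ
  inv k = + 1 / suc k

  -- Ordered-field facts

  sub-≤ : ∀ {a b} → 0ℚ ≤ b - a → a ≤ b
  sub-≤ {a} {b} p = subst₂ _≤_ (+-identityʳ a)
    (solve 2 (λ a b → a :+ (b :- a) := b) refl a b) (+-monoʳ-≤ a p)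

  *-nn : ∀ {a b} → 0ℚ ≤ a → 0ℚ ≤ b → 0ℚ ≤ a * b
  *-nn {a} {b} p q = nonNegative⁻¹ (a * b)
    {{nonNeg*nonNeg⇒nonNeg a {{nonNegative p}} b {{nonNegative q}}}}

  *-pos : ∀ {a b} → 0ℚ < a → 0ℚ < b → 0ℚ < a * b
  *-pos {a} {b} p q = positive⁻¹ (a * b) {{pos*pos⇒pos a {{positive p}} b {{positive q}}}}

  *-mono : ∀ {a b c d} → 0ℚ ≤ a → a ≤ b → 0ℚ ≤ c → c ≤ d → a * c ≤ b * d
  *-mono {a} {b} {c} {d} 0≤a a≤b 0≤c c≤d = ≤-trans
    (*-monoˡ-≤-nonNeg a {{nonNegative 0≤a}} c≤d)
    (*-monoʳ-≤-nonNeg d {{nonNegative (≤-trans 0≤c c≤d)}} a≤b)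

  recip-inverse : ∀ {p} → 0ℚ < p → p * recip p ≡ 1ℚ
  recip-inverse {p} 0<p with p ≟ 0ℚ
  ... | yes refl = ⊥-elim (<-irrefl refl 0<p)
  ... | no p≢0   = *-inverseʳ p {{≢-nonZero p≢0}}

  recip-pos : ∀ {p} → 0ℚ < p → 0ℚ < recip p
  recip-pos {p} 0<p with p ≟ 0ℚ
  ... | yes refl = ⊥-elim (<-irrefl refl 0<p)
  ... | no p≢0   = positive⁻¹ _ {{1/pos⇒pos p {{positive 0<p}}}}

  recip-anti : ∀ {δ p} → 0ℚ < δ → δ ≤ p → recip p ≤ recip δ
  recip-anti {δ} {p} 0<δ δ≤p = subst₂ _≤_ e₁ e₂
    (*-monoʳ-≤-nonNeg (recip p * recip δ)
      {{nonNegative (*-nn (<⇒≤ (recip-pos 0<p)) (<⇒≤ (recip-pos 0<δ)))}} δ≤p)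
    where
    0<p = <-≤-trans 0<δ δ≤p
    e₁ : δ * (recip p * recip δ) ≡ recip p
    e₁ = trans (solve 3 (λ d a b → d :* (a :* b) := (d :* b) :* a) refl δ (recip p) (recip δ))
               (trans (cong (_* recip p) (recip-inverse 0<δ)) (*-identityˡ _))
    e₂ : p * (recip p * recip δ) ≡ recip δ
    e₂ = trans (sym (*-assoc p (recip p) (recip δ)))
               (trans (cong (_* recip δ) (recip-inverse 0<p)) (*-identityˡ _))

  ∣-∣-comm : ∀ a b → ∣ a - b ∣ ≡ ∣ b - a ∣
  ∣-∣-comm a b = trans (sym (∣-p∣≡∣p∣ (a - b)))
    (cong ∣_∣ (solve 2 (λ a b → :- (a :- b) := b :- a) refl a b))

  ∣-∣-tri : ∀ a b c → ∣ a - c ∣ ≤ ∣ a - b ∣ + ∣ b - c ∣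
  ∣-∣-tri a b c = subst (_≤ ∣ a - b ∣ + ∣ b - c ∣)
    (cong ∣_∣ (solve 3 (λ a b c → (a :- b) :+ (b :- c) := a :- c) refl a b c))
    (∣p+q∣≤∣p∣+∣q∣ (a - b) (b - c))

  ∣∣-pos : ∀ {p} → 0ℚ < p → ∣ p ∣ ≡ p
  ∣∣-pos 0<p = 0≤p⇒∣p∣≡p (<⇒≤ 0<p)

  recip-diff : ∀ {p q} → 0ℚ < p → 0ℚ < q → recip p - recip q ≡ (q - p) * (recip p * recip q)
  recip-diff {p} {q} 0<p 0<q = sym (trans
    (solve 4 (λ p q a b → (q :- p) :* (a :* b) := (q :* b) :* a :- (p :* a) :* b)
      refl p q (recip p) (recip q))
    (cong₂ _-_
      (trans (cong (_* recip p) (recip-inverse 0<q)) (*-identityˡ (recip p)))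
      (trans (cong (_* recip q) (recip-inverse 0<p)) (*-identityˡ (recip q)))))

  recip-lip : ∀ {δ p q} → 0ℚ < δ → δ ≤ p → δ ≤ q →
              ∣ recip p - recip q ∣ ≤ ∣ p - q ∣ * (recip δ * recip δ)
  recip-lip {δ} {p} {q} 0<δ δ≤p δ≤q = subst (_≤ ∣ p - q ∣ * (recip δ * recip δ)) (sym e)
    (*-mono (0≤∣p∣ (p - q)) ≤-refl (*-nn (<⇒≤ rp) (<⇒≤ rq))
      (*-mono (<⇒≤ rp) (recip-anti 0<δ δ≤p) (<⇒≤ rq) (recip-anti 0<δ δ≤q)))
    where
    0<p = <-≤-trans 0<δ δ≤p
    0<q = <-≤-trans 0<δ δ≤q
    rp = recip-pos 0<p
    rq = recip-pos 0<q
    e : ∣ recip p - recip q ∣ ≡ ∣ p - q ∣ * (recip p * recip q)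
    e = trans (cong ∣_∣ (recip-diff 0<p 0<q)) (trans (∣p*q∣≡∣p∣*∣q∣ (q - p) _)
          (cong₂ _*_ (∣-∣-comm q p) (∣∣-pos (*-pos rp rq))))

  -- Casts

  ι-+ : ∀ m n → ι (m ℕ.+ n) ≡ ι m + ι n
  ι-+ m n = toℚᵘ-injective (ℚᵘP.≃-trans (toℚᵘ-fromℚᵘ (ℚᵘ.mkℚᵘ (+ (m ℕ.+ n)) 0))
    (ℚᵘP.≃-sym (ℚᵘP.≃-trans (toℚᵘ-homo-+ (ι m) (ι n))
      (ℚᵘP.≃-trans (ℚᵘP.+-cong (toℚᵘ-fromℚᵘ (ℚᵘ.mkℚᵘ (+ m) 0)) (toℚᵘ-fromℚᵘ (ℚᵘ.mkℚᵘ (+ n) 0)))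
        (ℚᵘ.*≡* (cong (ℤ._* + 1) (cong₂ ℤ._+_ (ℤP.*-identityʳ (+ m)) (ℤP.*-identityʳ (+ n)))))))))

  ι-suc : ∀ n → ι (suc n) ≡ ι n + 1ℚ
  ι-suc n = trans (cong ι (ℕP.+-comm 1 n)) (ι-+ n 1)

  ι-* : ∀ m n → ι (m ℕ.* n) ≡ ι m * ι n
  ι-* zero    n = sym (*-zeroˡ (ι n))
  ι-* (suc m) n = trans (ι-+ n (m ℕ.* n)) (trans (cong (λ z → ι n + z) (ι-* m n))
    (trans (solve 2 (λ m n → n :+ m :* n := (m :+ con 1ℚ) :* n) refl (ι m) (ι n))
           (cong (_* ι n) (sym (ι-suc m)))))

  0≤1 : 0ℚ ≤ 1ℚ
  0≤1 = nonNegative⁻¹ 1ℚ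

  0<1 : 0ℚ < 1ℚ
  0<1 = positive⁻¹ 1ℚ

  ι-nn : ∀ n → 0ℚ ≤ ι n
  ι-nn zero    = ≤-refl
  ι-nn (suc n) = subst (0ℚ ≤_) (sym (ι-suc n)) (+-mono-≤ (ι-nn n) 0≤1)

  ι-mono : ∀ {m n} → m ℕ.≤ n → ι m ≤ ι n
  ι-mono {m} {n} m≤n = subst₂ _≤_ (+-identityʳ (ι m))
    (trans (sym (ι-+ m (n ℕ.∸ m))) (cong ι (ℕP.m+[n∸m]≡n m≤n)))
    (+-monoʳ-≤ (ι m) (ι-nn (n ℕ.∸ m)))

  inv-inverse : ∀ k → inv k * ι (suc k) ≡ 1ℚ
  inv-inverse k = toℚᵘ-injective (ℚᵘP.≃-trans (toℚᵘ-homo-* (inv k) (ι (suc k)))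
    (ℚᵘP.≃-trans (ℚᵘP.*-cong (toℚᵘ-fromℚᵘ (ℚᵘ.mkℚᵘ (+ 1) k)) (toℚᵘ-fromℚᵘ (ℚᵘ.mkℚᵘ (+ suc k) 0)))
      (ℚᵘ.*≡* (trans (ℤP.*-identityʳ _) (trans (ℤP.*-identityˡ (+ suc k))
        (sym (trans (ℤP.*-identityˡ _) (ℤP.*-identityʳ (+ suc k)))))))))

  inv-nn : ∀ k → 0ℚ ≤ inv k
  inv-nn k = nonNegative⁻¹ _ {{normalize-nonNeg 1 (suc k)}}

  inv-small : ∀ η → 0ℚ < η → ∃ λ M → ∀ n → M ℕ.≤ n → inv n ≤ η
  inv-small η@(mkℚ (+ zero) d c) 0<η = ⊥-elim (<-irrefl (sym (↥p≡0⇒p≡0 η refl)) 0<η)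
  inv-small η@(mkℚ (+ suc a) d c) _ = d , λ n d≤n → toℚᵘ-cancel-≤
    (ℚᵘP.≤-respˡ-≃ (ℚᵘP.≃-sym (toℚᵘ-fromℚᵘ (ℚᵘ.mkℚᵘ (+ 1) n)))
      (ℚᵘ.*≤* (subst₂ ℤ._≤_ (sym (ℤP.*-identityˡ (+ suc d))) (ℤP.pos-* (suc a) (suc n))
        (ℤ.+≤+ (ℕP.≤-trans (s≤s d≤n) (ℕP.m≤m+n (suc n) (a ℕ.* suc n)))))))
  inv-small (mkℚ (ℤ.-[1+ a ]) d c) (*<* ())

  -- Sums

  sum-cong : ∀ n {f g : ℕ → ℚ} → (∀ i → f i ≡ g i) → sumTo n f ≡ sumTo n g
  sum-cong zero    e = refl
  sum-cong (suc n) e = cong₂ _+_ (sum-cong n e) (e n)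

  sum-const : ∀ n c → sumTo n (λ _ → c) ≡ ι n * c
  sum-const zero    c = sym (*-zeroˡ c)
  sum-const (suc n) c = trans (cong (_+ c) (sum-const n c))
    (trans (solve 2 (λ n c → n :* c :+ c := (n :+ con 1ℚ) :* c) refl (ι n) c)
           (cong (_* c) (sym (ι-suc n))))

  sum-close : ∀ n {f g : ℕ → ℚ} {e} → (∀ i → i ℕ.< n → ∣ f i - g i ∣ ≤ e) →
              ∣ sumTo n f - sumTo n g ∣ ≤ ι n * e
  sum-close zero    {e = e} _ = ≤-reflexive (sym (*-zeroˡ e))
  sum-close (suc n) {f} {g} {e} H = ≤-trans
    (subst (_≤ ∣ sumTo n f - sumTo n g ∣ + ∣ f n - g n ∣)
      (cong ∣_∣ (solve 4 (λ a b c d → (a :- c) :+ (b :- d) := (a :+ b) :- (c :+ d)) refl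
        (sumTo n f) (f n) (sumTo n g) (g n)))
      (∣p+q∣≤∣p∣+∣q∣ (sumTo n f - sumTo n g) (f n - g n)))
    (≤-trans (+-mono-≤ (sum-close n (λ i i<n → H i (ℕP.m≤n⇒m≤1+n i<n))) (H n ℕP.≤-refl))
      (≤-reflexive (trans
        (solve 2 (λ n e → n :* e :+ e := (n :+ con 1ℚ) :* e) refl (ι n) e)
        (cong (_* e) (sym (ι-suc n))))))

  sum-+ : ∀ m n f → sumTo (m ℕ.+ n) f ≡ sumTo m f + sumTo n (λ j → f (m ℕ.+ j))
  sum-+ m zero    f = trans (cong (λ z → sumTo z f) (ℕP.+-identityʳ m)) (sym (+-identityʳ _))
  sum-+ m (suc n) f = trans (cong (λ z → sumTo z f) (ℕP.+-suc m n))
    (trans (cong (_+ f (m ℕ.+ n)) (sum-+ m n f)) (+-assoc (sumTo m f) (sumTo n λ j → f (m ℕ.+ j)) (f (m ℕ.+ n))))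

  sum-block : ∀ n m f → sumTo (n ℕ.* m) f ≡ sumTo n (λ i → sumTo m (λ j → f (i ℕ.* m ℕ.+ j)))
  sum-block zero    m f = refl
  sum-block (suc n) m f = trans (cong (λ z → sumTo z f) (ℕP.+-comm m (n ℕ.* m)))
    (trans (sum-+ (n ℕ.* m) m f) (cong (_+ sumTo m (λ j → f (n ℕ.* m ℕ.+ j))) (sum-block n m f)))

  -- Cauchy sequences

  cauchy-by : ∀ {s} A → 0ℚ < A →
    (∀ η → 0ℚ < η → ∃ λ M → ∀ m n → M ℕ.≤ m → M ℕ.≤ n → ∣ s m - s n ∣ ≤ A * η) → Cauchy s
  cauchy-by {s} A 0<A H ε 0<ε = let M , P = H (ε * recip A) (*-pos 0<ε (recip-pos 0<A)) in
    M , λ m n p q → subst (∣ s m - s n ∣ ≤_)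
      (trans (solve 3 (λ a e r → a :* (e :* r) := e :* (a :* r)) refl A ε (recip A))
        (trans (cong (ε *_) (recip-inverse 0<A)) (*-identityʳ ε))) (P m n p q)

  bounded : ∀ {s} → Cauchy s → ∃ λ B → 0ℚ < B × ∃ λ M → ∀ n → M ℕ.≤ n → ∣ s n ∣ ≤ B
  bounded {s} cs = let M , P = cs 1ℚ 0<1 in
    1ℚ + ∣ s M ∣ , +-mono-<-≤ 0<1 (0≤∣p∣ (s M)) , M , λ n M≤n →
      ≤-trans (subst (_≤ ∣ s n - s M ∣ + ∣ s M ∣)
                (cong ∣_∣ (solve 2 (λ a b → (a :- b) :+ b := a) refl (s n) (s M)))
                (∣p+q∣≤∣p∣+∣q∣ (s n - s M) (s M)))
              (+-monoˡ-≤ ∣ s M ∣ (P n M M≤n ℕP.≤-refl))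

  *-cauchy : ∀ {s t} → Cauchy s → Cauchy t → Cauchy (λ n → s n * t n)
  *-cauchy {s} {t} cs ct =
    let B , 0<B , Ms , bs = bounded {s} cs
        C , 0<C , Mt , bt = bounded {t} ct
    in cauchy-by {λ n → s n * t n} (B + C) (+-mono-< 0<B 0<C) λ η 0<η →
      let M₁ , P₁ = cs η 0<η
          M₂ , P₂ = ct η 0<η
          M = (Ms ℕ.⊔ Mt) ℕ.⊔ (M₁ ℕ.⊔ M₂)
          ≤s  = ℕP.≤-trans (ℕP.m≤m⊔n Ms Mt) (ℕP.m≤m⊔n (Ms ℕ.⊔ Mt) (M₁ ℕ.⊔ M₂))
          ≤t  = ℕP.≤-trans (ℕP.m≤n⊔m Ms Mt) (ℕP.m≤m⊔n (Ms ℕ.⊔ Mt) (M₁ ℕ.⊔ M₂))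
          ≤₁  = ℕP.≤-trans (ℕP.m≤m⊔n M₁ M₂) (ℕP.m≤n⊔m (Ms ℕ.⊔ Mt) (M₁ ℕ.⊔ M₂))
          ≤₂  = ℕP.≤-trans (ℕP.m≤n⊔m M₁ M₂) (ℕP.m≤n⊔m (Ms ℕ.⊔ Mt) (M₁ ℕ.⊔ M₂))
      in M , λ m n p q → ≤-trans
        (subst (_≤ ∣ s m * (t m - t n) ∣ + ∣ (s m - s n) * t n ∣)
          (cong ∣_∣ (solve 4 (λ a b c d → a :* (b :- d) :+ (a :- c) :* d := a :* b :- c :* d)
            refl (s m) (t m) (s n) (t n)))
          (∣p+q∣≤∣p∣+∣q∣ (s m * (t m - t n)) ((s m - s n) * t n)))
        (subst₂ _≤_
          (sym (cong₂ _+_ (∣p*q∣≡∣p∣*∣q∣ (s m) (t m - t n)) (∣p*q∣≡∣p∣*∣q∣ (s m - s n) (t n))))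
          (solve 3 (λ b c e → b :* e :+ e :* c := (b :+ c) :* e) refl B C η)
          (+-mono-≤
            (*-mono (0≤∣p∣ (s m)) (bs m (ℕP.≤-trans ≤s p))
                    (0≤∣p∣ (t m - t n)) (P₂ m n (ℕP.≤-trans ≤₂ p) (ℕP.≤-trans ≤₂ q)))
            (*-mono (0≤∣p∣ (s m - s n)) (P₁ m n (ℕP.≤-trans ≤₁ p) (ℕP.≤-trans ≤₁ q))
                    (0≤∣p∣ (t n)) (bt n (ℕP.≤-trans ≤t q)))))

  module Positive {s : ℕ → ℚ} (cs : Cauchy s) {δ₀ : ℚ} (0<δ₀ : 0ℚ < δ₀) (M₀ : ℕ)
                  (lower : ∀ n → M₀ ℕ.≤ n → 0ℚ + δ₀ ≤ s n) where

    lower′ : ∀ n → M₀ ℕ.≤ n → δ₀ ≤ s n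
    lower′ n p = subst (_≤ s n) (+-identityˡ δ₀) (lower n p)

    recip-cauchy : Cauchy (λ n → recip (s n))
    recip-cauchy = cauchy-by {λ n → recip (s n)} (D * D) (*-pos 0<D 0<D) λ η 0<η →
      let M , P = cs η 0<η in
      M₀ ℕ.⊔ M , λ m n p q →
        let pm = ℕP.≤-trans (ℕP.m≤m⊔n M₀ M) p
            qn = ℕP.≤-trans (ℕP.m≤m⊔n M₀ M) q
            pm′ = ℕP.≤-trans (ℕP.m≤n⊔m M₀ M) p
            qn′ = ℕP.≤-trans (ℕP.m≤n⊔m M₀ M) q
        in ≤-trans (recip-lip 0<δ₀ (lower′ m pm) (lower′ n qn))
             (≤-trans (*-mono (0≤∣p∣ (s m - s n)) (P m n pm′ qn′) (<⇒≤ (*-pos 0<D 0<D)) ≤-refl)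
                      (≤-reflexive (*-comm η (D * D))))
      where
      D = recip δ₀
      0<D = recip-pos 0<δ₀

  -- Convergence of the Riemann sums of ∫₁^q dt/t, uniformly for δ ≤ q

  L : ℚ → ℕ → ℚ
  L q k = riemann recip 1ℚ q k

  module Log {δ : ℚ} (0<δ : 0ℚ < δ) (δ≤1 : δ ≤ 1ℚ) where

    D D² : ℚ
    D  = recip δ
    D² = D * D

    0<D : 0ℚ < D
    0<D = recip-pos 0<δ

    0≤D² : 0ℚ ≤ D²
    0≤D² = <⇒≤ (*-pos 0<D 0<D)

    point : ∀ {q} → δ ≤ q → ∀ N k → ι N * k ≡ q - 1ℚ → ∀ j → j ℕ.≤ N → δ ≤ 1ℚ + ι j * k
    point {q} δ≤q N k e j j≤N with ≤-total 0ℚ k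
    ... | inj₁ 0≤k = ≤-trans δ≤1
      (subst (_≤ 1ℚ + ι j * k) (+-identityʳ 1ℚ) (+-monoʳ-≤ 1ℚ (*-nn (ι-nn j) 0≤k)))
    ... | inj₂ k≤0 = ≤-trans δ≤q (subst (_≤ 1ℚ + ι j * k)
      (trans (cong (λ z → 1ℚ + z) e) (solve 1 (λ q → con 1ℚ :+ (q :- con 1ℚ) := q) refl q))
      (+-monoʳ-≤ 1ℚ (*-monoʳ-≤-nonPos k {{nonPositive k≤0}} (ι-mono j≤N))))

    step : ∀ q k → ι (suc k) * ((q - 1ℚ) * inv k) ≡ q - 1ℚ
    step q k = trans (solve 3 (λ a b c → a :* (b :* c) := b :* (c :* a)) refl
                        (ι (suc k)) (q - 1ℚ) (inv k))
                     (trans (cong ((q - 1ℚ) *_) (inv-inverse k)) (*-identityʳ _))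

    L-lip : ∀ {q q′} → δ ≤ q → δ ≤ q′ → ∀ k → ∣ L q k - L q′ k ∣ ≤ ∣ q - q′ ∣ * D²
    L-lip {q} {q′} δ≤q δ≤q′ k = ≤-trans (sum-close (suc k) term) (≤-reflexive total)
      where
      h h′ : ℚ
      h  = (q - 1ℚ) * inv k
      h′ = (q′ - 1ℚ) * inv k
      total : ι (suc k) * ((∣ q - q′ ∣ * inv k) * D²) ≡ ∣ q - q′ ∣ * D²
      total = trans (solve 4 (λ a b c d → a :* ((b :* c) :* d) := (c :* a) :* (b :* d)) refl
                       (ι (suc k)) ∣ q - q′ ∣ (inv k) D²)
                    (trans (cong (_* (∣ q - q′ ∣ * D²)) (inv-inverse k)) (*-identityˡ _))
      term : ∀ i → i ℕ.< suc k →
             ∣ h * recip (1ℚ + ι i * h) - h′ * recip (1ℚ + ι i * h′) ∣ ≤ (∣ q - q′ ∣ * inv k) * D²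
      term i i<n = subst (_≤ (∣ q - q′ ∣ * inv k) * D²) (sym e)
        (*-mono (*-nn (0≤∣p∣ (q - q′)) (inv-nn k)) ≤-refl (<⇒≤ (*-pos rp rp′))
          (*-mono (<⇒≤ rp) (recip-anti 0<δ δ≤t) (<⇒≤ rp′) (recip-anti 0<δ δ≤t′)))
        where
        t t′ : ℚ
        t  = 1ℚ + ι i * h
        t′ = 1ℚ + ι i * h′
        δ≤t  = point δ≤q  (suc k) h  (step q k)  i (ℕP.<⇒≤ i<n)
        δ≤t′ = point δ≤q′ (suc k) h′ (step q′ k) i (ℕP.<⇒≤ i<n)
        rp  = recip-pos (<-≤-trans 0<δ δ≤t)
        rp′ = recip-pos (<-≤-trans 0<δ δ≤t′)
        e₁ : h * recip t - h′ * recip t′ ≡ ((q - q′) * inv k) * (recip t * recip t′)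
        e₁ = trans
          (cong₂ (λ a b → h * a - h′ * b)
            (trans (sym (*-identityʳ (recip t)))
              (cong (recip t *_) (sym (recip-inverse (<-≤-trans 0<δ δ≤t′)))))
            (trans (sym (*-identityʳ (recip t′)))
              (cong (recip t′ *_) (sym (recip-inverse (<-≤-trans 0<δ δ≤t))))))
          (solve 6 (λ q q′ v i r r′ →
              let h  = (q :- con 1ℚ) :* v
                  h′ = (q′ :- con 1ℚ) :* v
              in h :* (r :* ((con 1ℚ :+ i :* h′) :* r′)) :- h′ :* (r′ :* ((con 1ℚ :+ i :* h) :* r))
                 := ((q :- q′) :* v) :* (r :* r′))
            refl q q′ (inv k) (ι i) (recip t) (recip t′))
        e : ∣ h * recip t - h′ * recip t′ ∣ ≡ (∣ q - q′ ∣ * inv k) * (recip t * recip t′)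
        e = trans (cong ∣_∣ e₁) (trans (∣p*q∣≡∣p∣*∣q∣ ((q - q′) * inv k) _)
              (cong₂ _*_ (trans (∣p*q∣≡∣p∣*∣q∣ (q - q′) (inv k))
                           (cong (∣ q - q′ ∣ *_) (0≤p⇒∣p∣≡p (inv-nn k))))
                         (∣∣-pos (*-pos rp rp′))))

    -- suc (refined a b) reduces to suc a * suc b
    refined : ℕ → ℕ → ℕ
    refined a b = b ℕ.+ a ℕ.* suc b

    inv-refined : ∀ a b → ι (suc b) * inv (refined a b) ≡ inv a
    inv-refined a b = trans (sym (*-identityˡ _)) (trans (cong (_* (ι (suc b) * inv c)) (sym (inv-inverse a)))
      (trans (solve 4 (λ x y z w → (x :* y) :* (z :* w) := x :* (w :* (y :* z))) refl
                (inv a) (ι (suc a)) (ι (suc b)) (inv c))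
        (trans (cong (λ z → inv a * (inv c * z)) (sym (ι-* (suc a) (suc b))))
          (trans (cong (inv a *_) (inv-inverse c)) (*-identityʳ _)))))
      where c = refined a b

    L-refine : ∀ {q} → δ ≤ q → ∀ a b →
               ∣ L q (refined a b) - L q a ∣ ≤ (∣ q - 1ℚ ∣ * ∣ q - 1ℚ ∣ * D²) * inv a
    L-refine {q} δ≤q a b = subst₂ _≤_
        (cong ∣_∣ (cong₂ _-_ (sym (sum-block (suc a) m F)) (sum-cong (suc a) coarse)))
        total
        (sum-close (suc a) {f = λ i → sumTo m (λ j → F (i ℕ.* m ℕ.+ j))}
           {g = λ i → sumTo m (λ _ → F (i ℕ.* m))} λ i i<n →
           sum-close m {f = λ j → F (i ℕ.* m ℕ.+ j)} {g = λ _ → F (i ℕ.* m)} λ j j<m → term i j i<n j<m)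
      where
      m c : ℕ
      m = suc b
      c = refined a b
      u k h : ℚ
      u = q - 1ℚ
      k = u * inv c
      h = u * inv a
      F : ℕ → ℚ
      F j = k * recip (1ℚ + ι j * k)

      mk≡h : ι m * k ≡ h
      mk≡h = trans (solve 3 (λ a b c → a :* (b :* c) := b :* (a :* c)) refl (ι m) u (inv c))
                   (cong (u *_) (inv-refined a b))

      coarse : ∀ i → sumTo m (λ _ → F (i ℕ.* m)) ≡ h * recip (1ℚ + ι i * h)
      coarse i = trans (sum-const m (F (i ℕ.* m)))
        (trans (sym (*-assoc (ι m) k _))
          (cong₂ (λ x y → x * recip (1ℚ + y)) mk≡h
            (trans (cong (_* k) (ι-* i m)) (trans (*-assoc (ι i) (ι m) k) (cong (ι i *_) mk≡h)))))

      e : ℚ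
      e = ∣ k ∣ * ((ι m * ∣ k ∣) * D²)

      term : ∀ i j → i ℕ.< suc a → j ℕ.< m → ∣ F (i ℕ.* m ℕ.+ j) - F (i ℕ.* m) ∣ ≤ e
      term i j i<n j<m = subst (_≤ e) (sym eq)
        (*-mono (0≤∣p∣ k) ≤-refl (0≤∣p∣ _) (≤-trans
          (recip-lip 0<δ (pt (i ℕ.* m ℕ.+ j) le) (pt (i ℕ.* m) (ℕP.≤-trans (ℕP.m≤m+n _ j) le)))
          (*-mono (0≤∣p∣ _) dist 0≤D² ≤-refl)))
        where
        le : i ℕ.* m ℕ.+ j ℕ.≤ suc c
        le = ℕP.≤-trans (ℕP.+-monoʳ-≤ (i ℕ.* m) (ℕP.<⇒≤ j<m))
               (subst (ℕ._≤ suc a ℕ.* m) (ℕP.+-comm m (i ℕ.* m)) (ℕP.*-monoˡ-≤ m i<n))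
        pt = point δ≤q (suc c) k (step q c)
        eq : ∣ F (i ℕ.* m ℕ.+ j) - F (i ℕ.* m) ∣ ≡
             ∣ k ∣ * ∣ recip (1ℚ + ι (i ℕ.* m ℕ.+ j) * k) - recip (1ℚ + ι (i ℕ.* m) * k) ∣
        eq = trans (cong ∣_∣ (solve 3 (λ k x y → k :* x :- k :* y := k :* (x :- y)) refl k _ _))
                   (∣p*q∣≡∣p∣*∣q∣ k _)
        diff : (1ℚ + ι (i ℕ.* m ℕ.+ j) * k) - (1ℚ + ι (i ℕ.* m) * k) ≡ ι j * k
        diff = trans (cong (λ z → (1ℚ + z * k) - (1ℚ + ι (i ℕ.* m) * k)) (ι-+ (i ℕ.* m) j))
          (solve 3 (λ x y k → (con 1ℚ :+ (x :+ y) :* k) :- (con 1ℚ :+ x :* k) := y :* k) refl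
             (ι (i ℕ.* m)) (ι j) k)
        dist : ∣ (1ℚ + ι (i ℕ.* m ℕ.+ j) * k) - (1ℚ + ι (i ℕ.* m) * k) ∣ ≤ ι m * ∣ k ∣
        dist = subst (_≤ ι m * ∣ k ∣)
          (sym (trans (cong ∣_∣ diff) (trans (∣p*q∣≡∣p∣*∣q∣ (ι j) k)
            (cong (_* ∣ k ∣) (0≤p⇒∣p∣≡p (ι-nn j))))))
          (*-mono (ι-nn j) (ι-mono (ℕP.<⇒≤ j<m)) (0≤∣p∣ k) ≤-refl)

      m∣k∣ : ι m * ∣ k ∣ ≡ ∣ u ∣ * inv a
      m∣k∣ = trans (cong (_* ∣ k ∣) (sym (0≤p⇒∣p∣≡p (ι-nn m))))
        (trans (sym (∣p*q∣≡∣p∣*∣q∣ (ι m) k)) (trans (cong ∣_∣ mk≡h)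
          (trans (∣p*q∣≡∣p∣*∣q∣ u (inv a)) (cong (∣ u ∣ *_) (0≤p⇒∣p∣≡p (inv-nn a))))))

      total : ι (suc a) * (ι m * e) ≡ (∣ u ∣ * ∣ u ∣ * D²) * inv a
      total = trans
        (solve 4 (λ n m k d → n :* (m :* (k :* ((m :* k) :* d))) := n :* ((m :* k) :* (m :* k) :* d))
          refl (ι (suc a)) (ι m) ∣ k ∣ D²)
        (trans (cong (λ z → ι (suc a) * (z * z * D²)) m∣k∣)
          (trans (solve 4 (λ n u v d → n :* ((u :* v) :* (u :* v) :* d) := (v :* n) :* ((u :* u :* d) :* v))
                    refl (ι (suc a)) ∣ u ∣ (inv a) D²)
            (trans (cong (_* ((∣ u ∣ * ∣ u ∣ * D²) * inv a)) (inv-inverse a)) (*-identityˡ _))))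

    L-close : ∀ {q} → δ ≤ q → ∀ a b →
              ∣ L q a - L q b ∣ ≤ (∣ q - 1ℚ ∣ * ∣ q - 1ℚ ∣ * D²) * (inv a + inv b)
    L-close {q} δ≤q a b = ≤-trans (∣-∣-tri (L q a) (L q (refined a b)) (L q b))
      (≤-trans (+-mono-≤
          (subst (_≤ E * inv a) (∣-∣-comm (L q (refined a b)) (L q a)) (L-refine δ≤q a b))
          (subst (λ z → ∣ L q z - L q b ∣ ≤ E * inv b)
            (ℕP.suc-injective (ℕP.*-comm (suc b) (suc a))) (L-refine δ≤q b a)))
        (≤-reflexive (sym (*-distribˡ-+ E (inv a) (inv b)))))
      where E = ∣ q - 1ℚ ∣ * ∣ q - 1ℚ ∣ * D²

    L-cauchy : ∀ {s} → Cauchy s → ∀ M₀ → (∀ n → M₀ ℕ.≤ n → δ ≤ s n) → Cauchy (λ n → L (s n) n)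
    L-cauchy {s} cs M₀ lower =
      let B , 0<B , M₁ , bs = bounded {s} cs
          C = B + 1ℚ
          0<C = +-mono-< 0<B 0<1
          E = C * C * D²
          0≤E = *-nn (<⇒≤ (*-pos 0<C 0<C)) 0≤D²
      in cauchy-by {λ n → L (s n) n} (D² + (E + E)) (+-mono-<-≤ (*-pos 0<D 0<D) (+-mono-≤ 0≤E 0≤E)) λ η 0<η →
        let M₂ , P₂ = cs η 0<η
            M₃ , P₃ = inv-small η 0<η
            M = (M₀ ℕ.⊔ M₁) ℕ.⊔ (M₂ ℕ.⊔ M₃)
            ≤₀ = ℕP.≤-trans (ℕP.m≤m⊔n M₀ M₁) (ℕP.m≤m⊔n (M₀ ℕ.⊔ M₁) (M₂ ℕ.⊔ M₃))
            ≤₁ = ℕP.≤-trans (ℕP.m≤n⊔m M₀ M₁) (ℕP.m≤m⊔n (M₀ ℕ.⊔ M₁) (M₂ ℕ.⊔ M₃))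
            ≤₂ = ℕP.≤-trans (ℕP.m≤m⊔n M₂ M₃) (ℕP.m≤n⊔m (M₀ ℕ.⊔ M₁) (M₂ ℕ.⊔ M₃))
            ≤₃ = ℕP.≤-trans (ℕP.m≤n⊔m M₂ M₃) (ℕP.m≤n⊔m (M₀ ℕ.⊔ M₁) (M₂ ℕ.⊔ M₃))
        in M , λ m n p q →
          let lm = lower m (ℕP.≤-trans ≤₀ p)
              ln = lower n (ℕP.≤-trans ≤₀ q)
              un = ≤-trans (∣p-q∣≤∣p∣+∣q∣ (s n) 1ℚ) (+-monoˡ-≤ 1ℚ (bs n (ℕP.≤-trans ≤₁ q)))
              EE : ∣ s n - 1ℚ ∣ * ∣ s n - 1ℚ ∣ * D² ≤ E
              EE = *-mono (*-nn (0≤∣p∣ (s n - 1ℚ)) (0≤∣p∣ (s n - 1ℚ))) (*-mono (0≤∣p∣ (s n - 1ℚ)) un (0≤∣p∣ (s n - 1ℚ)) un) 0≤D² ≤-refl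
              i≤ = +-mono-≤ (P₃ m (ℕP.≤-trans ≤₃ p)) (P₃ n (ℕP.≤-trans ≤₃ q))
          in ≤-trans (∣-∣-tri (L (s m) m) (L (s n) m) (L (s n) n))
               (≤-trans (+-mono-≤
                 (≤-trans (L-lip lm ln m)
                   (*-mono (0≤∣p∣ (s m - s n)) (P₂ m n (ℕP.≤-trans ≤₂ p) (ℕP.≤-trans ≤₂ q)) 0≤D² ≤-refl))
                 (≤-trans (L-close ln m n)
                   (*-mono (*-nn (*-nn (0≤∣p∣ (s n - 1ℚ)) (0≤∣p∣ (s n - 1ℚ))) 0≤D²) EE
                           (+-mono-≤ (inv-nn m) (inv-nn n)) i≤)))
                 (≤-reflexive (solve 3 (λ d e t → t :* d :+ e :* (t :+ t) := (d :+ (e :+ e)) :* t)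
                    refl D² E η)))

open RealLemmas

infixl 7 _*ℝ_

_*ℝ_ : ℝ → ℝ → ℝ
x *ℝ y = mkℝ (λ n → seq x n * seq y n) (*-cauchy {seq x} {seq y} (cauchy x) (cauchy y))

recipℝ : (x : ℝ) → 0ℝ <ℝ x → ℝ
recipℝ x (_ , 0<δ , M , lower) =
  mkℝ (λ n → recip (seq x n)) (Positive.recip-cauchy (cauchy x) 0<δ M lower)

-- log x = ∫₁ˣ dt/t : the n-th term is the Riemann sum for ∫₁^(seq x n) dt/t
-- with suc n intervals.
log : (x : ℝ) → 0ℝ <ℝ x → ℝ
log x (δ , 0<δ , M , lower) = mkℝ (λ n → riemann recip 1ℚ (seq x n) n)
  (Log.L-cauchy 0<δ⊓1 (p⊓q≤q δ 1ℚ) (cauchy x) M λ n M≤n →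
    ≤-trans (p⊓q≤p δ 1ℚ) (Positive.lower′ (cauchy x) 0<δ M lower n M≤n))
  where
  0<δ⊓1 : 0ℚ < δ ⊓ 1ℚ
  0<δ⊓1 with ≤-total δ 1ℚ
  ... | inj₁ δ≤1 = subst (0ℚ <_) (sym (p≤q⇒p⊓q≡p δ≤1)) 0<δ
  ... | inj₂ 1≤δ = subst (0ℚ <_) (sym (p≥q⇒p⊓q≡q 1≤δ)) 0<1

------------------------------------------------------------------------
-- Densities and residue classes

-- The proportion of integers a with ∣ a ∣ ≤ X that lie in A.
proportion : {A : Pred ℤ 0ℓ} → Decidable A → ℕ → ℚ
proportion A? X =
  + length (filter A? (List.map (λ i → + i ℤ.- + X) (upTo (suc (2 ℕ.* X))))) / suc (2 ℕ.* X)

HasDensity : {A : Pred ℤ 0ℓ} → Decidable A → ℝ → Set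
HasDensity A? d = proportion A? ⟶ d

record FiniteSet⁺ : Set where
  field
    elements : List ℕ
    unique   : Unique elements
    nonZeros : All ℕ.NonZero elements

open FiniteSet⁺ public

sumOfReciprocals : FiniteSet⁺ → ℚ
sumOfReciprocals S = foldr _+_ 0ℚ (reduce (λ {n} n≢0 → (+ 1 / n) {{n≢0}}) (nonZeros S))

-- A choice of residues is a function r : ℕ → ℤ; only its values on S matter.
Uncovered : FiniteSet⁺ → (ℕ → ℤ) → Pred ℤ 0ℓ
Uncovered S r a = All (λ n → ¬ (+ n ∣ a ℤ.- r n)) (elements S)

uncovered? : (S : FiniteSet⁺) (r : ℕ → ℤ) → Decidable (Uncovered S r)
uncovered? S r a = All.all? (λ n → ¬? (+ n ∣? (a ℤ.- r n))) (elements S)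

-- d = δ⁻(S): d is the least of the densities of the sets Uncovered S r.
IsMinDensity : FiniteSet⁺ → ℝ → Set
IsMinDensity S d =
  (∃ λ r → HasDensity (uncovered? S r) d) ×
  (∀ r d′ → HasDensity (uncovered? S r) d′ → d ≤ℝ d′)

-- The proof shows that distinct moduli that are all large never cover ℤ (Hough's theorem), by a derandomised form
-- of the distortion method of Balister, Bollobás, Morris, Sahasrabudhe and Tiba.  An uncovered integer is built by
-- fixing its residues modulo powers of one prime after the other, in increasing order.  A potential Φ bounds the
-- expected future damage: for every prime p it contains the second moment of the proportion of residues at p that
-- are hit by the moduli with largest prime p.  While Φ < 1 fewer than half of the residues at p are hit, so
-- averaging over the others loses at most a factor 2 on the terms that depend on p, and some choice keeps Φ < 1.
-- Initially Φ is at most ∑_p O(1/p²) ∏_{q<p} (1 + O(1/q)); by Chebyshev's bound the tail of this sum is small, and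
-- Rankin's trick makes the contribution of the moduli composed of small primes small.

module Submission where

-- Two effects compete in `Φ`. A prime `p` adds a term of order `1/p²`: moduli that agree at all
-- earlier primes and end at `p` differ in their exponent at `p`, so together they hit a proportion
-- `O(1/p)` of the residues, and squaring this gives a convergent series where the first power would
-- diverge. Against this, averaging multiplies later terms, but only by `1 + O(1/q)` for each
-- earlier prime `q` and not by 2, because a pair of moduli prime to `q` loses nothing. Over a
-- dyadic block of large primes these losses multiply to at most 3/2, while the tail of the series
-- halves from one block to the next; the margin between 3/2 and 2 also absorbs the fixed loss from
-- the primes below the first good block, once the border between small and large primes is pushed
-- far enough. The constants are chosen in this order: the border, the coefficient `C` of the small
-- primes, the number `K` of prime factors, the threshold for the moduli. The passage to densities
-- is finite: uncovered sets are periodic and only residues of `r n` modulo `n` matter, so a minimum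
-- is attained, and it is positive once every choice leaves one integer uncovered.

module NumberTheory where

  open import Data.List.Base using (List; []; _∷_; _++_; filter; applyUpTo; length)
  open import Data.List.Membership.Propositional using (_∈_)
  open import Data.List.Membership.Propositional.Properties
    using (∈-filter⁺; ∈-filter⁻; ∈-applyUpTo⁺; ∈-applyUpTo⁻; ∈-++⁻; ∈-++⁺ˡ; ∈-++⁺ʳ)
  open import Data.List.Relation.Unary.All as All using (All; []; _∷_)
  open import Data.List.Relation.Unary.AllPairs using ([]; _∷_)
  open import Data.List.Relation.Unary.Any using (here; there)
  open import Data.List.Relation.Unary.Unique.Propositional using (Unique)
  import Data.List.Relation.Unary.Unique.Propositional.Properties as Unique
  open import Data.Nat
  open import Data.Nat.Combinatorics using (_C_; nCk≡n!/k![n-k]!; k![n∸k]!∣n!; nCk+nC[k+1]≡[n+1]C[k+1])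
  open import Data.Nat.Divisibility
  open import Data.Nat.DivMod using (m*[n/m]≡n)
  open import Data.Nat.GCD using (gcd; gcd[m,n]∣m; gcd[m,n]∣n; gcd-greatest; gcd[m,n]≢0)
  open import Data.Nat.ListAction using (product)
  open import Data.Nat.Primality
  open import Data.Nat.Primality.Factorisation
    using (factorise; factorisationHasAllPrimeFactors)
  open import Data.Nat.Properties
  open import Data.Nat.Tactic.RingSolver using (solve-∀)
  open import Data.Product.Base using (∃; _×_; _,_; proj₁; proj₂)
  open import Data.Sum.Base using (inj₁; inj₂)
  open import Relation.Binary.PropositionalEquality
  open import Relation.Nullary using (¬_; yes; no; contradiction)

  -- Exponents of primes and divisibility.

  prime⇒2≤ : ∀ {p} → Prime p → 2 ≤ p
  prime⇒2≤ {p} pp = nonTrivial⇒n>1 p {{prime⇒nonTrivial pp}}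

  n<p^n : ∀ {p} → 2 ≤ p → ∀ n → n < p ^ n
  n<p^n {p} 2≤p zero = s≤s z≤n
  n<p^n {p} 2≤p (suc n) = begin
    2 + n           ≡⟨ +-comm 1 (suc n) ⟩
    suc n + 1       ≤⟨ +-mono-≤ (n<p^n 2≤p n) (m^n>0 p {{>-nonZero (<⇒≤ 2≤p)}} n) ⟩
    p ^ n + p ^ n   ≡⟨ cong (p ^ n +_) (sym (+-identityʳ (p ^ n))) ⟩
    2 * p ^ n       ≤⟨ *-monoˡ-≤ (p ^ n) 2≤p ⟩
    p ^ suc n       ∎
    where open ≤-Reasoning

  prime-factor : ∀ {n} → 2 ≤ n → ∃ λ p → Prime p × p ∣ n
  prime-factor {n} 2≤n with factorise n {{>-nonZero (<⇒≤ 2≤n)}}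
  ... | record { factors = [] ; isFactorisation = n≡1 } =
    contradiction (subst (2 ≤_) n≡1 2≤n) λ { (s≤s ()) }
  ... | record { factors = p ∷ ps ; isFactorisation = n≡ ; factorsPrime = pp ∷ _ } =
    p , pp , subst (p ∣_) (sym n≡) (m∣m*n (product ps))

  -- v p d is the exponent of p in d, for p ≥ 2 and d ≥ 1.
  largestExponent≤ : ℕ → ℕ → ℕ → ℕ
  largestExponent≤ zero    p d = 0
  largestExponent≤ (suc k) p d with p ^ suc k ∣? d
  ... | yes _ = suc k
  ... | no  _ = largestExponent≤ k p d

  v : ℕ → ℕ → ℕ
  v p d = largestExponent≤ d p d

  p^v∣ : ∀ p d → p ^ v p d ∣ d
  p^v∣ p d = go d
    where
    go : ∀ k → p ^ largestExponent≤ k p d ∣ d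
    go zero = 1∣ d
    go (suc k) with p ^ suc k ∣? d
    ... | yes h = h
    ... | no  _ = go k

  v≤ : ∀ p d → v p d ≤ d
  v≤ p d = go d
    where
    go : ∀ k → largestExponent≤ k p d ≤ k
    go zero = z≤n
    go (suc k) with p ^ suc k ∣? d
    ... | yes h = ≤-refl
    ... | no  _ = ≤-trans (go k) (n≤1+n k)

  -- Since `k < p ^ k ≤ d`, a search downwards from `d` does not start below `k`.
  p^k∣⇒k≤v : ∀ {p d k} → 2 ≤ p → 1 ≤ d → p ^ k ∣ d → k ≤ v p d
  p^k∣⇒k≤v {p} {d} {k} 2≤p 1≤d h = go d
    (<⇒≤ (<-≤-trans (n<p^n 2≤p k) (∣⇒≤ {{>-nonZero 1≤d}} h)))
    where
    go : ∀ m → k ≤ m → k ≤ largestExponent≤ m p d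
    go zero    k≤m = k≤m
    go (suc m) k≤m with p ^ suc m ∣? d
    ... | yes _ = k≤m
    ... | no ¬h with m≤n⇒m<n∨m≡n k≤m
    ...   | inj₁ (s≤s k≤m′) = go m k≤m′
    ...   | inj₂ refl       = contradiction h ¬h

  ^-mono-∣ : ∀ p {m n} → m ≤ n → p ^ m ∣ p ^ n
  ^-mono-∣ p {m} {n} m≤n = subst (p ^ m ∣_)
    (trans (sym (^-distribˡ-+-* p m (n ∸ m))) (cong (p ^_) (m+[n∸m]≡n m≤n)))
    (m∣m*n (p ^ (n ∸ m)))

  -- With g = gcd d e, a prime factor p of d / g would give p ^ (v p g + 1) ∣ d, hence ∣ e, hence ∣ g.
  primePowers⇒∣ : ∀ {d e} → 1 ≤ d → 1 ≤ e →
                  (∀ p k → Prime p → p ^ k ∣ d → p ^ k ∣ e) → d ∣ e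
  primePowers⇒∣ {d} {e} 1≤d 1≤e H with gcd[m,n]∣m d e
  ... | divides zero    d≡ = contradiction (subst (1 ≤_) d≡ 1≤d) λ ()
  ... | divides 1       d≡ = subst (_∣ e) (sym (trans d≡ (*-identityˡ _))) (gcd[m,n]∣n d e)
  ... | divides q@(suc (suc _)) d≡ with prime-factor {q} (s≤s (s≤s z≤n))
  ...   | p , pp , p∣q = contradiction (p^k∣⇒k≤v (prime⇒2≤ pp) 1≤g
            (gcd-greatest p^∣d (H p (suc k) pp p^∣d))) (<-irrefl refl)
    where
    g k : ℕ
    g = gcd d e
    k = v p g
    1≤g : 1 ≤ g
    1≤g = >-nonZero⁻¹ _ {{≢-nonZero (gcd[m,n]≢0 d e (inj₁ (m<n⇒n≢0 1≤d)))}}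
    p^∣d : p ^ suc k ∣ d
    p^∣d = subst (p ^ suc k ∣_) (sym d≡) (*-pres-∣ p∣q (p^v∣ p g))

  -- Euclid's lemma strips one factor `p` at a time. This carries a divisibility between two lifts
  -- `a + Q t` over to the parameters `t`.
  prime∤⇒^∣-cancel : ∀ {p Q} → Prime p → ¬ p ∣ Q → ∀ k {x} → p ^ k ∣ Q * x → p ^ k ∣ x
  prime∤⇒^∣-cancel pp p∤Q zero    {x} _ = 1∣ x
  prime∤⇒^∣-cancel {p} {Q} pp p∤Q (suc k) {x} h
    with euclidsLemma Q x pp (∣-trans (m∣m*n (p ^ k)) h)
  ... | inj₁ p∣Q = contradiction p∣Q p∤Q
  ... | inj₂ (divides y refl) = subst (p * p ^ k ∣_) (*-comm p y)
    (*-monoʳ-∣ p (prime∤⇒^∣-cancel pp p∤Q k (*-cancelˡ-∣ p {{prime⇒nonZero pp}}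
      (subst (p * p ^ k ∣_) (e Q y p) h))))
    where
    e : ∀ Q y p → Q * (y * p) ≡ p * (Q * y)
    e = solve-∀

  prime∣^⇒∣ : ∀ {p q} → Prime p → ∀ k → p ∣ q ^ k → p ∣ q
  prime∣^⇒∣ pp zero h = contradiction (∣1⇒≡1 h) λ { refl → ¬prime[1] pp }
  prime∣^⇒∣ {p} {q} pp (suc k) h with euclidsLemma q (q ^ k) pp h
  ... | inj₁ x = x
  ... | inj₂ y = prime∣^⇒∣ pp k y

  prime∣prime⇒≡ : ∀ {p q} → Prime p → Prime q → p ∣ q → p ≡ q
  prime∣prime⇒≡ pp pq p∣q with prime⇒irreducible pq p∣q
  ... | inj₁ refl = contradiction pp ¬prime[1]
  ... | inj₂ p≡q  = p≡q

  distinct-primes-∣ : ∀ {p q Q} → Prime p → Prime q → ¬ p ≡ q → ¬ p ∣ Q → ∀ γ → ¬ p ∣ Q * q ^ γ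
  distinct-primes-∣ {p} {q} {Q} pp pq p≢q p∤Q γ h with euclidsLemma Q (q ^ γ) pp h
  ... | inj₁ p∣Q = p∤Q p∣Q
  ... | inj₂ p∣q^γ = p≢q (prime∣prime⇒≡ pp pq (prime∣^⇒∣ pp γ p∣q^γ))

  smoothPart : List ℕ → ℕ → ℕ
  smoothPart []       d = 1
  smoothPart (p ∷ ps) d = p ^ v p d * smoothPart ps d

  p^v∣smoothPart : ∀ {p ps} d → p ∈ ps → p ^ v p d ∣ smoothPart ps d
  p^v∣smoothPart {ps = _ ∷ ps} d (here refl) = m∣m*n (smoothPart ps d)
  p^v∣smoothPart {ps = q ∷ _}  d (there p∈)  = ∣-trans (p^v∣smoothPart d p∈) (n∣m*n (q ^ v q d))

  exponentSum : List ℕ → ℕ → ℕ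
  exponentSum []       d = 0
  exponentSum (p ∷ ps) d = v p d + exponentSum ps d

  smoothPart≥1 : ∀ {ps} d → All Prime ps → 1 ≤ smoothPart ps d
  smoothPart≥1 d [] = ≤-refl
  smoothPart≥1 {p ∷ ps} d (pp ∷ pps) =
    *-mono-≤ (m^n>0 p {{prime⇒nonZero pp}} (v p d)) (smoothPart≥1 d pps)

  -- Read backwards: an integer above `y ^ K` composed of primes up to `y` has more than `K` prime
  -- factors with multiplicity. This is how the size of the moduli enters.
  smoothPart≤ : ∀ {ps y} d → 1 ≤ y → All (_≤ y) ps → smoothPart ps d ≤ y ^ exponentSum ps d
  smoothPart≤ d 1≤y [] = ≤-refl
  smoothPart≤ {p ∷ ps} {y} d 1≤y (p≤y ∷ h) = begin
    p ^ v p d * smoothPart ps d          ≤⟨ *-mono-≤ (^-monoˡ-≤ (v p d) p≤y) (smoothPart≤ d 1≤y h) ⟩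
    y ^ v p d * y ^ exponentSum ps d     ≡⟨ sym (^-distribˡ-+-* y (v p d) (exponentSum ps d)) ⟩
    y ^ (v p d + exponentSum ps d)       ∎
    where open ≤-Reasoning

  ∣⇒v≢0 : ∀ {p d} → 2 ≤ p → 1 ≤ d → p ∣ d → ¬ v p d ≡ 0
  ∣⇒v≢0 {p} {d} 2≤p 1≤d p∣d v≡0 = contradiction
    (subst (1 ≤_) v≡0 (p^k∣⇒k≤v {k = 1} 2≤p 1≤d (subst (_∣ d) (sym (*-identityʳ p)) p∣d))) λ ()

  ∣smoothPart : ∀ {ps d} → 1 ≤ d → All Prime ps → (∀ p → Prime p → p ∣ d → p ∈ ps) →
                d ∣ smoothPart ps d
  ∣smoothPart {ps} {d} 1≤d pps H = primePowers⇒∣ 1≤d (smoothPart≥1 d pps) go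
    where
    go : ∀ p k → Prime p → p ^ k ∣ d → p ^ k ∣ smoothPart ps d
    go p zero pp h = 1∣ _
    go p (suc k) pp h = ∣-trans (^-mono-∣ p (p^k∣⇒k≤v {k = suc k} (prime⇒2≤ pp) 1≤d h))
      (p^v∣smoothPart d (H p pp (∣-trans (m∣m*n (p ^ k)) h)))

  -- Used in both directions, so that moduli with equal exponents coincide by antisymmetry of
  -- divisibility.
  v-determines : ∀ {ps d e} → 1 ≤ d → 1 ≤ e → (∀ p → Prime p → p ∣ d → p ∈ ps) →
                 (∀ {p} → p ∈ ps → v p d ≡ v p e) → d ∣ e
  v-determines {ps} {d} {e} 1≤d 1≤e H eq = primePowers⇒∣ 1≤d 1≤e go
    where
    go : ∀ p k → Prime p → p ^ k ∣ d → p ^ k ∣ e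
    go p zero pp h = 1∣ _
    go p (suc k) pp h = ∣-trans (^-mono-∣ p (subst (suc k ≤_) (eq (H p pp (∣-trans (m∣m*n (p ^ k)) h)))
      (p^k∣⇒k≤v {k = suc k} (prime⇒2≤ pp) 1≤d h))) (p^v∣ p e)

  -- Chebyshev's upper bound for the primes in a dyadic block.

  nCk≤2^n : ∀ n k → n C k ≤ 2 ^ n
  nCk≤2^n n       zero    = m^n>0 2 n
  nCk≤2^n zero    (suc k) = z≤n
  nCk≤2^n (suc n) (suc k) = begin
    suc n C suc k        ≡⟨ sym (nCk+nC[k+1]≡[n+1]C[k+1] n k) ⟩
    n C k + n C suc k    ≤⟨ +-mono-≤ (nCk≤2^n n k) (nCk≤2^n n (suc k)) ⟩
    2 ^ n + 2 ^ n        ≡⟨ cong (2 ^ n +_) (sym (+-identityʳ (2 ^ n))) ⟩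
    2 ^ suc n            ∎
    where open ≤-Reasoning

  prime∤! : ∀ {p} → Prime p → ∀ {n} → n < p → ¬ p ∣ n !
  prime∤! pp {zero}  _   h = contradiction (∣1⇒≡1 h) λ { refl → ¬prime[1] pp }
  prime∤! pp {suc n} n<p h with euclidsLemma (suc n) (n !) pp h
  ... | inj₁ p∣n = <⇒≱ n<p (∣⇒≤ p∣n)
  ... | inj₂ p∣! = prime∤! pp (<-trans (n<1+n n) n<p) p∣!

  -- `(n + n) !` is the product of two copies of `n !` and the binomial coefficient; it is divisible
  -- by `p ≤ n + n`, while `n !` is not because `n < p`.
  prime∣central : ∀ {p n} → Prime p → n < p → p ≤ n + n → p ∣ (n + n) C n
  prime∣central {p} {n} pp n<p p≤2n with euclidsLemma (n ! * (n + n ∸ n) !) ((n + n) C n) pp p∣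
    where
    n≤2n : n ≤ n + n
    n≤2n = m≤m+n n n
    p∣ : p ∣ (n ! * (n + n ∸ n) !) * ((n + n) C n)
    p∣ = subst (p ∣_)
      (sym (trans (cong ((n ! * (n + n ∸ n) !) *_) (nCk≡n!/k![n-k]! n≤2n))
                  (m*[n/m]≡n {{n !* (n + n ∸ n) !≢0}} (k![n∸k]!∣n! n≤2n))))
      (∣-trans (m∣m! p {{prime⇒nonZero pp}}) (m≤n⇒m!∣n! p≤2n))
      where
      m∣m! : ∀ m → .{{NonZero m}} → m ∣ m !
      m∣m! (suc m) = m∣m*n (m !)
  ... | inj₂ h = h
  ... | inj₁ h with euclidsLemma (n !) ((n + n ∸ n) !) pp h
  ...   | inj₁ h′ = contradiction h′ (prime∤! pp n<p)
  ...   | inj₂ h′ = contradiction (subst (λ m → p ∣ m !) (m+n∸n≡m n n) h′) (prime∤! pp n<p)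

  -- With `m = q * product ps`, the new prime divides `q` or `product ps`; in the second case it
  -- would occur in `ps`, against distinctness.
  product-primes-∣ : ∀ {ps m} → All Prime ps → Unique ps → All (_∣ m) ps → product ps ∣ m
  product-primes-∣ [] _ _ = 1∣ _
  product-primes-∣ {p ∷ ps} (pp ∷ pps) (p∉ ∷ u) (p∣m ∷ h) with product-primes-∣ pps u h
  ... | divides q refl with euclidsLemma q (product ps) pp p∣m
  ...   | inj₁ p∣q = *-monoˡ-∣ (product ps) p∣q
  ...   | inj₂ p∣Π =
    contradiction refl (All.lookup p∉ (factorisationHasAllPrimeFactors pp p∣Π pps))

  product≥ : ∀ {ps m} → All (m ≤_) ps → m ^ length ps ≤ product ps
  product≥ [] = ≤-refl
  product≥ (m≤p ∷ h) = *-mono-≤ m≤p (product≥ h)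

  primesIn : ℕ → List ℕ
  primesIn k = filter prime? (applyUpTo (λ i → suc (2 ^ k + i)) (2 ^ k))

  2^suc : ∀ k → 2 ^ suc k ≡ 2 ^ k + 2 ^ k
  2^suc k = cong (2 ^ k +_) (+-identityʳ (2 ^ k))

  ∈primesIn⁻ : ∀ {p} k → p ∈ primesIn k → Prime p × 2 ^ k < p × p ≤ 2 ^ suc k
  ∈primesIn⁻ k p∈ with ∈-filter⁻ prime? {xs = applyUpTo (λ i → suc (2 ^ k + i)) (2 ^ k)} p∈
  ... | p∈′ , pp with ∈-applyUpTo⁻ (λ i → suc (2 ^ k + i)) p∈′
  ...   | i , i< , refl = pp , s≤s (m≤m+n (2 ^ k) i) ,
    subst₂ _≤_ (+-suc (2 ^ k) i) (sym (2^suc k)) (+-monoʳ-≤ (2 ^ k) i<)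

  ∈primesIn⁺ : ∀ {p} k → Prime p → 2 ^ k < p → p ≤ 2 ^ suc k → p ∈ primesIn k
  ∈primesIn⁺ {p} k pp 2^k<p p≤ = ∈-filter⁺ prime?
    (subst (_∈ applyUpTo (λ i → suc (2 ^ k + i)) (2 ^ k)) e
      (∈-applyUpTo⁺ (λ i → suc (2 ^ k + i)) i<)) pp
    where
    e : suc (2 ^ k) + (p ∸ suc (2 ^ k)) ≡ p
    e = m+[n∸m]≡n 2^k<p
    i< : p ∸ suc (2 ^ k) < 2 ^ k
    i< = +-cancelˡ-≤ (2 ^ k) _ _ (subst₂ _≤_ (sym (trans (+-suc (2 ^ k) _) e)) (2^suc k) p≤)

  primesIn-unique : ∀ k → Unique (primesIn k)
  primesIn-unique k = Unique.filter⁺ prime? (Unique.applyUpTo⁺₁ (λ i → suc (2 ^ k + i)) (2 ^ k)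
    λ {i} {j} i<j _ e → <⇒≢ i<j (+-cancelˡ-≡ (2 ^ k) i j (suc-injective e)))

  -- The primes of `(2 ^ k, 2 ^ (k + J)]` in increasing order, kept in dyadic blocks because the
  -- later estimates go block by block.
  segment : ℕ → ℕ → List ℕ
  segment k zero    = []
  segment k (suc J) = primesIn k ++ segment (suc k) J

  ∈segment⁻ : ∀ {p} k J → p ∈ segment k J → Prime p × 2 ^ k < p × p ≤ 2 ^ (k + J)
  ∈segment⁻ {p} k (suc J) p∈ with ∈-++⁻ (primesIn k) p∈
  ... | inj₁ h = let pp , lo , hi = ∈primesIn⁻ k h in
    pp , lo , ≤-trans hi (^-monoʳ-≤ 2 (subst (suc k ≤_) (sym (+-suc k J)) (s≤s (m≤m+n k J))))
  ... | inj₂ h = let pp , lo , hi = ∈segment⁻ (suc k) J h in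
    pp , ≤-<-trans (^-monoʳ-≤ 2 (n≤1+n k)) lo , subst (λ z → p ≤ 2 ^ z) (sym (+-suc k J)) hi

  ∈segment⁺ : ∀ {p} k J → Prime p → 2 ^ k < p → p ≤ 2 ^ (k + J) → p ∈ segment k J
  ∈segment⁺ {p} k zero pp lo hi = contradiction (subst (λ z → p ≤ 2 ^ z) (+-identityʳ k) hi) (<⇒≱ lo)
  ∈segment⁺ {p} k (suc J) pp lo hi with p ≤? 2 ^ suc k
  ... | yes h = ∈-++⁺ˡ (∈primesIn⁺ k pp lo h)
  ... | no ¬h = ∈-++⁺ʳ (primesIn k)
    (∈segment⁺ (suc k) J pp (≰⇒> ¬h) (subst (λ z → p ≤ 2 ^ z) (+-suc k J) hi))

  segment-unique : ∀ k J → Unique (segment k J)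
  segment-unique k zero    = []
  segment-unique k (suc J) = Unique.++⁺ (primesIn-unique k) (segment-unique (suc k) J)
    λ (h , h′) → <⇒≱ (proj₁ (proj₂ (∈segment⁻ (suc k) J h′))) (proj₂ (proj₂ (∈primesIn⁻ k h)))

  -- Chebyshev: the primes in (n, 2n] all divide the central binomial coefficient, which is at most 4^n.
  primesIn-length : ∀ k → k * length (primesIn k) ≤ 2 * 2 ^ k
  primesIn-length k = 2^-cancel-≤ (begin
    2 ^ (k * length ps)     ≡⟨ sym (^-*-assoc 2 k (length ps)) ⟩
    n ^ length ps           ≤⟨ product≥ (All.tabulate λ h → <⇒≤ (proj₁ (proj₂ (∈primesIn⁻ k h)))) ⟩
    product ps              ≤⟨ ∣⇒≤ {{C≢0}} (product-primes-∣ pps (primesIn-unique k) divs) ⟩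
    (n + n) C n             ≤⟨ nCk≤2^n (n + n) n ⟩
    2 ^ (n + n)             ≡⟨ cong (2 ^_) (cong (n +_) (sym (+-identityʳ n))) ⟩
    2 ^ (2 * n)             ∎)
    where
    open ≤-Reasoning
    n = 2 ^ k
    ps = primesIn k
    pps : All Prime ps
    pps = All.tabulate λ h → proj₁ (∈primesIn⁻ k h)
    divs : All (_∣ (n + n) C n) ps
    divs = All.tabulate λ {p} h → let pp , lo , hi = ∈primesIn⁻ k h in
      prime∣central pp lo (subst (p ≤_) (2^suc k) hi)
    C≢0 : NonZero ((n + n) C n)
    C≢0 = ≢-nonZero λ e → contradiction
      (trans (sym (m*[n/m]≡n {{n !* (n + n ∸ n) !≢0}} (k![n∸k]!∣n! (m≤m+n n n))))
        (trans (cong ((n ! * (n + n ∸ n) !) *_) (trans (sym (nCk≡n!/k![n-k]! (m≤m+n n n))) e))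
          (*-zeroʳ (n ! * (n + n ∸ n) !))))
      (≢-nonZero⁻¹ _ {{(n + n) !≢0}})
    2^-cancel-≤ : ∀ {a b} → 2 ^ a ≤ 2 ^ b → a ≤ b
    2^-cancel-≤ {a} {b} h with a ≤? b
    ... | yes a≤b = a≤b
    ... | no  a≰b = contradiction h (<⇒≱ (^-monoʳ-< 2 (s≤s (s≤s z≤n)) (≰⇒> a≰b)))

-- Finite sums, indicators and powers of rationals.

module Sieve where

  open NumberTheory
  open import Defs
  open RealLemmas
  open import Data.Integer.Base as ℤ using (ℤ; +_)
  import Data.Integer.Properties as ℤP
  open import Data.Integer.Divisibility.Signed as ℤD using (_∣_; _∣?_)
  open import Data.Integer.Tactic.RingSolver using (solve-∀)
  open import Data.List.Base using (List; []; _∷_; _++_; filter; length)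
  open import Data.List.Membership.Propositional using (_∈_)
  open import Data.List.Membership.Propositional.Properties using (∈-filter⁺; ∈-filter⁻; ∈-++⁻)
  open import Data.List.Properties using (++-assoc)
  open import Data.List.Relation.Unary.All as All using (All; []; _∷_)
  import Data.List.Relation.Unary.All.Properties as All
  open import Data.List.Relation.Unary.AllPairs using ([]; _∷_)
  open import Data.List.Relation.Unary.Any using (here; there)
  open import Data.List.Relation.Unary.Unique.Propositional using (Unique)
  import Data.List.Relation.Unary.Unique.Propositional.Properties as Unique
  open import Data.Nat.Base as ℕ using (ℕ; zero; suc; s≤s; z≤n)
  import Data.Nat.Divisibility as ℕD
  open import Data.Nat.Primality using (Prime; prime⇒nonZero; ¬prime[1])
  import Data.Nat.Properties as ℕP
  open import Data.Product.Base using (∃; _×_; _,_; proj₁; proj₂)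
  open import Data.Rational.Base
  open import Data.Rational.Properties
  open import Data.Rational.Solver using (module +-*-Solver)
  open import Data.Sum.Base using (_⊎_; inj₁; inj₂)
  open import Level using (0ℓ)
  open import Relation.Binary.PropositionalEquality
  open import Relation.Nullary using (¬_; Dec; yes; no; contradiction)
  open import Relation.Nullary.Decidable using (¬?; from-yes)
  open import Relation.Unary using (Pred; Decidable)
  open +-*-Solver using (solve; _:+_; _:*_; _:-_; con; _:=_)

  private variable
    A : Set

  ≤-by-≡ˡ : ∀ {x y z} → x ≡ y → y ≤ z → x ≤ z
  ≤-by-≡ˡ refl h = h

  +-nn : ∀ {a b} → 0ℚ ≤ a → 0ℚ ≤ b → 0ℚ ≤ a + b
  +-nn p q = +-mono-≤ p q

  p≤p+q : ∀ {p q} → 0ℚ ≤ q → p ≤ p + q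
  p≤p+q {p} {q} h = subst (_≤ p + q) (+-identityʳ p) (+-monoʳ-≤ p h)

  q≤p+q : ∀ {p q} → 0ℚ ≤ p → q ≤ p + q
  q≤p+q {p} {q} h = subst (_≤ p + q) (+-identityˡ q) (+-monoˡ-≤ q h)

  *-monoʳ : ∀ {a b c} → 0ℚ ≤ a → b ≤ c → a * b ≤ a * c
  *-monoʳ {a} h = *-monoˡ-≤-nonNeg a {{nonNegative h}}

  *-monoˡ : ∀ {a b c} → 0ℚ ≤ a → b ≤ c → b * a ≤ c * a
  *-monoˡ {a} h = *-monoʳ-≤-nonNeg a {{nonNegative h}}

  ∑ : List A → (A → ℚ) → ℚ
  ∑ []       f = 0ℚ
  ∑ (x ∷ xs) f = f x + ∑ xs f

  ∑-mono : ∀ (xs : List A) {f g : A → ℚ} → (∀ {x} → x ∈ xs → f x ≤ g x) → ∑ xs f ≤ ∑ xs g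
  ∑-mono []       h = ≤-refl
  ∑-mono (x ∷ xs) h = +-mono-≤ (h (here refl)) (∑-mono xs λ x∈ → h (there x∈))

  ∑-cong : ∀ (xs : List A) {f g : A → ℚ} → (∀ {x} → x ∈ xs → f x ≡ g x) → ∑ xs f ≡ ∑ xs g
  ∑-cong []       h = refl
  ∑-cong (x ∷ xs) h = cong₂ _+_ (h (here refl)) (∑-cong xs λ x∈ → h (there x∈))

  ∑-nn : ∀ (xs : List A) {f : A → ℚ} → (∀ {x} → x ∈ xs → 0ℚ ≤ f x) → 0ℚ ≤ ∑ xs f
  ∑-nn []       h = ≤-refl
  ∑-nn (x ∷ xs) h = +-nn (h (here refl)) (∑-nn xs λ x∈ → h (there x∈))

  ∑-*ˡ : ∀ (xs : List A) c (f : A → ℚ) → ∑ xs (λ x → c * f x) ≡ c * ∑ xs f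
  ∑-*ˡ []       c f = sym (*-zeroʳ c)
  ∑-*ˡ (x ∷ xs) c f = trans (cong (λ z → c * f x + z) (∑-*ˡ xs c f)) (sym (*-distribˡ-+ c (f x) (∑ xs f)))

  ∑-*ʳ : ∀ (xs : List A) c (f : A → ℚ) → ∑ xs (λ x → f x * c) ≡ ∑ xs f * c
  ∑-*ʳ xs c f = trans (∑-cong xs λ {x} _ → *-comm (f x) c) (trans (∑-*ˡ xs c f) (*-comm c (∑ xs f)))

  sumTo-mono : ∀ n {f g : ℕ → ℚ} → (∀ i → i ℕ.< n → f i ≤ g i) → sumTo n f ≤ sumTo n g
  sumTo-mono zero    h = ≤-refl
  sumTo-mono (suc n) h = +-mono-≤ (sumTo-mono n λ i i<n → h i (ℕP.m<n⇒m<1+n i<n)) (h n ℕP.≤-refl)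

  sumTo-nn : ∀ n {f : ℕ → ℚ} → (∀ i → 0ℚ ≤ f i) → 0ℚ ≤ sumTo n f
  sumTo-nn zero    h = ≤-refl
  sumTo-nn (suc n) h = +-nn (sumTo-nn n h) (h n)

  sumTo-*ˡ : ∀ n c (f : ℕ → ℚ) → sumTo n (λ i → c * f i) ≡ c * sumTo n f
  sumTo-*ˡ zero    c f = sym (*-zeroʳ c)
  sumTo-*ˡ (suc n) c f = trans (cong (_+ c * f n) (sumTo-*ˡ n c f)) (sym (*-distribˡ-+ c (sumTo n f) (f n)))

  sumTo-*ʳ : ∀ n c (f : ℕ → ℚ) → sumTo n (λ i → f i * c) ≡ sumTo n f * c
  sumTo-*ʳ n c f = trans (sum-cong n λ i → *-comm (f i) c) (trans (sumTo-*ˡ n c f) (*-comm c (sumTo n f)))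

  interchange : ∀ a b c d → (a + b) + (c + d) ≡ (a + c) + (b + d)
  interchange = solve 4 (λ a b c d → (a :+ b) :+ (c :+ d) := (a :+ c) :+ (b :+ d)) refl

  sumTo-+ : ∀ n (f g : ℕ → ℚ) → sumTo n (λ i → f i + g i) ≡ sumTo n f + sumTo n g
  sumTo-+ zero    f g = refl
  sumTo-+ (suc n) f g = trans (cong (_+ (f n + g n)) (sumTo-+ n f g))
    (interchange (sumTo n f) (sumTo n g) (f n) (g n))

  sumTo-0 : ∀ n → sumTo n (λ _ → 0ℚ) ≡ 0ℚ
  sumTo-0 zero    = refl
  sumTo-0 (suc n) = trans (+-identityʳ (sumTo n λ _ → 0ℚ)) (sumTo-0 n)

  sumTo-∑ : ∀ n (xs : List A) (f : ℕ → A → ℚ) →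
            sumTo n (λ i → ∑ xs (f i)) ≡ ∑ xs (λ x → sumTo n (λ i → f i x))
  sumTo-∑ n []       f = sumTo-0 n
  sumTo-∑ n (x ∷ xs) f = trans (sumTo-+ n (λ i → f i x) (λ i → ∑ xs (f i)))
    (cong (λ z → sumTo n (λ i → f i x) + z) (sumTo-∑ n xs f))

  𝟙 : ∀ {P : Set} → Dec P → ℚ
  𝟙 (yes _) = 1ℚ
  𝟙 (no  _) = 0ℚ

  𝟙-nn : ∀ {P : Set} (P? : Dec P) → 0ℚ ≤ 𝟙 P?
  𝟙-nn (yes _) = 0≤1
  𝟙-nn (no  _) = ≤-refl

  𝟙≤1 : ∀ {P : Set} (P? : Dec P) → 𝟙 P? ≤ 1ℚ
  𝟙≤1 (yes _) = ≤-refl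
  𝟙≤1 (no  _) = 0≤1

  ∑-filter : ∀ {P : Pred A 0ℓ} (P? : Decidable P) xs (f : A → ℚ) →
             ∑ (filter P? xs) f ≡ ∑ xs (λ x → 𝟙 (P? x) * f x)
  ∑-filter P? []       f = refl
  ∑-filter P? (x ∷ xs) f with P? x
  ... | yes _ = cong₂ _+_ (sym (*-identityˡ (f x))) (∑-filter P? xs f)
  ... | no  _ = trans (∑-filter P? xs f)
    (trans (sym (+-identityˡ (∑ xs λ x → 𝟙 (P? x) * f x)))
           (cong (_+ ∑ xs (λ x → 𝟙 (P? x) * f x)) (sym (*-zeroˡ (f x)))))

  sumTo-indicator : ∀ n k c → k ℕ.< n → sumTo n (λ u → 𝟙 (k ℕP.≟ u) * c) ≡ c
  sumTo-indicator (suc n) k c k<n with k ℕP.≟ n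
  ... | yes refl = trans (cong₂ _+_ (vanish k ℕP.≤-refl) (*-identityˡ c)) (+-identityˡ c)
    where
    vanish : ∀ m → m ℕ.≤ k → sumTo m (λ u → 𝟙 (k ℕP.≟ u) * c) ≡ 0ℚ
    vanish zero    _ = refl
    vanish (suc m) m<k with k ℕP.≟ m
    ... | yes refl = contradiction m<k (ℕP.<-irrefl refl)
    ... | no  _    = cong₂ _+_ (vanish m (ℕP.<⇒≤ m<k)) (*-zeroˡ c)
  ... | no k≢n = trans (cong₂ _+_ (sumTo-indicator n k c (ℕP.≤∧≢⇒< (ℕP.≤-pred k<n) k≢n)) (*-zeroˡ c))
    (+-identityʳ c)

  -- Inserts the indicators of the values and exchanges the sums. It serves to split sums over
  -- moduli by their exponent at one prime.
  ∑-regroup : ∀ n (val : A → ℕ) xs (f : A → ℚ) → (∀ {x} → x ∈ xs → val x ℕ.< n) →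
              ∑ xs f ≡ sumTo n (λ u → ∑ (filter (λ x → val x ℕP.≟ u) xs) f)
  ∑-regroup n val xs f h = sym (trans
    (sum-cong n λ u → ∑-filter (λ x → val x ℕP.≟ u) xs f)
    (trans (sumTo-∑ n xs λ u x → 𝟙 (val x ℕP.≟ u) * f x)
           (∑-cong xs λ {x} x∈ → sumTo-indicator n (val x) (f x) (h x∈))))

  infixr 8 _^_

  _^_ : ℚ → ℕ → ℚ
  x ^ zero  = 1ℚ
  x ^ suc n = x * x ^ n

  ^-nn : ∀ {x} → 0ℚ ≤ x → ∀ n → 0ℚ ≤ x ^ n
  ^-nn h zero    = 0≤1
  ^-nn h (suc n) = *-nn h (^-nn h n)

  ^-+ : ∀ x m n → x ^ (m ℕ.+ n) ≡ x ^ m * x ^ n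
  ^-+ x zero    n = sym (*-identityˡ (x ^ n))
  ^-+ x (suc m) n = trans (cong (x *_) (^-+ x m n)) (sym (*-assoc x (x ^ m) (x ^ n)))

  ^-* : ∀ x y n → (x * y) ^ n ≡ x ^ n * y ^ n
  ^-* x y zero    = refl
  ^-* x y (suc n) = trans (cong (x * y *_) (^-* x y n))
    (solve 4 (λ x y a b → (x :* y) :* (a :* b) := (x :* a) :* (y :* b)) refl x y (x ^ n) (y ^ n))

  1^ : ∀ n → 1ℚ ^ n ≡ 1ℚ
  1^ zero    = refl
  1^ (suc n) = trans (*-identityˡ (1ℚ ^ n)) (1^ n)

  ^-monoˡ : ∀ {x y} → 0ℚ ≤ x → x ≤ y → ∀ n → x ^ n ≤ y ^ n
  ^-monoˡ h x≤y zero    = ≤-refl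
  ^-monoˡ h x≤y (suc n) = *-mono h x≤y (^-nn h n) (^-monoˡ h x≤y n)

  ^-antiʳ : ∀ {x m n} → 0ℚ ≤ x → x ≤ 1ℚ → m ℕ.≤ n → x ^ n ≤ x ^ m
  ^-antiʳ {x} {m} {n} 0≤x x≤1 m≤n = ≤-by-≡ˡ
    (trans (cong (x ^_) (sym (ℕP.m+[n∸m]≡n m≤n))) (^-+ x m (n ℕ.∸ m)))
    (subst (x ^ m * x ^ (n ℕ.∸ m) ≤_) (*-identityʳ (x ^ m))
      (*-monoʳ (^-nn 0≤x m) (subst (x ^ (n ℕ.∸ m) ≤_) (1^ (n ℕ.∸ m)) (^-monoˡ 0≤x x≤1 (n ℕ.∸ m)))))

  ι-^ : ∀ m n → ι (m ℕ.^ n) ≡ ι m ^ n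
  ι-^ m zero    = refl
  ι-^ m (suc n) = trans (ι-* m (m ℕ.^ n)) (cong (ι m *_) (ι-^ m n))

  -- The hypothesis says b ≥ 1 / (1 - x).
  geometric : ∀ {x b} → 0ℚ ≤ x → 1ℚ + x * b ≤ b → 0ℚ ≤ b → ∀ n → sumTo n (x ^_) ≤ b
  geometric {x} {b} 0≤x h 0≤b n = ≤-trans (p≤p+q (*-nn (^-nn 0≤x n) 0≤b)) (go n)
    where
    go : ∀ n → sumTo n (x ^_) + x ^ n * b ≤ b
    go zero    = ≤-reflexive (trans (+-identityˡ (1ℚ * b)) (*-identityˡ b))
    go (suc n) = ≤-trans
      (≤-by-≡ˡ (solve 4 (λ s y x b → (s :+ y) :+ (x :* y) :* b := s :+ y :* (con 1ℚ :+ x :* b)) refl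
                 (sumTo n (x ^_)) (x ^ n) x b)
               (+-monoʳ-≤ (sumTo n (x ^_)) (*-monoʳ (^-nn 0≤x n) h)))
      (go n)

  -- The step that replaces randomness: `P` will be the lifts missed by the finals, and `f` the
  -- potential left after a lift.
  average-<1 : ∀ n {P : Pred ℕ 0ℓ} (P? : Decidable P) (f : ℕ → ℚ) →
               sumTo n (λ i → 𝟙 (P? i) * f i) < sumTo n (λ i → 𝟙 (P? i)) →
               ∃ λ i → i ℕ.< n × P i × f i < 1ℚ
  average-<1 n {P} P? f h with search n
    where
    search : ∀ n → (∃ λ i → i ℕ.< n × P i × f i < 1ℚ) ⊎
             (sumTo n (λ i → 𝟙 (P? i)) ≤ sumTo n (λ i → 𝟙 (P? i) * f i))
    search zero    = inj₂ ≤-refl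
    search (suc n) with search n
    ... | inj₁ (i , i<n , r) = inj₁ (i , ℕP.m<n⇒m<1+n i<n , r)
    ... | inj₂ le with P? n
    ...   | no  _  = inj₂ (+-mono-≤ le (≤-reflexive (sym (*-zeroˡ (f n)))))
    ...   | yes pn with f n <? 1ℚ
    ...     | yes lt = inj₁ (n , ℕP.≤-refl , pn , lt)
    ...     | no ¬lt = inj₂ (+-mono-≤ le (subst (1ℚ ≤_) (sym (*-identityˡ (f n))) (≮⇒≥ ¬lt)))
  ... | inj₁ r  = r
  ... | inj₂ le = contradiction (<-≤-trans h le) (<-irrefl refl)

  -- The potential and its recursion over the primes.

  π : ℕ → ℚ
  π p = recip (ι p)

  -- Any value with `½ ≤ λ₀²` and `λ₀ < 1` dominates the maximum of two exponents by a product; the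
  -- room below 1 lets Rankin's weight be inserted later, as `λ₀ * θ₀ = 15/16`.
  λ₀ : ℚ
  λ₀ = + 3 / 4

  δ₀ : ℕ → ℚ
  δ₀ zero    = 1ℚ
  δ₀ (suc _) = 0ℚ

  -- κ p u u′ ≥ 2 p ^ (- max u u′) unless u = u′ = 0, when κ p u u′ ≥ 1: it bounds twice the proportion of residues
  -- at p that meet two classes of exponents u and u′, and is easily summed over u and u′.
  κ : ℕ → ℕ → ℕ → ℚ
  κ p u u′ = δ₀ u * δ₀ u′ + ι 4 * π p * (λ₀ ^ u * λ₀ ^ u′)

  -- For positive `d`: no prime factor of `d` is left to be treated.
  Ends : List ℕ → ℕ → Set
  Ends ps d = All (λ q → v q d ≡ 0) ps

  ends? : ∀ ps → Decidable (Ends ps)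
  ends? ps d = All.all? (λ q → v q d ℕP.≟ 0) ps

  -- While the primes p ∷ ps are still to be treated, the finals are the moduli with largest prime p.
  finals middles : List ℕ → List ℕ → List ℕ
  finals  ps S = filter (ends? ps) S
  middles ps S = filter (λ d → ¬? (ends? ps d)) S

  -- Nonzero only for pairs ending at the same prime `q`. The weight is then
  -- `4 q ^ (- v q d) q ^ (- v q d′)`, a term of the second moment at `q`, times one `κ` for every
  -- earlier prime, which pays for the choice made there. The 4 makes `Φ < 1` mean that at most half
  -- of the residues are hit.
  W : List ℕ → ℕ → ℕ → ℚ
  W []       d d′ = 0ℚ
  W (p ∷ ps) d d′ =
    (𝟙 (ends? ps d) * 𝟙 (ends? ps d′)) * (ι 4 * (π p ^ v p d * π p ^ v p d′)) +
    (𝟙 (¬? (ends? ps d)) * 𝟙 (¬? (ends? ps d′))) * (κ p (v p d) (v p d′) * W ps d d′)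

  -- Two lists are needed: splitting by the exponents at a prime pairs classes that belong to
  -- different exponents.
  Φ : List ℕ → List ℕ → List ℕ → ℚ
  Φ ps S S′ = ∑ S λ d → ∑ S′ λ d′ → W ps d d′

  ∑∑-filter : ∀ {A : Set} {P Q : Pred A 0ℓ} (P? : Decidable P) (Q? : Decidable Q) xs ys (X : A → A → ℚ) →
    ∑ (filter P? xs) (λ x → ∑ (filter Q? ys) (X x)) ≡
    ∑ xs (λ x → ∑ ys λ y → (𝟙 (P? x) * 𝟙 (Q? y)) * X x y)
  ∑∑-filter P? Q? xs ys X = trans (∑-filter P? xs _) (∑-cong xs λ {x} _ →
    trans (cong (𝟙 (P? x) *_) (∑-filter Q? ys (X x)))
      (trans (sym (∑-*ˡ ys (𝟙 (P? x)) (λ y → 𝟙 (Q? y) * X x y)))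
        (∑-cong ys λ {y} _ → sym (*-assoc (𝟙 (P? x)) (𝟙 (Q? y)) (X x y)))))

  ∑-+ : ∀ {A : Set} (xs : List A) (f g : A → ℚ) → ∑ xs (λ x → f x + g x) ≡ ∑ xs f + ∑ xs g
  ∑-+ []       f g = refl
  ∑-+ (x ∷ xs) f g = trans (cong (λ z → (f x + g x) + z) (∑-+ xs f g))
    (interchange (f x) (g x) (∑ xs f) (∑ xs g))

  -- Pairs ending at `p` contribute a product of two single sums, mixed pairs have weight 0, and
  -- pairs of middles are passed on with the factor `κ`.
  Φ-∷ : ∀ p ps S S′ → Φ (p ∷ ps) S S′ ≡
    ι 4 * (∑ (finals ps S) (λ d → π p ^ v p d) * ∑ (finals ps S′) (λ d → π p ^ v p d)) +
    ∑ (middles ps S) (λ d → ∑ (middles ps S′) λ d′ → κ p (v p d) (v p d′) * W ps d d′)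
  Φ-∷ p ps S S′ = trans
    (trans (∑-cong S λ {d} _ → ∑-+ S′ (F d) (G d)) (∑-+ S (λ d → ∑ S′ (F d)) (λ d → ∑ S′ (G d))))
    (cong₂ _+_
      (trans (sym (∑∑-filter (ends? ps) (ends? ps) S S′ λ d d′ → ι 4 * (g d * g d′))) product)
      (sym (∑∑-filter (λ d → ¬? (ends? ps d)) (λ d → ¬? (ends? ps d)) S S′
        λ d d′ → κ p (v p d) (v p d′) * W ps d d′)))
    where
    g : ℕ → ℚ
    g d = π p ^ v p d
    F G : ℕ → ℕ → ℚ
    F d d′ = (𝟙 (ends? ps d) * 𝟙 (ends? ps d′)) * (ι 4 * (g d * g d′))
    G d d′ = (𝟙 (¬? (ends? ps d)) * 𝟙 (¬? (ends? ps d′))) * (κ p (v p d) (v p d′) * W ps d d′)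
    product : ∑ (finals ps S) (λ d → ∑ (finals ps S′) λ d′ → ι 4 * (g d * g d′)) ≡
              ι 4 * (∑ (finals ps S) g * ∑ (finals ps S′) g)
    product = trans
      (∑-cong (finals ps S) λ {d} _ → trans (∑-*ˡ (finals ps S′) (ι 4) (λ d′ → g d * g d′))
        (cong (ι 4 *_) (∑-*ˡ (finals ps S′) (g d) g)))
      (trans (∑-*ˡ (finals ps S) (ι 4) (λ d → g d * ∑ (finals ps S′) g))
        (cong (ι 4 *_) (∑-*ʳ (finals ps S) (∑ (finals ps S′) g) g)))

  0≤λ₀ : 0ℚ ≤ λ₀
  0≤λ₀ = from-yes (0ℚ ≤? λ₀)

  0≤ι4 : 0ℚ ≤ ι 4
  0≤ι4 = ι-nn 4

  ι-pos : ∀ {n} → 1 ℕ.≤ n → 0ℚ < ι n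
  ι-pos h = <-≤-trans 0<1 (ι-mono h)

  π-pos : ∀ {p} → 1 ℕ.≤ p → 0ℚ < π p
  π-pos h = recip-pos (ι-pos h)

  π-inverse : ∀ {p} → 1 ℕ.≤ p → ι p * π p ≡ 1ℚ
  π-inverse h = recip-inverse (ι-pos h)

  π≤½ : ∀ {p} → 2 ℕ.≤ p → π p ≤ ½
  π≤½ h = recip-anti (ι-pos {2} (s≤s z≤n)) (ι-mono h)

  δ₀-nn : ∀ u → 0ℚ ≤ δ₀ u
  δ₀-nn zero    = 0≤1
  δ₀-nn (suc _) = ≤-refl

  κ-nn : ∀ {p} → 1 ℕ.≤ p → ∀ u u′ → 0ℚ ≤ κ p u u′
  κ-nn h u u′ = +-nn (*-nn (δ₀-nn u) (δ₀-nn u′))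
    (*-nn (*-nn 0≤ι4 (<⇒≤ (π-pos h))) (*-nn (^-nn 0≤λ₀ u) (^-nn 0≤λ₀ u′)))

  W-nn : ∀ {ps} → All Prime ps → ∀ d d′ → 0ℚ ≤ W ps d d′
  W-nn [] d d′ = ≤-refl
  W-nn {p ∷ ps} (pp ∷ pps) d d′ = +-nn
    (*-nn (*-nn (𝟙-nn (ends? ps d)) (𝟙-nn (ends? ps d′)))
      (*-nn 0≤ι4 (*-nn (^-nn 0≤π (v p d)) (^-nn 0≤π (v p d′)))))
    (*-nn (*-nn (𝟙-nn (¬? (ends? ps d))) (𝟙-nn (¬? (ends? ps d′))))
      (*-nn (κ-nn 1≤p (v p d) (v p d′)) (W-nn pps d d′)))
    where
    1≤p = ℕP.<⇒≤ (prime⇒2≤ pp)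
    0≤π = <⇒≤ (π-pos 1≤p)

  -- λ₀² = 9/16 ≥ 1/2, so λ₀ ^ u * λ₀ ^ u′ dominates 2 ^ (- max u u′).
  ½^≤λ₀^ : ∀ {u u′ m} → u ℕ.≤ m → u′ ℕ.≤ m → ½ ^ m ≤ λ₀ ^ u * λ₀ ^ u′
  ½^≤λ₀^ {u} {u′} {m} u≤m u′≤m = ≤-trans
    (^-monoˡ (from-yes (0ℚ ≤? ½)) (from-yes (½ ≤? λ₀ * λ₀)) m)
    (≤-by-≡ˡ (^-* λ₀ λ₀ m) (*-mono (^-nn 0≤λ₀ m) (^-antiʳ 0≤λ₀ λ₀≤1 u≤m)
      (^-nn 0≤λ₀ m) (^-antiʳ 0≤λ₀ λ₀≤1 u′≤m)))
    where
    λ₀≤1 = from-yes (λ₀ ≤? 1ℚ)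

  -- One factor `1/p` is kept and the others are replaced by `½`, so that sums over exponents become
  -- geometric series independent of `p`.
  π^suc≤ : ∀ {p} → 2 ℕ.≤ p → ∀ n → π p ^ suc n ≤ ι 2 * π p * ½ ^ suc n
  π^suc≤ {p} 2≤p n = ≤-trans (*-monoʳ 0≤π (^-monoˡ 0≤π (π≤½ 2≤p) n))
    (≤-reflexive (trans (sym (*-identityˡ (π p * ½ ^ n)))
      (solve 4 (λ a h x y → (a :* h) :* (x :* y) := (a :* x) :* (h :* y)) refl (ι 2) ½ (π p) (½ ^ n))))
    where
    0≤π = <⇒≤ (π-pos (ℕP.<⇒≤ 2≤p))

  π^≤κ : ∀ {p u u′ m} → 2 ℕ.≤ p → 1 ℕ.≤ m → u ℕ.≤ m → u′ ℕ.≤ m → ι 2 * π p ^ m ≤ κ p u u′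
  π^≤κ {p} {u} {u′} {suc n} 2≤p _ u≤m u′≤m = begin
    ι 2 * π p ^ suc n                  ≤⟨ *-monoʳ (ι-nn 2) (π^suc≤ 2≤p n) ⟩
    ι 2 * (ι 2 * π p * ½ ^ suc n)      ≡⟨ solve 4 (λ a b x y → a :* ((b :* x) :* y) := ((a :* b) :* x) :* y) refl (ι 2) (ι 2) (π p) (½ ^ suc n) ⟩
    ι 4 * π p * ½ ^ suc n              ≤⟨ *-monoʳ (*-nn 0≤ι4 (<⇒≤ (π-pos (ℕP.<⇒≤ 2≤p)))) (½^≤λ₀^ u≤m u′≤m) ⟩
    ι 4 * π p * (λ₀ ^ u * λ₀ ^ u′)     ≤⟨ q≤p+q (*-nn (δ₀-nn u) (δ₀-nn u′)) ⟩
    κ p u u′                           ∎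
    where open ≤-Reasoning

  1≤κ00 : ∀ {p} → 1 ℕ.≤ p → 1ℚ ≤ κ p 0 0
  1≤κ00 {p} h = p≤p+q (*-nn (*-nn 0≤ι4 (<⇒≤ (π-pos h))) (from-yes (0ℚ ≤? 1ℚ * 1ℚ)))

  -- Counting by gaps and the union bound.

  module _ {P : Pred ℕ 0ℓ} (P? : Decidable P) {q : ℕ}
           (gap : ∀ {t t′} → t ℕ.< t′ → P t → P t′ → t ℕ.+ q ℕ.≤ t′) where

    private
      -- If the last point of the window lies in `P`, the gap excludes all earlier ones; otherwise
      -- the window is shortened.
      window : ∀ b m → m ℕ.≤ q → sumTo m (λ j → 𝟙 (P? (b ℕ.+ j))) ≤ 1ℚ
      window b zero    _   = 0≤1
      window b (suc m) m<q with P? (b ℕ.+ m)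
      ... | no  _ = ≤-by-≡ˡ (+-identityʳ _) (window b m (ℕP.<⇒≤ m<q))
      ... | yes h = ≤-by-≡ˡ (cong (_+ 1ℚ) (none m ℕP.≤-refl)) (≤-reflexive (+-identityˡ 1ℚ))
        where
        none : ∀ l → l ℕ.≤ m → sumTo l (λ j → 𝟙 (P? (b ℕ.+ j))) ≡ 0ℚ
        none zero    _   = refl
        none (suc l) l<m with P? (b ℕ.+ l)
        ... | no  _  = trans (+-identityʳ _) (none l (ℕP.<⇒≤ l<m))
        ... | yes h′ = contradiction
          (ℕP.≤-trans (ℕP.+-monoʳ-≤ b (ℕP.≤-trans m<q (ℕP.m≤n+m q l)))
            (subst (ℕ._≤ b ℕ.+ m) (ℕP.+-assoc b l q) (gap (ℕP.+-monoʳ-< b l<m) h′ h)))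
          (λ le → ℕP.<-irrefl refl (ℕP.+-cancelˡ-≤ b _ _ le))

    gap-count≤ : ∀ s → sumTo (s ℕ.* q) (λ t → 𝟙 (P? t)) ≤ ι s
    gap-count≤ s = ≤-by-≡ˡ (sum-block s q (λ t → 𝟙 (P? t)))
      (≤-trans (sumTo-mono s λ i _ → window (i ℕ.* q) q ℕP.≤-refl)
        (≤-reflexive (trans (sum-const s 1ℚ) (*-identityʳ (ι s)))))

  𝟙-*≤ˡ : ∀ {P Q : Set} (P? : Dec P) (Q? : Dec Q) → 𝟙 P? * 𝟙 Q? ≤ 𝟙 P?
  𝟙-*≤ˡ P? Q? = subst (𝟙 P? * 𝟙 Q? ≤_) (*-identityʳ (𝟙 P?)) (*-monoʳ (𝟙-nn P?) (𝟙≤1 Q?))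

  𝟙-*≤ʳ : ∀ {P Q : Set} (P? : Dec P) (Q? : Dec Q) → 𝟙 P? * 𝟙 Q? ≤ 𝟙 Q?
  𝟙-*≤ʳ P? Q? = ≤-by-≡ˡ (*-comm (𝟙 P?) (𝟙 Q?)) (𝟙-*≤ˡ Q? P?)

  -- The union bound at a single point; it is summed over the lifts later.
  1≤𝟙+∑ : ∀ {P : Pred ℕ 0ℓ} (P? : Decidable P) xs →
           1ℚ ≤ 𝟙 (All.all? (λ x → ¬? (P? x)) xs) + ∑ xs (λ x → 𝟙 (P? x))
  1≤𝟙+∑ {P} P? xs with All.all? (λ x → ¬? (P? x)) xs
  ... | yes _ = p≤p+q (∑-nn xs λ {x} _ → 𝟙-nn (P? x))
  ... | no ¬h = ≤-trans (some xs ¬h) (≤-reflexive (sym (+-identityˡ (∑ xs λ x → 𝟙 (P? x)))))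
    where
    some : ∀ xs → ¬ All (λ x → ¬ P x) xs → 1ℚ ≤ ∑ xs (λ x → 𝟙 (P? x))
    some []       ¬h = contradiction [] ¬h
    some (x ∷ xs) ¬h with P? x
    ... | yes _ = p≤p+q (∑-nn xs λ {x} _ → 𝟙-nn (P? x))
    ... | no ¬p = ≤-trans (some xs λ h → ¬h (¬p ∷ h)) (q≤p+q ≤-refl)

  2x≤1 : ∀ {x} → 0ℚ ≤ x → ι 4 * (x * x) < 1ℚ → ι 2 * x ≤ 1ℚ
  2x≤1 {x} 0≤x h with ι 2 * x ≤? 1ℚ
  ... | yes le = le
  ... | no ¬le = contradiction (≤-<-trans (≤-trans
    (*-mono {1ℚ} {ι 2 * x} {1ℚ} {ι 2 * x} 0≤1 (<⇒≤ (≰⇒> ¬le)) 0≤1 (<⇒≤ (≰⇒> ¬le)))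
    (≤-reflexive (solve 2 (λ a x → (a :* x) :* (a :* x) := (a :* a) :* (x :* x)) refl (ι 2) x))) h)
    (<-irrefl refl)

  ∣-≡ : ∀ {k i j : ℤ} → i ≡ j → k ∣ i → k ∣ j
  ∣-≡ refl h = h

  -- Fixing residues modulo one prime power after the other.

  module Avoid (r : ℕ → ℤ) (γ : ℕ) where

    -- The `p`-part of the congruence by which `d` would cover the lift `a + Q t`. Lifts are taken
    -- modulo `p ^ γ`, with `γ` at least every exponent that occurs, so the choice of `t` settles
    -- it.
    Compatible : ℕ → ℤ → ℕ → ℕ → ℕ → Set
    Compatible p a Q d t = + (p ℕ.^ v p d) ∣ (a ℤ.+ + (Q ℕ.* t)) ℤ.- r d

    module Step {p : ℕ} (pp : Prime p) (a : ℤ) {Q : ℕ} (p∤Q : ¬ p ℕD.∣ Q) where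

      compatible? : ∀ t → Decidable (λ d → Compatible p a Q d t)
      compatible? t d = + (p ℕ.^ v p d) ∣? ((a ℤ.+ + (Q ℕ.* t)) ℤ.- r d)

      N : ℕ
      N = p ℕ.^ γ

      1≤p = ℕP.<⇒≤ (prime⇒2≤ pp)

      -- Subtracting the two congruences gives `p ^ v p d ∣ Q * (t′ - t)`, where `Q` is prime to
      -- `p`.
      gap : ∀ d {t t′} → t ℕ.< t′ → Compatible p a Q d t → Compatible p a Q d t′ → t ℕ.+ p ℕ.^ v p d ℕ.≤ t′
      gap d {t} {t′} t<t′ h h′ = subst (t ℕ.+ p ℕ.^ v p d ℕ.≤_) (ℕP.m+[n∸m]≡n (ℕP.<⇒≤ t<t′))
        (ℕP.+-monoʳ-≤ t (ℕD.∣⇒≤ {{ℕ.>-nonZero (ℕP.m<n⇒0<n∸m t<t′)}}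
          (prime∤⇒^∣-cancel pp p∤Q (v p d) (ℤD.∣⇒∣ᵤ (∣-≡ difference (ℤD.∣m∣n⇒∣m-n h′ h))))))
        where
        e : ∀ a r x y → ((a ℤ.+ (x ℤ.+ y)) ℤ.- r) ℤ.- ((a ℤ.+ x) ℤ.- r) ≡ y
        e = solve-∀
        difference : ((a ℤ.+ + (Q ℕ.* t′)) ℤ.- r d) ℤ.- ((a ℤ.+ + (Q ℕ.* t)) ℤ.- r d) ≡ + (Q ℕ.* (t′ ℕ.∸ t))
        difference = trans
          (cong (λ z → ((a ℤ.+ z) ℤ.- r d) ℤ.- ((a ℤ.+ + (Q ℕ.* t)) ℤ.- r d))
            (trans (cong (λ z → + (Q ℕ.* z)) (sym (ℕP.m+[n∸m]≡n (ℕP.<⇒≤ t<t′))))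
              (trans (cong +_ (ℕP.*-distribˡ-+ Q t (t′ ℕ.∸ t))) (ℤP.pos-+ (Q ℕ.* t) (Q ℕ.* (t′ ℕ.∸ t))))))
          (e a (r d) (+ (Q ℕ.* t)) (+ (Q ℕ.* (t′ ℕ.∸ t))))

      -- The `N` lifts form `s` blocks of length `p ^ v p d`, each with at most one compatible lift.
      density : ∀ d → v p d ℕ.≤ γ → sumTo N (λ t → 𝟙 (compatible? t d)) ≤ ι N * π p ^ v p d
      density d v≤γ = subst₂ _≤_
        (cong (λ n → sumTo n (λ t → 𝟙 (compatible? t d))) N≡)
        (trans (sym (*-identityʳ _)) (trans (cong (ι s *_) (sym one))
          (trans (sym (*-assoc (ι s) (ι (p ℕ.^ u)) (π p ^ u)))
            (cong (_* π p ^ u) (trans (sym (ι-* s (p ℕ.^ u))) (cong ι N≡))))))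
        (gap-count≤ (λ t → compatible? t d) (gap d) s)
        where
        u s : ℕ
        u = v p d
        s = p ℕ.^ (γ ℕ.∸ u)
        N≡ : s ℕ.* p ℕ.^ u ≡ N
        N≡ = trans (sym (ℕP.^-distribˡ-+-* p (γ ℕ.∸ u) u)) (cong (p ℕ.^_) (ℕP.m∸n+n≡m v≤γ))
        one : ι (p ℕ.^ u) * π p ^ u ≡ 1ℚ
        one = trans (cong (_* π p ^ u) (ι-^ p u)) (trans (sym (^-* (ι p) (π p) u))
          (trans (cong (_^ u) (π-inverse 1≤p)) (1^ u)))

      module _ (E : List ℕ) (v≤γ : ∀ {d} → d ∈ E → v p d ℕ.≤ γ) where

        Good : Pred ℕ 0ℓ
        Good t = All (λ d → ¬ Compatible p a Q d t) E

        good? : Decidable Good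
        good? t = All.all? (λ d → ¬? (compatible? t d)) E

        G α : ℚ
        G = sumTo N (λ t → 𝟙 (good? t))
        α = ∑ E (λ d → π p ^ v p d)

        -- The union bound gives `N ≤ G + N α`, and `α ≤ ½`; everything is doubled to avoid
        -- division.
        ιN≤2G : ι 2 * α ≤ 1ℚ → ι N ≤ ι 2 * G
        ιN≤2G 2α≤1 = subst₂ _≤_
          (solve 2 (λ n g → (n :+ n) :- n := n) refl (ι N) G)
          (solve 2 (λ n g → (con (ι 2) :* g :+ n) :- n := con (ι 2) :* g) refl (ι N) G)
          (+-monoˡ-≤ (- ι N) double)
          where
          cover : ι N ≤ G + ι N * α
          cover = begin
            ι N                                                        ≡⟨ sym (*-identityʳ (ι N)) ⟩
            ι N * 1ℚ                                                   ≡⟨ sym (sum-const N 1ℚ) ⟩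
            sumTo N (λ _ → 1ℚ)                                         ≤⟨ sumTo-mono N (λ t _ → 1≤𝟙+∑ (compatible? t) E) ⟩
            sumTo N (λ t → 𝟙 (good? t) + ∑ E (λ d → 𝟙 (compatible? t d)))
              ≡⟨ sumTo-+ N (λ t → 𝟙 (good? t)) (λ t → ∑ E (λ d → 𝟙 (compatible? t d))) ⟩
            G + sumTo N (λ t → ∑ E (λ d → 𝟙 (compatible? t d)))        ≡⟨ cong (λ z → G + z) (sumTo-∑ N E λ t d → 𝟙 (compatible? t d)) ⟩
            G + ∑ E (λ d → sumTo N (λ t → 𝟙 (compatible? t d)))        ≤⟨ +-monoʳ-≤ G (∑-mono E λ {d} d∈ → density d (v≤γ d∈)) ⟩
            G + ∑ E (λ d → ι N * π p ^ v p d)                          ≡⟨ cong (λ z → G + z) (∑-*ˡ E (ι N) (λ d → π p ^ v p d)) ⟩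
            G + ι N * α                                                ∎
            where open ≤-Reasoning
          double : ι N + ι N ≤ ι 2 * G + ι N
          double = begin
            ι N + ι N                         ≤⟨ +-mono-≤ cover cover ⟩
            (G + ι N * α) + (G + ι N * α)     ≡⟨ solve 3 (λ n g a → (g :+ n :* a) :+ (g :+ n :* a) := con (ι 2) :* g :+ n :* (con (ι 2) :* a)) refl (ι N) G α ⟩
            ι 2 * G + ι N * (ι 2 * α)         ≤⟨ +-monoʳ-≤ (ι 2 * G) (*-monoʳ (ι-nn N) 2α≤1) ⟩
            ι 2 * G + ι N * 1ℚ                ≡⟨ cong (λ z → ι 2 * G + z) (*-identityʳ (ι N)) ⟩
            ι 2 * G + ι N                     ∎
            where open ≤-Reasoning

        0≤G : 0ℚ ≤ G
        0≤G = sumTo-nn N λ t → 𝟙-nn (good? t)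

        -- Dropping goodness costs at most `N / G ≤ 2`, which is the 2 in the hypothesis on `k`. The
        -- modulus `e` is whichever of `d`, `d′` has the larger exponent.
        dominated : ι N ≤ ι 2 * G → ∀ d d′ e {k} → v p e ℕ.≤ γ →
          (∀ t → 𝟙 (compatible? t d) * 𝟙 (compatible? t d′) ≤ 𝟙 (compatible? t e)) →
          ι 2 * π p ^ v p e ≤ k →
          sumTo N (λ t → 𝟙 (good? t) * (𝟙 (compatible? t d) * 𝟙 (compatible? t d′))) ≤ G * k
        dominated N≤ d d′ e {k} he h hk = begin
          sumTo N (λ t → 𝟙 (good? t) * (𝟙 (compatible? t d) * 𝟙 (compatible? t d′)))
            ≤⟨ sumTo-mono N (λ t _ → ≤-trans (*-monoˡ (*-nn (𝟙-nn (compatible? t d)) (𝟙-nn (compatible? t d′))) (𝟙≤1 (good? t)))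
                 (≤-trans (≤-reflexive (*-identityˡ (𝟙 (compatible? t d) * 𝟙 (compatible? t d′)))) (h t))) ⟩
          sumTo N (λ t → 𝟙 (compatible? t e))   ≤⟨ density e he ⟩
          ι N * π p ^ v p e                     ≤⟨ *-monoˡ (^-nn (<⇒≤ (π-pos 1≤p)) (v p e)) N≤ ⟩
          ι 2 * G * π p ^ v p e                 ≡⟨ solve 3 (λ a g x → (a :* g) :* x := g :* (a :* x)) refl (ι 2) G (π p ^ v p e) ⟩
          G * (ι 2 * π p ^ v p e)               ≤⟨ *-monoʳ 0≤G hk ⟩
          G * k                                 ∎
          where open ≤-Reasoning

        -- Two conditions are bounded by the stronger one. If `p` divides neither modulus, the
        -- trivial bound `G` is used instead of `dominated`, so no factor 2 is lost; without this,
        -- the losses over all primes would be exponential in their number.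
        pair-density : ι N ≤ ι 2 * G → ∀ d d′ → v p d ℕ.≤ γ → v p d′ ℕ.≤ γ →
          sumTo N (λ t → 𝟙 (good? t) * (𝟙 (compatible? t d) * 𝟙 (compatible? t d′))) ≤ G * κ p (v p d) (v p d′)
        pair-density N≤ d d′ hd hd′ with ℕP.≤-total (v p d) (v p d′) | v p d ℕP.≟ 0 | v p d′ ℕP.≟ 0
        ... | _       | yes z | yes z′ = ≤-trans
          (sumTo-mono N λ t _ → ≤-trans
            (*-monoʳ (𝟙-nn (good? t)) (≤-trans (𝟙-*≤ˡ (compatible? t d) (compatible? t d′)) (𝟙≤1 (compatible? t d))))
            (≤-reflexive (*-identityʳ (𝟙 (good? t)))))
          (subst (_≤ G * κ p (v p d) (v p d′)) (*-identityʳ G)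
            (*-monoʳ 0≤G (subst₂ (λ u u′ → 1ℚ ≤ κ p u u′) (sym z) (sym z′) (1≤κ00 1≤p))))
        ... | inj₁ le | _     | no nz′ =
          dominated N≤ d d′ d′ hd′ (λ t → 𝟙-*≤ʳ (compatible? t d) (compatible? t d′))
            (π^≤κ (prime⇒2≤ pp) (ℕP.n≢0⇒n>0 nz′) le ℕP.≤-refl)
        ... | inj₁ le | no nz | yes z′ =
          contradiction (ℕP.n≤0⇒n≡0 (subst (v p d ℕ.≤_) z′ le)) nz
        ... | inj₂ le | no nz | _      =
          dominated N≤ d d′ d hd (λ t → 𝟙-*≤ˡ (compatible? t d) (compatible? t d′))
            (π^≤κ (prime⇒2≤ pp) (ℕP.n≢0⇒n>0 nz) ℕP.≤-refl le)
        ... | inj₂ le | yes z | no nz′ =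
          contradiction (ℕP.n≤0⇒n≡0 (subst (v p d′ ℕ.≤_) z le)) nz′

    -- At most half of the lifts a + Q t are hit by the finals, since 4 α² ≤ Φ < 1; averaging over the other lifts
    -- multiplies the term of a pair of middles by at most κ.
    lift : ∀ {p ps} (pp : Prime p) → All Prime ps → ∀ a {Q} (p∤Q : ¬ p ℕD.∣ Q) S →
      (∀ {d} → d ∈ S → v p d ℕ.≤ γ) → Φ (p ∷ ps) S S < 1ℚ → let open Step pp a p∤Q in
      ∃ λ t → All (λ d → ¬ Compatible p a Q d t) (finals ps S) ×
              Φ ps (filter (compatible? t) (middles ps S)) (filter (compatible? t) (middles ps S)) < 1ℚ
    lift {p} {ps} pp pps a {Q} p∤Q S v≤γ Φ<1 =
      let t , _ , g , h = average-<1 N (good? E v≤E) f average in t , g , h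
      where
      open Step pp a p∤Q
      E R : List ℕ
      E = finals ps S
      R = middles ps S
      v≤E : ∀ {d} → d ∈ E → v p d ℕ.≤ γ
      v≤E d∈ = v≤γ (proj₁ (∈-filter⁻ (ends? ps) d∈))
      v≤R : ∀ {d} → d ∈ R → v p d ℕ.≤ γ
      v≤R d∈ = v≤γ (proj₁ (∈-filter⁻ (λ d → ¬? (ends? ps d)) d∈))
      α′ G′ ΦR : ℚ
      α′ = α E v≤E
      G′ = G E v≤E
      ΦR = ∑ R λ d → ∑ R λ d′ → κ p (v p d) (v p d′) * W ps d d′
      f : ℕ → ℚ
      f t = Φ ps (filter (compatible? t) R) (filter (compatible? t) R)
      g𝟙 : ℕ → ℕ → ℕ → ℚ
      g𝟙 d d′ t = 𝟙 (good? E v≤E t) * (𝟙 (compatible? t d) * 𝟙 (compatible? t d′))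
      0≤α : 0ℚ ≤ α′
      0≤α = ∑-nn E λ {d} _ → ^-nn (<⇒≤ (π-pos 1≤p)) (v p d)
      0≤ΦR : 0ℚ ≤ ΦR
      0≤ΦR = ∑-nn R λ {d} _ → ∑-nn R λ {d′} _ → *-nn (κ-nn 1≤p (v p d) (v p d′)) (W-nn pps d d′)
      split<1 : ι 4 * (α′ * α′) + ΦR < 1ℚ
      split<1 = subst (_< 1ℚ) (Φ-∷ p ps S S) Φ<1
      ΦR<1 : ΦR < 1ℚ
      ΦR<1 = ≤-<-trans (q≤p+q (*-nn 0≤ι4 (*-nn 0≤α 0≤α))) split<1
      N≤2G : ι N ≤ ι 2 * G′
      N≤2G = ιN≤2G E v≤E (2x≤1 0≤α (≤-<-trans (p≤p+q 0≤ΦR) split<1))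
      0<G : 0ℚ < G′
      0<G = *-cancelˡ-<-nonNeg (ι 2) (subst (_< ι 2 * G′) (sym (*-zeroʳ (ι 2)))
        (<-≤-trans (ι-pos (ℕP.m^n>0 p {{prime⇒nonZero pp}} γ)) N≤2G))
      expand : ∀ t → 𝟙 (good? E v≤E t) * f t ≡ ∑ R λ d → ∑ R λ d′ → g𝟙 d d′ t * W ps d d′
      expand t = trans (cong (𝟙 (good? E v≤E t) *_) (∑∑-filter (compatible? t) (compatible? t) R R (W ps)))
        (trans (sym (∑-*ˡ R (𝟙 (good? E v≤E t)) (λ d → ∑ R λ d′ → (𝟙 (compatible? t d) * 𝟙 (compatible? t d′)) * W ps d d′)))
          (∑-cong R λ {d} _ → trans
            (sym (∑-*ˡ R (𝟙 (good? E v≤E t)) (λ d′ → (𝟙 (compatible? t d) * 𝟙 (compatible? t d′)) * W ps d d′)))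
            (∑-cong R λ {d′} _ → sym (*-assoc (𝟙 (good? E v≤E t)) (𝟙 (compatible? t d) * 𝟙 (compatible? t d′)) (W ps d d′)))))
      average : sumTo N (λ t → 𝟙 (good? E v≤E t) * f t) < G′
      average = begin-strict
        sumTo N (λ t → 𝟙 (good? E v≤E t) * f t)
          ≡⟨ sum-cong N expand ⟩
        sumTo N (λ t → ∑ R λ d → ∑ R λ d′ → g𝟙 d d′ t * W ps d d′)
          ≡⟨ sumTo-∑ N R (λ t d → ∑ R λ d′ → g𝟙 d d′ t * W ps d d′) ⟩
        ∑ R (λ d → sumTo N λ t → ∑ R λ d′ → g𝟙 d d′ t * W ps d d′)
          ≡⟨ ∑-cong R (λ {d} _ → sumTo-∑ N R (λ t d′ → g𝟙 d d′ t * W ps d d′)) ⟩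
        ∑ R (λ d → ∑ R λ d′ → sumTo N λ t → g𝟙 d d′ t * W ps d d′)
          ≡⟨ ∑-cong R (λ {d} _ → ∑-cong R λ {d′} _ → sumTo-*ʳ N (W ps d d′) (g𝟙 d d′)) ⟩
        ∑ R (λ d → ∑ R λ d′ → sumTo N (g𝟙 d d′) * W ps d d′)
          ≤⟨ ∑-mono R (λ {d} d∈ → ∑-mono R λ {d′} d′∈ → *-monoˡ (W-nn pps d d′)
               (pair-density E v≤E N≤2G d d′ (v≤R d∈) (v≤R d′∈))) ⟩
        ∑ R (λ d → ∑ R λ d′ → G′ * κ p (v p d) (v p d′) * W ps d d′)
          ≡⟨ ∑-cong R (λ {d} _ → trans (∑-cong R λ {d′} _ → *-assoc G′ (κ p (v p d) (v p d′)) (W ps d d′))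
               (∑-*ˡ R G′ (λ d′ → κ p (v p d) (v p d′) * W ps d d′))) ⟩
        ∑ R (λ d → G′ * ∑ R λ d′ → κ p (v p d) (v p d′) * W ps d d′)
          ≡⟨ ∑-*ˡ R G′ (λ d → ∑ R λ d′ → κ p (v p d) (v p d′) * W ps d d′) ⟩
        G′ * ΦR
          <⟨ *-monoʳ-<-pos G′ {{positive 0<G}} ΦR<1 ⟩
        G′ * 1ℚ
          ≡⟨ *-identityʳ G′ ⟩
        G′ ∎
        where open ≤-Reasoning

    -- `b` agrees with the lift modulo `p ^ γ`, so a `d` covering `b` must be compatible with the
    -- lift. Finals are excluded by the choice of `t`, incompatible middles are harmless from now
    -- on, and compatible ones go to the recursive call. With no primes left, `¬ Ends [] d` leaves
    -- `S` empty.
    avoid : ∀ ps → All Prime ps → Unique ps → ∀ a Q → (∀ {q} → q ∈ ps → ¬ q ℕD.∣ Q) → ∀ S →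
      (∀ {d} → d ∈ S → ∀ p → v p d ℕ.≤ γ) → (∀ {d} → d ∈ S → ¬ Ends ps d) → Φ ps S S < 1ℚ →
      ∃ λ b → (+ Q ∣ b ℤ.- a) × (∀ {d} → d ∈ S → ¬ (+ d ∣ b ℤ.- r d))
    avoid [] _ _ a Q _ S _ ¬ends _ = a , ∣-≡ (sym (ℤP.+-inverseʳ a)) (ℤD.∣ᵤ⇒∣ (Q ℕD.∣0)) ,
      λ d∈ → contradiction [] (¬ends d∈)
    avoid (p ∷ ps) (pp ∷ pps) (p∉ ∷ u) a Q ∤Q S v≤γ ¬ends Φ<1 =
      let t , good , Φ′ = lift pp pps a (∤Q (here refl)) S (λ d∈ → v≤γ d∈ p) Φ<1
          b , Q′∣ , avoids = avoid ps pps u (a ℤ.+ + (Q ℕ.* t)) (Q ℕ.* p ℕ.^ γ) ∤Q′ (S′ t)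
            (λ d∈ → v≤γ (S′⊆S t d∈)) (λ d∈ → proj₂ (∈-filter⁻ (λ d → ¬? (ends? ps d)) {xs = S} (S′⊆R t d∈))) Φ′
      in b , ∣-≡ (e₁ b a (+ (Q ℕ.* t)))
               (ℤD.∣m∣n⇒∣m+n (ℤD.∣-trans (ℤD.∣ᵤ⇒∣ (ℕD.m∣m*n (p ℕ.^ γ))) Q′∣) (ℤD.∣ᵤ⇒∣ (ℕD.m∣m*n t))) ,
         λ {d} d∈ d∣ → step t b good Q′∣ avoids d∈ d∣
      where
      open Step pp a (∤Q (here refl))
      S′ : ℕ → List ℕ
      S′ t = filter (compatible? t) (middles ps S)
      S′⊆R : ∀ t {d} → d ∈ S′ t → d ∈ middles ps S
      S′⊆R t d∈ = proj₁ (∈-filter⁻ (compatible? t) {xs = middles ps S} d∈)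
      S′⊆S : ∀ t {d} → d ∈ S′ t → d ∈ S
      S′⊆S t d∈ = proj₁ (∈-filter⁻ (λ d → ¬? (ends? ps d)) (S′⊆R t d∈))
      ∤Q′ : ∀ {q} → q ∈ ps → ¬ q ℕD.∣ Q ℕ.* p ℕ.^ γ
      ∤Q′ q∈ = distinct-primes-∣ (All.lookup pps q∈) pp (λ q≡p → All.lookup p∉ q∈ (sym q≡p)) (∤Q (there q∈)) γ
      e₁ : ∀ b a x → (b ℤ.- (a ℤ.+ x)) ℤ.+ x ≡ b ℤ.- a
      e₁ = solve-∀
      e₂ : ∀ b a r → (b ℤ.- r) ℤ.- (b ℤ.- a) ≡ a ℤ.- r
      e₂ = solve-∀
      step : ∀ t b → All (λ d → ¬ Compatible p a Q d t) (finals ps S) →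
        + (Q ℕ.* p ℕ.^ γ) ∣ b ℤ.- (a ℤ.+ + (Q ℕ.* t)) → (∀ {d} → d ∈ S′ t → ¬ (+ d ∣ b ℤ.- r d)) →
        ∀ {d} → d ∈ S → ¬ (+ d ∣ b ℤ.- r d)
      step t b good Q′∣ avoids {d} d∈ d∣ with ends? ps d
      ... | yes ends = All.lookup good (∈-filter⁺ (ends? ps) d∈ ends) compat
        where
        compat : Compatible p a Q d t
        compat = ∣-≡ (e₂ b (a ℤ.+ + (Q ℕ.* t)) (r d)) (ℤD.∣m∣n⇒∣m-n (ℤD.∣-trans (ℤD.∣ᵤ⇒∣ (p^v∣ p d)) d∣)
          (ℤD.∣-trans (ℤD.∣ᵤ⇒∣ (ℕD.∣-trans (^-mono-∣ p (v≤γ d∈ p)) (ℕD.n∣m*n Q))) Q′∣))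
      ... | no ¬e = avoids (∈-filter⁺ (compatible? t) (∈-filter⁺ (λ d → ¬? (ends? ps d)) d∈ ¬e) compat) d∣
        where
        compat : Compatible p a Q d t
        compat = ∣-≡ (e₂ b (a ℤ.+ + (Q ℕ.* t)) (r d)) (ℤD.∣m∣n⇒∣m-n (ℤD.∣-trans (ℤD.∣ᵤ⇒∣ (p^v∣ p d)) d∣)
          (ℤD.∣-trans (ℤD.∣ᵤ⇒∣ (ℕD.∣-trans (^-mono-∣ p (v≤γ d∈ p)) (ℕD.n∣m*n Q))) Q′∣))

  -- Bounding the potential, one prime at a time.

  record Distinguished (ps S : List ℕ) : Set where
    field
      unique  : Unique S
      -- The form taken by distinctness of the moduli once their exponents at earlier primes have
      -- been fixed.
      agree⇒≡ : ∀ {d d′} → d ∈ S → d′ ∈ S → (∀ {q} → q ∈ ps → v q d ≡ v q d′) → d ≡ d′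
      ¬ends   : ∀ {d} → d ∈ S → ¬ Ends ps d

  open Distinguished

  at : ℕ → ℕ → List ℕ → List ℕ
  at p u = filter (λ d → v p d ℕP.≟ u)

  ∈at⁻ : ∀ p u S {d} → d ∈ at p u S → d ∈ S × v p d ≡ u
  ∈at⁻ p u S = ∈-filter⁻ (λ d → v p d ℕP.≟ u) {xs = S}

  ∈finals⁻ : ∀ ps S {d} → d ∈ finals ps S → d ∈ S × Ends ps d
  ∈finals⁻ ps S = ∈-filter⁻ (ends? ps) {xs = S}

  ∈middles⁻ : ∀ ps S {d} → d ∈ middles ps S → d ∈ S × ¬ Ends ps d
  ∈middles⁻ ps S = ∈-filter⁻ (λ d → ¬? (ends? ps d)) {xs = S}

  at-distinguished : ∀ {p ps S} → Distinguished (p ∷ ps) S → ∀ u →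
                     Distinguished ps (at p u (middles ps S))
  at-distinguished {p} {ps} {S} D u = record
    { unique  = Unique.filter⁺ (λ d → v p d ℕP.≟ u) (Unique.filter⁺ (λ d → ¬? (ends? ps d)) (unique D))
    ; agree⇒≡ = λ d∈ d′∈ h →
        let d∈R , d≡ = ∈at⁻ p u (middles ps S) d∈
            d′∈R , d′≡ = ∈at⁻ p u (middles ps S) d′∈
        in agree⇒≡ D (proj₁ (∈middles⁻ ps S d∈R)) (proj₁ (∈middles⁻ ps S d′∈R))
          λ { (here refl) → trans d≡ (sym d′≡) ; (there q∈) → h q∈ }
    ; ¬ends   = λ d∈ → proj₂ (∈middles⁻ ps S (proj₁ (∈at⁻ p u (middles ps S) d∈)))
    }

  exponentBound : ∀ p (S : List ℕ) → ∃ λ n → ∀ {d} → d ∈ S → v p d ℕ.< n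
  exponentBound p []      = 0 , λ ()
  exponentBound p (d ∷ S) = let n , h = exponentBound p S in suc (v p d) ℕ.⊔ n , λ
    { (here refl) → ℕP.m≤m⊔n (suc (v p d)) n
    ; (there d∈)  → ℕP.≤-trans (h d∈) (ℕP.m≤n⊔m (suc (v p d)) n) }

  ∑-all-equal : ∀ {A : Set} (xs : List A) {f : A → ℚ} {c} → Unique xs → (∀ {x y} → x ∈ xs → y ∈ xs → x ≡ y) →
                0ℚ ≤ c → (∀ {x} → x ∈ xs → f x ≤ c) → ∑ xs f ≤ c
  ∑-all-equal []           _ _ 0≤c _ = 0≤c
  ∑-all-equal (x ∷ [])     {f} _ _ _   h = ≤-by-≡ˡ (+-identityʳ (f x)) (h (here refl))
  ∑-all-equal (x ∷ y ∷ xs) ((x≢y ∷ _) ∷ _) eq _ _ = contradiction (eq (here refl) (there (here refl))) x≢y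

  -- Finals differ only in their exponent at `p`, so each exponent occurs at most once and the sum
  -- is part of a geometric series. This is where distinctness pays off.
  ∑-finals : ∀ {p ps S x b} → Distinguished (p ∷ ps) S → 0ℚ ≤ x → 1ℚ + x * b ≤ b → 0ℚ ≤ b →
             ∑ (finals ps S) (λ d → x ^ v p d) ≤ b
  ∑-finals {p} {ps} {S} {x} {b} D 0≤x hb 0≤b with exponentBound p (finals ps S)
  ... | n , v<n = ≤-trans (≤-by-≡ˡ (∑-regroup n (v p) (finals ps S) (λ d → x ^ v p d) v<n)
    (sumTo-mono n λ u _ → ∑-all-equal (at p u (finals ps S))
      (Unique.filter⁺ (λ d → v p d ℕP.≟ u) (Unique.filter⁺ (ends? ps) (unique D)))
      (λ d∈ d′∈ →
        let d∈E  , d≡  = ∈at⁻ p u (finals ps S) d∈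
            d′∈E , d′≡ = ∈at⁻ p u (finals ps S) d′∈
            d∈S  , e   = ∈finals⁻ ps S d∈E
            d′∈S , e′  = ∈finals⁻ ps S d′∈E
        in agree⇒≡ D d∈S d′∈S λ
          { (here refl) → trans d≡ (sym d′≡)
          ; (there q∈)  → trans (All.lookup e q∈) (sym (All.lookup e′ q∈)) })
      (^-nn 0≤x u)
      (λ d∈ → ≤-reflexive (cong (x ^_) (proj₂ (∈at⁻ p u (finals ps S) d∈))))))
    (geometric 0≤x hb 0≤b n)

  finals-exponent : ∀ {p ps S} → Distinguished (p ∷ ps) S → ∀ {d} → d ∈ finals ps S → ¬ v p d ≡ 0
  finals-exponent {p} {ps} {S} D d∈ v≡0 =
    let d∈S , e = ∈finals⁻ ps S d∈ in ¬ends D d∈S (v≡0 ∷ e)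

  π^v≤ : ∀ {p u} → 2 ℕ.≤ p → ¬ u ≡ 0 → π p ^ u ≤ ι 2 * π p * ½ ^ u
  π^v≤ {u = zero}  _ u≢0 = contradiction refl u≢0
  π^v≤ {u = suc n} h _   = π^suc≤ h n

  -- A final has positive exponent at `p`, so a factor `1/p` comes out; its square makes the sum
  -- over all primes converge.
  ∑-finals-π : ∀ {p ps S} → Prime p → Distinguished (p ∷ ps) S →
               ∑ (finals ps S) (λ d → π p ^ v p d) ≤ ι 4 * π p
  ∑-finals-π {p} {ps} {S} pp D = begin
    ∑ E (λ d → π p ^ v p d)                  ≤⟨ ∑-mono E (λ d∈ → π^v≤ (prime⇒2≤ pp) (finals-exponent {ps = ps} D d∈)) ⟩
    ∑ E (λ d → ι 2 * π p * ½ ^ v p d)        ≡⟨ ∑-*ˡ E (ι 2 * π p) (λ d → ½ ^ v p d) ⟩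
    ι 2 * π p * ∑ E (λ d → ½ ^ v p d)        ≤⟨ *-monoʳ (*-nn (ι-nn 2) (<⇒≤ (π-pos (ℕP.<⇒≤ (prime⇒2≤ pp)))))
                                                  (∑-finals {ps = ps} D (from-yes (0ℚ ≤? ½)) (from-yes (1ℚ + ½ * ι 2 ≤? ι 2)) (ι-nn 2)) ⟩
    ι 2 * π p * ι 2                          ≡⟨ solve 1 (λ x → con (ι 2) :* x :* con (ι 2) := con (ι 4) :* x) refl (π p) ⟩
    ι 4 * π p                                ∎
    where
    open ≤-Reasoning
    E = finals ps S

  -- Bounds the sum of `κ p u u′` over `u′`: here `16 = 4 · 4`, the second 4 being the geometric sum
  -- of `λ₀`.
  κ̄ : ℕ → ℕ → ℚ
  κ̄ p u = δ₀ u + ι 16 * π p * λ₀ ^ u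

  sumTo-δ₀ : ∀ n → sumTo n δ₀ ≤ 1ℚ
  sumTo-δ₀ zero          = 0≤1
  sumTo-δ₀ (suc zero)    = ≤-refl
  sumTo-δ₀ (suc (suc n)) = ≤-by-≡ˡ (+-identityʳ (sumTo (suc n) δ₀)) (sumTo-δ₀ (suc n))

  sumTo-λ₀ : ∀ n → sumTo n (λ₀ ^_) ≤ ι 4
  sumTo-λ₀ = geometric 0≤λ₀ (from-yes (1ℚ + λ₀ * ι 4 ≤? ι 4)) 0≤ι4

  sumTo-κ : ∀ {p} → 1 ℕ.≤ p → ∀ u n → sumTo n (κ p u) ≤ κ̄ p u
  sumTo-κ {p} 1≤p u n = begin
    sumTo n (κ p u)
      ≡⟨ sumTo-+ n (λ u′ → δ₀ u * δ₀ u′) (λ u′ → ι 4 * π p * (λ₀ ^ u * λ₀ ^ u′)) ⟩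
    sumTo n (λ u′ → δ₀ u * δ₀ u′) + sumTo n (λ u′ → ι 4 * π p * (λ₀ ^ u * λ₀ ^ u′))
      ≡⟨ cong₂ _+_ (sumTo-*ˡ n (δ₀ u) δ₀)
          (trans (sumTo-*ˡ n (ι 4 * π p) (λ u′ → λ₀ ^ u * λ₀ ^ u′)) (cong (ι 4 * π p *_) (sumTo-*ˡ n (λ₀ ^ u) (λ₀ ^_)))) ⟩
    δ₀ u * sumTo n δ₀ + ι 4 * π p * (λ₀ ^ u * sumTo n (λ₀ ^_))
      ≤⟨ +-mono-≤ (*-monoʳ (δ₀-nn u) (sumTo-δ₀ n))
          (*-monoʳ (*-nn 0≤ι4 (<⇒≤ (π-pos 1≤p))) (*-monoʳ (^-nn 0≤λ₀ u) (sumTo-λ₀ n))) ⟩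
    δ₀ u * 1ℚ + ι 4 * π p * (λ₀ ^ u * ι 4)
      ≡⟨ solve 3 (λ d x l → d :* con 1ℚ :+ con (ι 4) :* x :* (l :* con (ι 4)) := d :+ con (ι 16) :* x :* l) refl (δ₀ u) (π p) (λ₀ ^ u) ⟩
    κ̄ p u ∎
    where open ≤-Reasoning

  κ̄-nn : ∀ {p} → 1 ℕ.≤ p → ∀ u → 0ℚ ≤ κ̄ p u
  κ̄-nn 1≤p u = +-nn (δ₀-nn u) (*-nn (*-nn (ι-nn 16) (<⇒≤ (π-pos 1≤p))) (^-nn 0≤λ₀ u))

  -- On a pair of exponent classes `κ` is constant and the rest is `Φ ps`. The bound `b` may vary
  -- with `u`, because in Rankin's argument the exponent at `p` uses up part of the required prime
  -- factors of the first modulus.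
  middles-bound : ∀ {p ps S S′} (b : ℕ → ℚ) → 1 ℕ.≤ p →
    (∀ u → 0ℚ ≤ b u) → (∀ u u′ → Φ ps (at p u (middles ps S)) (at p u′ (middles ps S′)) ≤ b u) →
    ∃ λ n → ∑ (middles ps S) (λ d → ∑ (middles ps S′) λ d′ → κ p (v p d) (v p d′) * W ps d d′) ≤
            sumTo n (λ u → κ̄ p u * b u)
  middles-bound {p} {ps} {S} {S′} b 1≤p 0≤b hb = n , (begin
    ∑ R (λ d → ∑ R′ λ d′ → κ p (v p d) (v p d′) * W ps d d′)
      ≡⟨ ∑-regroup n (v p) R (λ d → ∑ R′ λ d′ → κ p (v p d) (v p d′) * W ps d d′) v<n ⟩
    sumTo n (λ u → ∑ (at p u R) λ d → ∑ R′ λ d′ → κ p (v p d) (v p d′) * W ps d d′)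
      ≡⟨ sum-cong n (λ u → inner u) ⟩
    sumTo n (λ u → sumTo n′ λ u′ → κ p u u′ * Φ ps (at p u R) (at p u′ R′))
      ≤⟨ sumTo-mono n (λ u _ → sumTo-mono n′ λ u′ _ → *-monoʳ (κ-nn 1≤p u u′) (hb u u′)) ⟩
    sumTo n (λ u → sumTo n′ λ u′ → κ p u u′ * b u)
      ≡⟨ sum-cong n (λ u → sumTo-*ʳ n′ (b u) (κ p u)) ⟩
    sumTo n (λ u → sumTo n′ (κ p u) * b u)
      ≤⟨ sumTo-mono n (λ u _ → *-monoˡ (0≤b u) (sumTo-κ 1≤p u n′)) ⟩
    sumTo n (λ u → κ̄ p u * b u) ∎)
    where
    open ≤-Reasoning
    R R′ : List ℕ
    R  = middles ps S
    R′ = middles ps S′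
    n n′ : ℕ
    n  = proj₁ (exponentBound p R)
    n′ = proj₁ (exponentBound p R′)
    v<n : ∀ {d} → d ∈ R → v p d ℕ.< n
    v<n = proj₂ (exponentBound p R)
    inner : ∀ u → ∑ (at p u R) (λ d → ∑ R′ λ d′ → κ p (v p d) (v p d′) * W ps d d′) ≡
                  sumTo n′ (λ u′ → κ p u u′ * Φ ps (at p u R) (at p u′ R′))
    inner u = trans
      (∑-cong (at p u R) λ {d} d∈ → trans
        (∑-regroup n′ (v p) R′ (λ d′ → κ p (v p d) (v p d′) * W ps d d′) (proj₂ (exponentBound p R′)))
        (sum-cong n′ λ u′ → trans
          (∑-cong (at p u′ R′) λ {d′} d′∈ → cong₂ (λ x y → κ p x y * W ps d d′)
            (proj₂ (∈at⁻ p u R d∈)) (proj₂ (∈at⁻ p u′ R′ d′∈)))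
          (∑-*ˡ (at p u′ R′) (κ p u u′) (W ps d))))
      (trans (sym (sumTo-∑ n′ (at p u R) λ u′ d → κ p u u′ * ∑ (at p u′ R′) (W ps d)))
        (sum-cong n′ λ u′ → ∑-*ˡ (at p u R) (κ p u u′) (λ d → ∑ (at p u′ R′) (W ps d))))

  -- The condition on `c` says `c ≥ 1 / (1 - λ₀ y)`. It is used with `y = 1`, `c = 4` and, for
  -- Rankin's trick, with `y = θ₀`, `c = 16`.
  sumTo-κ̄ : ∀ {p y c} → 1 ℕ.≤ p → 1ℚ ≤ y → 1ℚ + λ₀ * y * c ≤ c → 0ℚ ≤ c → ∀ n →
            sumTo n (λ u → κ̄ p u * y ^ u) ≤ 1ℚ + ι 16 * π p * c
  sumTo-κ̄ {p} {y} {c} 1≤p 1≤y hc 0≤c n = begin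
    sumTo n (λ u → κ̄ p u * y ^ u)
      ≡⟨ sum-cong n (λ u → trans (*-distribʳ-+ (y ^ u) (δ₀ u) (ι 16 * π p * λ₀ ^ u))
          (cong₂ _+_ (δ₀-^ u) (trans (*-assoc (ι 16 * π p) (λ₀ ^ u) (y ^ u)) (cong (ι 16 * π p *_) (sym (^-* λ₀ y u)))))) ⟩
    sumTo n (λ u → δ₀ u + ι 16 * π p * (λ₀ * y) ^ u)
      ≡⟨ sumTo-+ n δ₀ (λ u → ι 16 * π p * (λ₀ * y) ^ u) ⟩
    sumTo n δ₀ + sumTo n (λ u → ι 16 * π p * (λ₀ * y) ^ u)
      ≤⟨ +-mono-≤ (sumTo-δ₀ n) (≤-by-≡ˡ (sumTo-*ˡ n (ι 16 * π p) ((λ₀ * y) ^_))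
          (*-monoʳ (*-nn (ι-nn 16) (<⇒≤ (π-pos 1≤p)))
            (geometric (*-nn 0≤λ₀ (≤-trans 0≤1 1≤y)) hc 0≤c n))) ⟩
    1ℚ + ι 16 * π p * c ∎
    where
    open ≤-Reasoning
    δ₀-^ : ∀ u → δ₀ u * y ^ u ≡ δ₀ u
    δ₀-^ zero    = refl
    δ₀-^ (suc u) = *-zeroˡ (y ^ suc u)

  Bounded : List ℕ → ℚ → Set
  Bounded ps b = ∀ {S S′} → Distinguished ps S → Distinguished ps S′ → Φ ps S S′ ≤ b

  Bounded-[] : Bounded [] 0ℚ
  Bounded-[] {[]}    _ _ = ≤-refl
  Bounded-[] {d ∷ S} D _ = contradiction [] (¬ends D (here refl))

  -- `64 = 4 · 4 · 4` for the finals and `64 = 16 · 4` for the middles. Iterated, this is the sum of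
  -- `64/p²` times the product of `1 + 64/q` over the earlier primes `q`.
  Bounded-∷ : ∀ {p ps b} → Prime p → 0ℚ ≤ b → Bounded ps b →
              Bounded (p ∷ ps) (ι 64 * (π p * π p) + (1ℚ + ι 64 * π p) * b)
  Bounded-∷ {p} {ps} {b} pp 0≤b h {S} {S′} D D′ = ≤-by-≡ˡ (Φ-∷ p ps S S′) (+-mono-≤
    (≤-trans (*-monoʳ 0≤ι4 (*-mono (0≤∑ S) (∑-finals-π {ps = ps} pp D) (0≤∑ S′) (∑-finals-π {ps = ps} pp D′)))
      (≤-reflexive (solve 1 (λ x → con (ι 4) :* ((con (ι 4) :* x) :* (con (ι 4) :* x)) := con (ι 64) :* (x :* x)) refl (π p))))
    (let n , le = middles-bound {ps = ps} {S} {S′} (λ _ → b) 1≤p (λ _ → 0≤b)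
                    (λ u u′ → h (at-distinguished D u) (at-distinguished D′ u′))
     in ≤-trans le (≤-by-≡ˡ (trans (sum-cong n λ u → cong (_* b) (trans (sym (*-identityʳ (κ̄ p u))) (cong (κ̄ p u *_) (sym (1^ u)))))
          (sumTo-*ʳ n b (λ u → κ̄ p u * 1ℚ ^ u)))
        (*-monoˡ 0≤b (≤-trans (sumTo-κ̄ {c = ι 4} 1≤p ≤-refl (from-yes (1ℚ + λ₀ * 1ℚ * ι 4 ≤? ι 4)) 0≤ι4 n)
          (≤-reflexive (solve 1 (λ x → con 1ℚ :+ con (ι 16) :* x :* con (ι 4) := con 1ℚ :+ con (ι 64) :* x) refl (π p))))))))
    where
    1≤p = ℕP.<⇒≤ (prime⇒2≤ pp)
    0≤∑ : ∀ S → 0ℚ ≤ ∑ (finals ps S) (λ d → π p ^ v p d)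
    0≤∑ S = ∑-nn (finals ps S) λ {d} _ → ^-nn (<⇒≤ (π-pos 1≤p)) (v p d)

  -- Rankin's trick for the small primes.

  η₀ θ₀ : ℚ
  -- The gain per prime factor and its inverse. Both geometric series must survive the weight:
  -- `½ = η₀ · 5/8` for the finals, and `λ₀ θ₀ = 15/16 < 1` for the middles.
  η₀ = + 4 / 5
  θ₀ = + 5 / 4

  0≤η₀ : 0ℚ ≤ η₀
  0≤η₀ = from-yes (0ℚ ≤? η₀)

  η₀≤1 : η₀ ≤ 1ℚ
  η₀≤1 = from-yes (η₀ ≤? 1ℚ)

  Large : ℕ → List ℕ → List ℕ → ℕ → Set
  Large K ss ls d = K ℕ.≤ exponentSum ss d ⊎ ¬ Ends ls d

  -- Moduli composed of primes in ss only are supposed to have at least K prime factors, counted with multiplicity;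
  -- by Rankin's trick their contribution then decays geometrically in K.
  RankinBounded : List ℕ → List ℕ → ℚ → ℚ → Set
  RankinBounded ss ls C T = ∀ K {S S′} → Distinguished (ss ++ ls) S → Distinguished (ss ++ ls) S′ →
    (∀ {d} → d ∈ S → Large K ss ls d) → Φ (ss ++ ls) S S′ ≤ C * η₀ ^ K + T

  RankinBounded-[] : ∀ {ls T} → Bounded ls T → RankinBounded [] ls 0ℚ T
  RankinBounded-[] {ls} {T} h K D D′ _ = ≤-trans (h D D′)
    (≤-reflexive (sym (trans (cong (_+ T) (*-zeroˡ (η₀ ^ K))) (+-identityˡ T))))

  exponentSum-ends : ∀ ss {ls d} → Ends (ss ++ ls) d → exponentSum ss d ≡ 0
  exponentSum-ends []       _        = refl
  exponentSum-ends (p ∷ ss) (z ∷ zs) = cong₂ ℕ._+_ z (exponentSum-ends ss zs)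

  module RankinStep {p ss ls C T} (pp : Prime p) (0≤C : 0ℚ ≤ C) (0≤T : 0ℚ ≤ T)
                    (h : RankinBounded ss ls C T)
                    {K : ℕ} {S S′ : List ℕ} (D : Distinguished (p ∷ ss ++ ls) S) (D′ : Distinguished (p ∷ ss ++ ls) S′)
                    (large : ∀ {d} → d ∈ S → Large K (p ∷ ss) ls d) where

    ps E E′ : List ℕ
    ps = ss ++ ls
    E  = finals ps S
    E′ = finals ps S′

    1≤p = ℕP.<⇒≤ (prime⇒2≤ pp)
    0≤π = <⇒≤ (π-pos 1≤p)
    0≤η^K = ^-nn 0≤η₀ K

    -- Nothing is left after `p`, so all of the required `K` prime factors equal `p`.
    finals-large : ∀ {d} → d ∈ E → K ℕ.≤ v p d
    finals-large {d} d∈ with ∈finals⁻ ps S d∈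
    ... | d∈S , ends with large d∈S
    ...   | inj₂ ¬e = contradiction (All.++⁻ʳ ss ends) ¬e
    ...   | inj₁ le = subst (K ℕ.≤_) (trans (cong (v p d ℕ.+_) (exponentSum-ends ss ends)) (ℕP.+-identityʳ (v p d))) le

    -- In `½ = η₀ · 5/8` the first factor pays for `η₀ ^ K` and the second keeps the sum over
    -- exponents finite.
    final-term : ∀ {d} → d ∈ E → π p ^ v p d ≤ ι 2 * π p * η₀ ^ K * (+ 5 / 8) ^ v p d
    final-term {d} d∈ = begin
      π p ^ v p d                                           ≤⟨ π^v≤ (prime⇒2≤ pp) (finals-exponent {ps = ps} D d∈) ⟩
      ι 2 * π p * ½ ^ v p d                                 ≡⟨ cong (ι 2 * π p *_) (^-* η₀ (+ 5 / 8) (v p d)) ⟩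
      ι 2 * π p * (η₀ ^ v p d * (+ 5 / 8) ^ v p d)          ≤⟨ *-monoʳ (*-nn (ι-nn 2) 0≤π) (*-monoˡ (^-nn (from-yes (0ℚ ≤? + 5 / 8)) (v p d))
                                                                 (^-antiʳ 0≤η₀ η₀≤1 (finals-large d∈))) ⟩
      ι 2 * π p * (η₀ ^ K * (+ 5 / 8) ^ v p d)              ≡⟨ sym (*-assoc (ι 2 * π p) (η₀ ^ K) ((+ 5 / 8) ^ v p d)) ⟩
      ι 2 * π p * η₀ ^ K * (+ 5 / 8) ^ v p d                ∎
      where open ≤-Reasoning

    finals-sum : ∑ E (λ d → π p ^ v p d) ≤ ι 2 * π p * η₀ ^ K * ι 3
    finals-sum = ≤-trans (∑-mono E final-term)
      (≤-by-≡ˡ (∑-*ˡ E (ι 2 * π p * η₀ ^ K) (λ d → (+ 5 / 8) ^ v p d))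
        (*-monoʳ (*-nn (*-nn (ι-nn 2) 0≤π) 0≤η^K)
          (∑-finals {ps = ps} D (from-yes (0ℚ ≤? + 5 / 8)) (from-yes (1ℚ + + 5 / 8 * ι 3 ≤? ι 3)) (ι-nn 3))))

    -- Only `S` is known to be large, so one sum supplies `η₀ ^ K` and the other gets the plain
    -- bound; `96 = 4 · (2 · 3) · 4`.
    finals-product : ι 4 * (∑ E (λ d → π p ^ v p d) * ∑ E′ (λ d → π p ^ v p d)) ≤ ι 96 * η₀ ^ K
    finals-product = begin
      ι 4 * (∑ E (λ d → π p ^ v p d) * ∑ E′ (λ d → π p ^ v p d))
        ≤⟨ *-monoʳ 0≤ι4 (*-mono (∑-nn E λ {d} _ → ^-nn 0≤π (v p d)) finals-sum
             (∑-nn E′ λ {d} _ → ^-nn 0≤π (v p d)) (∑-finals-π {ps = ps} pp D′)) ⟩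
      ι 4 * ((ι 2 * π p * η₀ ^ K * ι 3) * (ι 4 * π p))
        ≡⟨ solve 2 (λ x e → con (ι 4) :* ((con (ι 2) :* x :* e :* con (ι 3)) :* (con (ι 4) :* x)) := con (ι 96) :* e :* (x :* x)) refl (π p) (η₀ ^ K) ⟩
      ι 96 * η₀ ^ K * (π p * π p)
        ≤⟨ *-monoʳ (*-nn (ι-nn 96) 0≤η^K) (≤-trans (*-mono 0≤π (π≤½ (prime⇒2≤ pp)) 0≤π (π≤½ (prime⇒2≤ pp))) (from-yes (½ * ½ ≤? 1ℚ))) ⟩
      ι 96 * η₀ ^ K * 1ℚ
        ≡⟨ *-identityʳ (ι 96 * η₀ ^ K) ⟩
      ι 96 * η₀ ^ K ∎
      where open ≤-Reasoning

    b : ℕ → ℚ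
    b u = C * η₀ ^ (K ℕ.∸ u) + T

    -- An equality for `u ≤ K`; beyond that the truncated difference is 0 and `θ₀ ^ u` outweighs
    -- `η₀ ^ K`.
    η^∸≤ : ∀ u → η₀ ^ (K ℕ.∸ u) ≤ η₀ ^ K * θ₀ ^ u
    η^∸≤ u = begin
      η₀ ^ (K ℕ.∸ u)                          ≡⟨ sym (*-identityʳ (η₀ ^ (K ℕ.∸ u))) ⟩
      η₀ ^ (K ℕ.∸ u) * 1ℚ                     ≡⟨ cong (η₀ ^ (K ℕ.∸ u) *_) (trans (sym (1^ u)) (^-* η₀ θ₀ u)) ⟩
      η₀ ^ (K ℕ.∸ u) * (η₀ ^ u * θ₀ ^ u)      ≡⟨ sym (*-assoc (η₀ ^ (K ℕ.∸ u)) (η₀ ^ u) (θ₀ ^ u)) ⟩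
      η₀ ^ (K ℕ.∸ u) * η₀ ^ u * θ₀ ^ u        ≡⟨ cong (_* θ₀ ^ u) (sym (^-+ η₀ (K ℕ.∸ u) u)) ⟩
      η₀ ^ (K ℕ.∸ u ℕ.+ u) * θ₀ ^ u           ≤⟨ *-monoˡ (^-nn (from-yes (0ℚ ≤? θ₀)) u)
                                                    (^-antiʳ 0≤η₀ η₀≤1 (subst (K ℕ.≤_) (ℕP.+-comm u (K ℕ.∸ u)) (ℕP.m≤n+m∸n K u))) ⟩
      η₀ ^ K * θ₀ ^ u                         ∎
      where open ≤-Reasoning

    middle-large : ∀ u {d} → d ∈ at p u (middles ps S) → Large (K ℕ.∸ u) ss ls d
    middle-large u {d} d∈ with ∈at⁻ p u (middles ps S) d∈
    ... | d∈R , refl with large (proj₁ (∈middles⁻ ps S d∈R))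
    ...   | inj₂ ¬e = inj₂ ¬e
    ...   | inj₁ le = inj₁ (subst (K ℕ.∸ v p d ℕ.≤_) (ℕP.m+n∸m≡n (v p d) (exponentSum ss d)) (ℕP.∸-monoˡ-≤ (v p d) le))

    -- The coefficient of `η₀ ^ K` may be crude, since `K` is chosen after it:
    -- `129 = 1 + 16 · ½ · 16` uses only `π p ≤ ½`. The factor on `T` has to keep its dependence on
    -- `p`.
    middles-sum : ∀ n → sumTo n (λ u → κ̄ p u * b u) ≤ ι 129 * C * η₀ ^ K + (1ℚ + ι 64 * π p) * T
    middles-sum n = begin
      sumTo n (λ u → κ̄ p u * b u)
        ≤⟨ sumTo-mono n (λ u _ → *-monoʳ (κ̄-nn 1≤p u) (+-monoˡ-≤ T (*-monoʳ 0≤C (η^∸≤ u)))) ⟩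
      sumTo n (λ u → κ̄ p u * (C * (η₀ ^ K * θ₀ ^ u) + T))
        ≡⟨ sum-cong n (λ u → solve 5 (λ k c e t T → k :* (c :* (e :* t) :+ T) := (k :* t) :* (c :* e) :+ (k :* con 1ℚ) :* T)
             refl (κ̄ p u) C (η₀ ^ K) (θ₀ ^ u) T) ⟩
      sumTo n (λ u → κ̄ p u * θ₀ ^ u * (C * η₀ ^ K) + κ̄ p u * 1ℚ * T)
        ≡⟨ trans (sumTo-+ n (λ u → κ̄ p u * θ₀ ^ u * (C * η₀ ^ K)) (λ u → κ̄ p u * 1ℚ * T))
             (cong₂ _+_ (sumTo-*ʳ n (C * η₀ ^ K) (λ u → κ̄ p u * θ₀ ^ u))
               (trans (sumTo-*ʳ n T (λ u → κ̄ p u * 1ℚ)) (cong (_* T) (sum-cong n λ u → cong (κ̄ p u *_) (sym (1^ u)))))) ⟩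
      sumTo n (λ u → κ̄ p u * θ₀ ^ u) * (C * η₀ ^ K) + sumTo n (λ u → κ̄ p u * 1ℚ ^ u) * T
        ≤⟨ +-mono-≤
             (*-monoˡ (*-nn 0≤C 0≤η^K) (sumTo-κ̄ 1≤p (from-yes (1ℚ ≤? θ₀)) (from-yes (1ℚ + λ₀ * θ₀ * ι 16 ≤? ι 16)) (ι-nn 16) n))
             (*-monoˡ 0≤T (sumTo-κ̄ {c = ι 4} 1≤p ≤-refl (from-yes (1ℚ + λ₀ * 1ℚ * ι 4 ≤? ι 4)) 0≤ι4 n)) ⟩
      (1ℚ + ι 16 * π p * ι 16) * (C * η₀ ^ K) + (1ℚ + ι 16 * π p * ι 4) * T
        ≤⟨ +-monoˡ-≤ ((1ℚ + ι 16 * π p * ι 4) * T) (*-monoˡ (*-nn 0≤C 0≤η^K)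
             (+-monoʳ-≤ 1ℚ (*-monoˡ (ι-nn 16) (*-monoʳ (ι-nn 16) (π≤½ (prime⇒2≤ pp)))))) ⟩
      (1ℚ + ι 16 * ½ * ι 16) * (C * η₀ ^ K) + (1ℚ + ι 16 * π p * ι 4) * T
        ≡⟨ solve 4 (λ c e x t → (con 1ℚ :+ con (ι 16) :* con ½ :* con (ι 16)) :* (c :* e) :+ (con 1ℚ :+ con (ι 16) :* x :* con (ι 4)) :* t
             := con (ι 129) :* c :* e :+ (con 1ℚ :+ con (ι 64) :* x) :* t) refl C (η₀ ^ K) (π p) T ⟩
      ι 129 * C * η₀ ^ K + (1ℚ + ι 64 * π p) * T ∎
      where open ≤-Reasoning

    bound : Φ (p ∷ ps) S S′ ≤ (ι 96 + ι 129 * C) * η₀ ^ K + (1ℚ + ι 64 * π p) * T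
    bound = begin
      Φ (p ∷ ps) S S′
        ≡⟨ Φ-∷ p ps S S′ ⟩
      ι 4 * (∑ E (λ d → π p ^ v p d) * ∑ E′ (λ d → π p ^ v p d)) +
        ∑ (middles ps S) (λ d → ∑ (middles ps S′) λ d′ → κ p (v p d) (v p d′) * W ps d d′)
        ≤⟨ +-mono-≤ finals-product (≤-trans (proj₂ mid) (middles-sum (proj₁ mid))) ⟩
      ι 96 * η₀ ^ K + (ι 129 * C * η₀ ^ K + (1ℚ + ι 64 * π p) * T)
        ≡⟨ solve 3 (λ e c t → con (ι 96) :* e :+ (con (ι 129) :* c :* e :+ t) := (con (ι 96) :+ con (ι 129) :* c) :* e :+ t)
             refl (η₀ ^ K) C ((1ℚ + ι 64 * π p) * T) ⟩
      (ι 96 + ι 129 * C) * η₀ ^ K + (1ℚ + ι 64 * π p) * T ∎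
      where
      open ≤-Reasoning
      mid = middles-bound {ps = ps} {S} {S′} b 1≤p (λ u → +-nn (*-nn 0≤C (^-nn 0≤η₀ (K ℕ.∸ u))) 0≤T)
        (λ u u′ → h (K ℕ.∸ u) (at-distinguished D u) (at-distinguished D′ u′) (middle-large u))

  -- Iterating the recursion over a block of primes with a common bound on `1/p`.

  iter : ℚ → ℚ → ℕ → ℚ → ℚ
  iter a h zero    X = X
  iter a h (suc c) X = a + (1ℚ + h) * iter a h c X

  iter-nn : ∀ {a h X} → 0ℚ ≤ a → 0ℚ ≤ h → 0ℚ ≤ X → ∀ c → 0ℚ ≤ iter a h c X
  iter-nn 0≤a 0≤h 0≤X zero    = 0≤X
  iter-nn 0≤a 0≤h 0≤X (suc c) = +-nn 0≤a (*-nn (+-nn 0≤1 0≤h) (iter-nn 0≤a 0≤h 0≤X c))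

  -- (1 + h) ^ c ≤ 1 / (1 - c h), with the inhomogeneous term carried along.
  iter-bound : ∀ {a h X} → 0ℚ ≤ a → 0ℚ ≤ h → 0ℚ ≤ X → ∀ c → ι c * h ≤ 1ℚ →
               (1ℚ - ι c * h) * iter a h c X ≤ X + ι c * a
  iter-bound {a} {h} {X} 0≤a 0≤h 0≤X zero _ = ≤-reflexive
    (solve 3 (λ h X a → (con 1ℚ :- con 0ℚ :* h) :* X := X :+ con 0ℚ :* a) refl h X a)
  iter-bound {a} {h} {X} 0≤a 0≤h 0≤X (suc c) ch≤1 = begin
    (1ℚ - ι (suc c) * h) * (a + (1ℚ + h) * Y)
      ≡⟨ cong (λ z → (1ℚ - z * h) * (a + (1ℚ + h) * Y)) (ι-suc c) ⟩
    (1ℚ - (ι c + 1ℚ) * h) * (a + (1ℚ + h) * Y)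
      ≡⟨ solve 4 (λ c h a y → (con 1ℚ :- (c :+ con 1ℚ) :* h) :* (a :+ (con 1ℚ :+ h) :* y)
           := ((con 1ℚ :- c :* h) :* y :+ a) :- ((c :+ con 1ℚ) :* (h :* (a :+ h :* y)))) refl (ι c) h a Y ⟩
    ((1ℚ - ι c * h) * Y + a) - ((ι c + 1ℚ) * (h * (a + h * Y)))
      ≤⟨ +-monoʳ-≤ ((1ℚ - ι c * h) * Y + a) (neg-antimono-≤
           (*-nn (+-nn (ι-nn c) 0≤1) (*-nn 0≤h (+-nn 0≤a (*-nn 0≤h (iter-nn 0≤a 0≤h 0≤X c)))))) ⟩
    ((1ℚ - ι c * h) * Y + a) + 0ℚ
      ≡⟨ +-identityʳ ((1ℚ - ι c * h) * Y + a) ⟩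
    (1ℚ - ι c * h) * Y + a
      ≤⟨ +-monoˡ-≤ a (iter-bound 0≤a 0≤h 0≤X c (≤-trans (*-monoˡ 0≤h (ι-mono (ℕP.n≤1+n c))) ch≤1)) ⟩
    (X + ι c * a) + a
      ≡⟨ solve 3 (λ X c a → (X :+ c :* a) :+ a := X :+ (c :+ con 1ℚ) :* a) refl X (ι c) a ⟩
    X + (ι c + 1ℚ) * a
      ≡⟨ cong (λ z → X + z * a) (sym (ι-suc c)) ⟩
    X + ι (suc c) * a ∎
    where
    open ≤-Reasoning
    Y = iter a h c X

  -- For `c h ≤ 1/3` the loss `1 / (1 - c h)` is at most 3/2, less than the factor 2 gained from one
  -- dyadic block to the next.
  iter-≤ : ∀ {a h X} → 0ℚ ≤ a → 0ℚ ≤ h → 0ℚ ≤ X → ∀ c → ι c * h ≤ + 1 / 3 →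
           iter a h c X ≤ + 3 / 2 * (X + ι c * a)
  iter-≤ {a} {h} {X} 0≤a 0≤h 0≤X c ch≤ = begin
    Y                                     ≡⟨ sym (trans (sym (*-assoc (+ 3 / 2) (+ 2 / 3) Y)) (*-identityˡ Y)) ⟩
    + 3 / 2 * (+ 2 / 3 * Y)               ≤⟨ *-monoʳ 0≤3/2 (*-monoˡ (iter-nn 0≤a 0≤h 0≤X c)
                                               (+-monoʳ-≤ 1ℚ (neg-antimono-≤ ch≤))) ⟩
    + 3 / 2 * ((1ℚ - ι c * h) * Y)        ≤⟨ *-monoʳ 0≤3/2 (iter-bound 0≤a 0≤h 0≤X c (≤-trans ch≤ (from-yes (+ 1 / 3 ≤? 1ℚ)))) ⟩
    + 3 / 2 * (X + ι c * a)               ∎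
    where
    open ≤-Reasoning
    Y = iter a h c X
    0≤3/2 = from-yes (0ℚ ≤? + 3 / 2)

  Bounded-mono : ∀ {ps b b′} → b ≤ b′ → Bounded ps b → Bounded ps b′
  Bounded-mono le h D D′ = ≤-trans (h D D′) le

  module _ {x : ℚ} (0≤x : 0ℚ ≤ x) where

    Bounded-++ : ∀ {qs ps X} → 0ℚ ≤ X → All Prime qs → All (λ p → π p ≤ x) qs → Bounded ps X →
                 Bounded (qs ++ ps) (iter (ι 64 * (x * x)) (ι 64 * x) (length qs) X)
    Bounded-++ 0≤X [] [] h = h
    Bounded-++ {p ∷ qs} {ps} {X} 0≤X (pp ∷ pps) (πp ∷ πps) h = Bounded-mono
      (+-mono-≤ (*-monoʳ (ι-nn 64) (*-mono 0≤π πp 0≤π πp)) (*-monoˡ 0≤Y (+-monoʳ-≤ 1ℚ (*-monoʳ (ι-nn 64) πp))))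
      (Bounded-∷ pp 0≤Y (Bounded-++ 0≤X pps πps h))
      where
      0≤π = <⇒≤ (π-pos (ℕP.<⇒≤ (prime⇒2≤ pp)))
      0≤Y = iter-nn (*-nn (ι-nn 64) (*-nn 0≤x 0≤x)) (*-nn (ι-nn 64) 0≤x) 0≤X (length qs)

    -- `C′` is fixed before `ls` and `T`, so it does not change when the segment of large primes
    -- grows with the moduli.
    RankinBounded-++ : ∀ {qs C} → 0ℚ ≤ C → All Prime qs → All (λ p → π p ≤ x) qs →
      ∃ λ C′ → 0ℚ ≤ C′ × (∀ {ss ls T} → 0ℚ ≤ T → RankinBounded ss ls C T →
                           RankinBounded (qs ++ ss) ls C′ (iter 0ℚ (ι 64 * x) (length qs) T))
    RankinBounded-++ {C = C} 0≤C [] [] = C , 0≤C , λ _ h → h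
    RankinBounded-++ {p ∷ qs} 0≤C (pp ∷ pps) (πp ∷ πps) =
      let C′ , 0≤C′ , f = RankinBounded-++ 0≤C pps πps in
      ι 96 + ι 129 * C′ , +-nn (ι-nn 96) (*-nn (ι-nn 129) 0≤C′) , λ {ss} {ls} {T} 0≤T h K D D′ large →
        let 0≤Y = iter-nn ≤-refl (*-nn (ι-nn 64) 0≤x) 0≤T (length qs) in
        ≤-trans (RankinStep.bound pp 0≤C′ 0≤Y (f {ss} {ls} 0≤T h) D D′ large)
          (+-monoʳ-≤ ((ι 96 + ι 129 * C′) * η₀ ^ K) (≤-trans
            (*-monoˡ 0≤Y (+-monoʳ-≤ 1ℚ (*-monoʳ (ι-nn 64) πp)))
            (≤-reflexive (sym (+-identityˡ ((1ℚ + ι 64 * x) * iter 0ℚ (ι 64 * x) (length qs) T))))))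

  ¼ : ℚ
  ¼ = + 1 / 4

  -- Bernoulli: (1 - t) ^ n (1 + n t) ≤ 1.
  power-small : ∀ {t A} → 0ℚ < t → 0ℚ ≤ 1ℚ - t → 0ℚ ≤ A → ∃ λ n → A * (1ℚ - t) ^ n ≤ ¼
  power-small {t} {A} 0<t 0≤x 0≤A with inv-small (t * recip B) (*-pos 0<t (recip-pos 0<B))
    where
    B = ι 4 * A + 1ℚ
    0<B : 0ℚ < B
    0<B = <-≤-trans 0<1 (q≤p+q (*-nn (ι-nn 4) 0≤A))
  ... | m , small = suc m , (begin
    A * x ^ suc m
      ≡⟨ solve 2 (λ a y → a :* y := con ¼ :* ((con (ι 4) :* a) :* y)) refl A (x ^ suc m) ⟩
    ¼ * (ι 4 * A * x ^ suc m)
      ≤⟨ *-monoʳ (from-yes (0ℚ ≤? ¼)) (*-monoˡ (^-nn 0≤x (suc m)) (p≤p+q {ι 4 * A} 0≤1)) ⟩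
    ¼ * (B * x ^ suc m)
      ≤⟨ *-monoʳ (from-yes (0ℚ ≤? ¼)) (*-monoˡ (^-nn 0≤x (suc m)) (≤-trans B≤ (q≤p+q 0≤1))) ⟩
    ¼ * ((1ℚ + ι (suc m) * t) * x ^ suc m)
      ≤⟨ *-monoʳ (from-yes (0ℚ ≤? ¼)) (bernoulli (suc m)) ⟩
    ¼ * 1ℚ ∎)
    where
    open ≤-Reasoning
    x B : ℚ
    x = 1ℚ - t
    B = ι 4 * A + 1ℚ
    0<B : 0ℚ < B
    0<B = <-≤-trans 0<1 (q≤p+q (*-nn (ι-nn 4) 0≤A))
    B≤ : B ≤ ι (suc m) * t
    B≤ = begin
      B                                        ≡⟨ sym (*-identityʳ B) ⟩
      B * 1ℚ                                   ≡⟨ cong (B *_) (sym (inv-inverse m)) ⟩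
      B * (inv m * ι (suc m))                  ≤⟨ *-monoʳ (<⇒≤ 0<B) (*-monoˡ (ι-nn (suc m)) (small m ℕP.≤-refl)) ⟩
      B * (t * recip B * ι (suc m))            ≡⟨ solve 4 (λ b t r n → b :* ((t :* r) :* n) := (b :* r) :* (n :* t)) refl B t (recip B) (ι (suc m)) ⟩
      B * recip B * (ι (suc m) * t)            ≡⟨ trans (cong (_* (ι (suc m) * t)) (recip-inverse 0<B)) (*-identityˡ (ι (suc m) * t)) ⟩
      ι (suc m) * t                            ∎
    bernoulli : ∀ n → (1ℚ + ι n * t) * x ^ n ≤ 1ℚ
    bernoulli zero    = ≤-reflexive (solve 1 (λ t → (con 1ℚ :+ con 0ℚ :* t) :* con 1ℚ := con 1ℚ) refl t)
    bernoulli (suc n) = begin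
      (1ℚ + ι (suc n) * t) * (x * x ^ n)
        ≡⟨ cong (λ z → (1ℚ + z * t) * (x * x ^ n)) (ι-suc n) ⟩
      (1ℚ + (ι n + 1ℚ) * t) * (x * x ^ n)
        ≡⟨ solve 3 (λ n t y → (con 1ℚ :+ (n :+ con 1ℚ) :* t) :* ((con 1ℚ :- t) :* y)
             := (con 1ℚ :+ n :* t) :* y :- ((n :+ con 1ℚ) :* (t :* t)) :* y) refl (ι n) t (x ^ n) ⟩
      (1ℚ + ι n * t) * x ^ n - ((ι n + 1ℚ) * (t * t)) * x ^ n
        ≤⟨ +-monoʳ-≤ ((1ℚ + ι n * t) * x ^ n) (neg-antimono-≤
             (*-nn (*-nn (+-nn (ι-nn n) 0≤1) (*-nn (<⇒≤ 0<t) (<⇒≤ 0<t))) (^-nn 0≤x n))) ⟩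
      (1ℚ + ι n * t) * x ^ n + 0ℚ
        ≡⟨ +-identityʳ ((1ℚ + ι n * t) * x ^ n) ⟩
      (1ℚ + ι n * t) * x ^ n
        ≤⟨ bernoulli n ⟩
      1ℚ ∎

  -- Dyadic blocks and segments of primes.

  ½^-inverse : ∀ k → ι (2 ℕ.^ k) * ½ ^ k ≡ 1ℚ
  ½^-inverse k = trans (cong (_* ½ ^ k) (ι-^ 2 k)) (trans (sym (^-* (ι 2) ½ k)) (1^ k))

  0≤½ : 0ℚ ≤ ½
  0≤½ = from-yes (0ℚ ≤? ½)

  π≤½^ : ∀ {p k} → 2 ℕ.^ k ℕ.< p → π p ≤ ½ ^ k
  π≤½^ {p} {k} h = begin
    π p                              ≡⟨ sym (*-identityʳ (π p)) ⟩
    π p * 1ℚ                         ≡⟨ cong (π p *_) (sym (½^-inverse k)) ⟩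
    π p * (ι (2 ℕ.^ k) * ½ ^ k)      ≤⟨ *-monoʳ (<⇒≤ (π-pos 1≤p)) (*-monoˡ (^-nn 0≤½ k) (ι-mono (ℕP.<⇒≤ h))) ⟩
    π p * (ι p * ½ ^ k)              ≡⟨ solve 3 (λ a b c → a :* (b :* c) := (b :* a) :* c) refl (π p) (ι p) (½ ^ k) ⟩
    ι p * π p * ½ ^ k                ≡⟨ trans (cong (_* ½ ^ k) (π-inverse 1≤p)) (*-identityˡ (½ ^ k)) ⟩
    ½ ^ k                            ∎
    where
    open ≤-Reasoning
    1≤p : 1 ℕ.≤ p
    1≤p = ℕP.≤-trans (s≤s z≤n) h

  -- m stands for 384 = 6 · 64: for k ≥ 384, Chebyshev's k · #primes ≤ 2 · 2 ^ k gives 64 · #primes / 2 ^ k ≤ 1/3.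
  -- It is a variable so that the type checker does not unfold it.
  primesIn-sparse-by : ∀ m {k} → ι 64 ≡ + 1 / 6 * ι m → m ℕ.≤ k → ι (length (primesIn k)) * (ι 64 * ½ ^ k) ≤ + 1 / 3
  primesIn-sparse-by m {k} e h = begin
    ι c * (ι 64 * ½ ^ k)
      ≡⟨ cong (λ z → ι c * (z * ½ ^ k)) e ⟩
    ι c * (+ 1 / 6 * ι m * ½ ^ k)
      ≡⟨ solve 4 (λ c s n x → c :* ((s :* n) :* x) := s :* ((n :* c) :* x)) refl (ι c) (+ 1 / 6) (ι m) (½ ^ k) ⟩
    + 1 / 6 * (ι m * ι c * ½ ^ k)
      ≤⟨ *-monoʳ (from-yes (0ℚ ≤? + 1 / 6)) (*-monoˡ (^-nn 0≤½ k) (≤-by-≡ˡ (sym (ι-* m c))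
           (ι-mono (ℕP.≤-trans (ℕP.*-monoˡ-≤ c h) (primesIn-length k))))) ⟩
    + 1 / 6 * (ι (2 ℕ.* 2 ℕ.^ k) * ½ ^ k)
      ≡⟨ cong (λ z → + 1 / 6 * (z * ½ ^ k)) (ι-* 2 (2 ℕ.^ k)) ⟩
    + 1 / 6 * (ι 2 * ι (2 ℕ.^ k) * ½ ^ k)
      ≡⟨ solve 2 (λ n x → con (+ 1 / 6) :* ((con (ι 2) :* n) :* x) := con (+ 1 / 3) :* (n :* x)) refl (ι (2 ℕ.^ k)) (½ ^ k) ⟩
    + 1 / 3 * (ι (2 ℕ.^ k) * ½ ^ k)
      ≡⟨ trans (cong (+ 1 / 3 *_) (½^-inverse k)) (*-identityʳ (+ 1 / 3)) ⟩
    + 1 / 3 ∎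
    where
    open ≤-Reasoning
    c = length (primesIn k)

  primesIn-sparse : ∀ {k} → 384 ℕ.≤ k → ι (length (primesIn k)) * (ι 64 * ½ ^ k) ≤ + 1 / 3
  primesIn-sparse = primesIn-sparse-by 384 refl

  primesIn-prime : ∀ k → All Prime (primesIn k)
  primesIn-prime k = All.tabulate λ p∈ → proj₁ (∈primesIn⁻ k p∈)

  primesIn-π≤ : ∀ k → All (λ p → π p ≤ ½ ^ k) (primesIn k)
  primesIn-π≤ k = All.tabulate λ p∈ → π≤½^ {k = k} (proj₁ (proj₂ (∈primesIn⁻ k p∈)))

  segment-prime : ∀ k J → All Prime (segment k J)
  segment-prime k J = All.tabulate λ p∈ → proj₁ (∈segment⁻ k J p∈)

  segment-++ : ∀ k i J → segment k (i ℕ.+ J) ≡ segment k i ++ segment (k ℕ.+ i) J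
  segment-++ k zero    J = cong (λ z → segment z J) (sym (ℕP.+-identityʳ k))
  segment-++ k (suc i) J = trans (cong (primesIn k ++_)
    (trans (segment-++ (suc k) i J) (cong (λ z → segment (suc k) i ++ segment z J) (sym (ℕP.+-suc k i)))))
    (sym (++-assoc (primesIn k) (segment (suc k) i) (segment (k ℕ.+ suc i) J)))

  -- The bound reproduces itself: with `x = ½ ^ k`, the later blocks leave `x`, this block adds
  -- `c · 64 x² ≤ x/3`, and `3/2 · (x + x/3) = 2 x`. It is uniform in `J`.
  segment-bounded : ∀ J {k} → 384 ℕ.≤ k → Bounded (segment k J) (ι 2 * ½ ^ k)
  segment-bounded zero    {k} h = Bounded-mono (*-nn (ι-nn 2) (^-nn 0≤½ k)) Bounded-[]
  segment-bounded (suc J) {k} h = Bounded-mono total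
    (Bounded-++ 0≤x 0≤X (primesIn-prime k) (primesIn-π≤ k) (segment-bounded J (ℕP.m≤n⇒m≤1+n h)))
    where
    open ≤-Reasoning
    x = ½ ^ k
    X = ι 2 * ½ ^ suc k
    c = length (primesIn k)
    0≤x = ^-nn 0≤½ k
    0≤X = *-nn (ι-nn 2) (^-nn 0≤½ (suc k))
    total : iter (ι 64 * (x * x)) (ι 64 * x) c X ≤ ι 2 * x
    total = begin
      iter (ι 64 * (x * x)) (ι 64 * x) c X
        ≤⟨ iter-≤ (*-nn (ι-nn 64) (*-nn 0≤x 0≤x)) (*-nn (ι-nn 64) 0≤x) 0≤X c (primesIn-sparse h) ⟩
      + 3 / 2 * (ι 2 * (½ * x) + ι c * (ι 64 * (x * x)))
        ≡⟨ solve 2 (λ x c → con (+ 3 / 2) :* (con (ι 2) :* (con ½ :* x) :+ c :* (con (ι 64) :* (x :* x)))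
             := con (+ 3 / 2) :* (x :+ (c :* (con (ι 64) :* x)) :* x)) refl x (ι c) ⟩
      + 3 / 2 * (x + ι c * (ι 64 * x) * x)
        ≤⟨ *-monoʳ (from-yes (0ℚ ≤? + 3 / 2)) (+-monoʳ-≤ x (*-monoˡ 0≤x (primesIn-sparse h))) ⟩
      + 3 / 2 * (x + + 1 / 3 * x)
        ≡⟨ solve 1 (λ x → con (+ 3 / 2) :* (x :+ con (+ 1 / 3) :* x) := con (ι 2) :* x) refl x ⟩
      ι 2 * x ∎

  RankinBounded-mono : ∀ {ss ls C T T′} → T ≤ T′ → RankinBounded ss ls C T → RankinBounded ss ls C T′
  RankinBounded-mono {C = C} le h K D D′ large = ≤-trans (h K D D′ large) (+-monoʳ-≤ (C * η₀ ^ K) le)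

  -- The `1/p²` terms of these primes go into the coefficient of `η₀ ^ K`, so each block merely
  -- multiplies `T` by 3/2.
  segment-rankin : ∀ i {k} → 384 ℕ.≤ k →
    ∃ λ C → 0ℚ ≤ C × (∀ {ls T} → 0ℚ ≤ T → Bounded ls T → RankinBounded (segment k i) ls C ((+ 3 / 2) ^ i * T))
  segment-rankin zero    _   = 0ℚ , ≤-refl , λ {ls} {T} _ h →
    RankinBounded-mono {[]} {ls} {0ℚ} {T} (≤-reflexive (sym (*-identityˡ T))) (RankinBounded-[] h)
  segment-rankin (suc i) {k} le =
    let C , 0≤C , f = segment-rankin i (ℕP.m≤n⇒m≤1+n le)
        C′ , 0≤C′ , g = RankinBounded-++ {½ ^ k} (^-nn 0≤½ k) {primesIn k} 0≤C (primesIn-prime k) (primesIn-π≤ k)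
    in C′ , 0≤C′ , λ {ls} {T} 0≤T h → RankinBounded-mono {segment k (suc i)} {ls} {C′} (bound 0≤T)
         (g {segment (suc k) i} {ls} (0≤Y 0≤T) (f 0≤T h))
    where
    open ≤-Reasoning
    c = length (primesIn k)
    0≤Y : ∀ {T} → 0ℚ ≤ T → 0ℚ ≤ (+ 3 / 2) ^ i * T
    0≤Y 0≤T = *-nn (^-nn (from-yes (0ℚ ≤? + 3 / 2)) i) 0≤T
    bound : ∀ {T} → 0ℚ ≤ T → iter 0ℚ (ι 64 * ½ ^ k) c ((+ 3 / 2) ^ i * T) ≤ (+ 3 / 2) ^ suc i * T
    bound {T} 0≤T = begin
      iter 0ℚ (ι 64 * ½ ^ k) c ((+ 3 / 2) ^ i * T)      ≤⟨ iter-≤ ≤-refl (*-nn (ι-nn 64) (^-nn 0≤½ k)) (0≤Y 0≤T) c (primesIn-sparse le) ⟩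
      + 3 / 2 * ((+ 3 / 2) ^ i * T + ι c * 0ℚ)          ≡⟨ solve 4 (λ h y t c → h :* (y :* t :+ c :* con 0ℚ) := h :* y :* t) refl (+ 3 / 2) ((+ 3 / 2) ^ i) T (ι c) ⟩
      (+ 3 / 2) ^ suc i * T                             ∎

  iter-0 : ∀ h c X → iter 0ℚ h c X ≡ (1ℚ + h) ^ c * X
  iter-0 h zero    X = sym (*-identityˡ X)
  iter-0 h (suc c) X = trans (+-identityˡ ((1ℚ + h) * iter 0ℚ h c X))
    (trans (cong ((1ℚ + h) *_) (iter-0 h c X)) (sym (*-assoc (1ℚ + h) ((1ℚ + h) ^ c) X)))

  module _ (k₀ : ℕ) (384≤k₀ : 384 ℕ.≤ k₀) where

    private
      -- The loss on `T` from the primes up to `2 ^ k₀`, where only `π p ≤ 1` is used. It is fixed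
      -- before `i`.
      Γ : ℚ
      Γ = (1ℚ + ι 64 * 1ℚ) ^ length (segment 0 k₀)

      0≤Γ : 0ℚ ≤ Γ
      0≤Γ = ^-nn (from-yes (0ℚ ≤? 1ℚ + ι 64 * 1ℚ)) (length (segment 0 k₀))

      -- Moving the border up by `i` blocks costs `(3/2) ^ i` but shrinks the tail by `½ ^ i`, a net
      -- gain of `(3/4) ^ i` that beats `Γ`.
      i-small : ∃ λ i → Γ * ι 2 * (+ 3 / 4) ^ i ≤ ¼
      i-small = power-small {¼} {Γ * ι 2} (from-yes (0ℚ <? ¼)) (from-yes (0ℚ ≤? 1ℚ - ¼)) (*-nn 0≤Γ (ι-nn 2))

      i k₁ : ℕ
      i  = proj₁ i-small
      k₁ = k₀ ℕ.+ i

    rankin : ∃ λ k₁ → ∃ λ C → 0ℚ ≤ C × (∀ J → RankinBounded (segment 0 k₁) (segment k₁ J) C ¼)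
    rankin =
      let C , 0≤C , f = segment-rankin i 384≤k₀
          C′ , 0≤C′ , g = RankinBounded-++ {1ℚ} 0≤1 {segment 0 k₀} 0≤C (segment-prime 0 k₀) small
      in k₁ , C′ , 0≤C′ , λ J → subst (λ ss → RankinBounded ss (segment k₁ J) C′ ¼) (sym (segment-++ 0 k₀ i))
           (RankinBounded-mono {segment 0 k₀ ++ segment k₀ i} {segment k₁ J} {C′} bound
             (g {segment k₀ i} {segment k₁ J} 0≤Y (f 0≤T (segment-bounded J (ℕP.≤-trans 384≤k₀ (ℕP.m≤m+n k₀ i))))))
      where
      open ≤-Reasoning
      T Y : ℚ
      T = ι 2 * ½ ^ k₁
      Y = (+ 3 / 2) ^ i * T
      0≤T : 0ℚ ≤ T
      0≤T = *-nn (ι-nn 2) (^-nn 0≤½ k₁)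
      0≤Y : 0ℚ ≤ Y
      0≤Y = *-nn (^-nn (from-yes (0ℚ ≤? + 3 / 2)) i) 0≤T
      small : All (λ p → π p ≤ 1ℚ) (segment 0 k₀)
      small = All.map (λ pp → ≤-trans (π≤½ (prime⇒2≤ pp)) (from-yes (½ ≤? 1ℚ))) (segment-prime 0 k₀)
      bound : iter 0ℚ (ι 64 * 1ℚ) (length (segment 0 k₀)) Y ≤ ¼
      bound = begin
        iter 0ℚ (ι 64 * 1ℚ) (length (segment 0 k₀)) Y   ≡⟨ iter-0 (ι 64 * 1ℚ) (length (segment 0 k₀)) Y ⟩
        Γ * ((+ 3 / 2) ^ i * (ι 2 * ½ ^ k₁))            ≤⟨ *-monoʳ 0≤Γ (*-monoʳ (^-nn (from-yes (0ℚ ≤? + 3 / 2)) i)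
                                                              (*-monoʳ (ι-nn 2) (^-antiʳ 0≤½ (from-yes (½ ≤? 1ℚ)) (ℕP.m≤n+m i k₀)))) ⟩
        Γ * ((+ 3 / 2) ^ i * (ι 2 * ½ ^ i))             ≡⟨ solve 4 (λ a x t y → a :* (x :* (t :* y)) := a :* t :* (x :* y)) refl Γ ((+ 3 / 2) ^ i) (ι 2) (½ ^ i) ⟩
        Γ * ι 2 * ((+ 3 / 2) ^ i * ½ ^ i)               ≡⟨ cong (Γ * ι 2 *_) (sym (^-* (+ 3 / 2) ½ i)) ⟩
        Γ * ι 2 * (+ 3 / 4) ^ i                         ≤⟨ proj₂ i-small ⟩
        ¼                                               ∎

  -- An uncovered integer for every system of large moduli.

  module _ (k₁ K : ℕ) {C : ℚ} (rankin : ∀ J → RankinBounded (segment 0 k₁) (segment k₁ J) C ¼)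
           (small : C * η₀ ^ K ≤ ¼) where

    module _ (S : List ℕ) (unique : Unique S) (m : ℕ) (≤m : ∀ {d} → d ∈ S → d ℕ.≤ m)
             (large : ∀ {d} → d ∈ S → suc ((2 ℕ.^ k₁) ℕ.^ K) ℕ.< d) where

      private
        ps : List ℕ
        ps = segment 0 k₁ ++ segment k₁ m

        ps≡ : segment 0 (k₁ ℕ.+ m) ≡ ps
        ps≡ = segment-++ 0 k₁ m

        ps-prime : All Prime ps
        ps-prime = subst (All Prime) ps≡ (segment-prime 0 (k₁ ℕ.+ m))

        ps-unique : Unique ps
        ps-unique = subst Unique ps≡ (segment-unique 0 (k₁ ℕ.+ m))

        2≤d : ∀ {d} → d ∈ S → 2 ℕ.≤ d
        2≤d d∈ = ℕP.≤-trans (s≤s (s≤s z≤n)) (large d∈)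

        1≤d : ∀ {d} → d ∈ S → 1 ℕ.≤ d
        1≤d d∈ = ℕP.<⇒≤ (2≤d d∈)

        ∈ps : ∀ {d} → d ∈ S → ∀ p → Prime p → p ℕD.∣ d → p ∈ ps
        ∈ps {d} d∈ p pp p∣d = subst (p ∈_) ps≡ (∈segment⁺ 0 (k₁ ℕ.+ m) pp (prime⇒2≤ pp) (begin
          p                     ≤⟨ ℕD.∣⇒≤ {{ℕ.>-nonZero (1≤d d∈)}} p∣d ⟩
          d                     ≤⟨ ≤m d∈ ⟩
          m                     ≤⟨ ℕP.m≤n+m m k₁ ⟩
          k₁ ℕ.+ m              ≤⟨ ℕP.<⇒≤ (n<p^n ℕP.≤-refl (k₁ ℕ.+ m)) ⟩
          2 ℕ.^ (k₁ ℕ.+ m)      ∎))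
          where open ℕP.≤-Reasoning

        distinguished : Distinguished ps S
        distinguished = record
          { unique  = unique
          ; agree⇒≡ = λ d∈ d′∈ h → ℕD.∣-antisym
              (v-determines (1≤d d∈) (1≤d d′∈) (∈ps d∈) h)
              (v-determines (1≤d d′∈) (1≤d d∈) (∈ps d′∈) (λ q∈ → sym (h q∈)))
          ; ¬ends   = λ d∈ ends → let p , pp , p∣d = prime-factor (2≤d d∈) in
              ∣⇒v≢0 (prime⇒2≤ pp) (1≤d d∈) p∣d (All.lookup ends (∈ps d∈ p pp p∣d))
          }

        -- A modulus without prime factors above `2 ^ k₁` divides its smooth part; with fewer than
        -- `K` prime factors it would be at most `(2 ^ k₁) ^ K`.
        moduli-large : ∀ {d} → d ∈ S → Large K (segment 0 k₁) (segment k₁ m) d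
        moduli-large {d} d∈ with ends? (segment k₁ m) d
        ... | no ¬e = inj₂ ¬e
        ... | yes e with K ℕP.≤? exponentSum (segment 0 k₁) d
        ...   | yes le = inj₁ le
        ...   | no ¬le = contradiction (ℕP.<-trans (ℕP.n<1+n _) (large d∈)) (ℕP.≤⇒≯ (begin
          d                                               ≤⟨ ℕD.∣⇒≤ {{ℕ.>-nonZero (smoothPart≥1 d (segment-prime 0 k₁))}}
                                                               (∣smoothPart (1≤d d∈) (segment-prime 0 k₁) small-factors) ⟩
          smoothPart (segment 0 k₁) d                     ≤⟨ smoothPart≤ d (ℕP.m^n>0 2 k₁) (All.tabulate λ p∈ → proj₂ (proj₂ (∈segment⁻ 0 k₁ p∈))) ⟩
          (2 ℕ.^ k₁) ℕ.^ exponentSum (segment 0 k₁) d     ≤⟨ ℕP.^-monoʳ-≤ (2 ℕ.^ k₁) {{ℕ.>-nonZero (ℕP.m^n>0 2 k₁)}} (ℕP.<⇒≤ (ℕP.≰⇒> ¬le)) ⟩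
          (2 ℕ.^ k₁) ℕ.^ K                                ∎))
          where
          open ℕP.≤-Reasoning
          small-factors : ∀ p → Prime p → p ℕD.∣ d → p ∈ segment 0 k₁
          small-factors p pp p∣d with ∈-++⁻ (segment 0 k₁) (∈ps d∈ p pp p∣d)
          ... | inj₁ p∈ = p∈
          ... | inj₂ p∈ = contradiction (All.lookup e p∈) (∣⇒v≢0 (prime⇒2≤ pp) (1≤d d∈) p∣d)

        Φ<1 : Φ ps S S < 1ℚ
        Φ<1 = ≤-<-trans (≤-trans (rankin m K distinguished distinguished moduli-large)
          (+-monoˡ-≤ ¼ small)) (from-yes (¼ + ¼ <? 1ℚ))

      exists-uncovered : ∀ (r : ℕ → ℤ) → ∃ λ a → ∀ {d} → d ∈ S → ¬ (+ d ∣ a ℤ.- r d)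
      exists-uncovered r =
        -- `γ = m` is allowed since `v p d ≤ d ≤ m`; the search starts from the class of 0 modulo 1,
        -- that is, from all integers.
        let a , _ , h = Avoid.avoid r m ps ps-prime ps-unique ℤ.0ℤ 1
              (λ q∈ q∣1 → contradiction (subst Prime (ℕD.∣1⇒≡1 q∣1) (All.lookup ps-prime q∈)) ¬prime[1])
              S (λ {d} d∈ p → ℕP.≤-trans (v≤ p d) (≤m d∈)) (Distinguished.¬ends distinguished) Φ<1
        in a , h

  member≤ : ∀ (S : List ℕ) → ∃ λ m → ∀ {d} → d ∈ S → d ℕ.≤ m
  member≤ []      = 0 , λ ()
  member≤ (d ∷ S) = let m , h = member≤ S in d ℕ.⊔ m , λ
    { (here refl) → ℕP.m≤m⊔n d m
    ; (there d∈)  → ℕP.≤-trans (h d∈) (ℕP.m≤n⊔m d m) }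

  Uncoverable : ℕ → Set
  Uncoverable n₀ = ∀ (S : List ℕ) → Unique S → (∀ {d} → d ∈ S → n₀ ℕ.< d) → ∀ (r : ℕ → ℤ) →
                   ∃ λ a → ∀ {d} → d ∈ S → ¬ (+ d ∣ a ℤ.- r d)

  -- `K` is chosen once `C` is known, from powers of `1 - 1/5 = η₀`; the small primes and the tail
  -- then contribute at most `¼` each.
  hough-from : (∃ λ k₁ → ∃ λ C → 0ℚ ≤ C × (∀ J → RankinBounded (segment 0 k₁) (segment k₁ J) C ¼)) → ∃ Uncoverable
  hough-from (k₁ , C , 0≤C , bounded) =
    let K , small = power-small {+ 1 / 5} (from-yes (0ℚ <? + 1 / 5)) (from-yes (0ℚ ≤? 1ℚ - + 1 / 5)) 0≤C
    in suc ((2 ℕ.^ k₁) ℕ.^ K) , λ S u large →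
       let m , ≤m = member≤ S in exists-uncovered k₁ K {C} bounded small S u m ≤m large

-- Densities of periodic sets and the attained minimum.

module Density where

  open Sieve using (ι-pos; ∣-≡; ≤-by-≡ˡ; *-monoˡ; *-monoʳ)
  open import Defs
  open RealLemmas
  open import Data.Integer.Base as ℤ using (ℤ; +_)
  import Data.Integer.Properties as ℤP
  open import Data.Integer.DivMod using (_%ℕ_; _/ℕ_; a≡a%ℕn+[a/ℕn]*n; n%ℕd<d)
  open import Data.Integer.Divisibility.Signed as ℤD using (_∣_)
  open import Data.Integer.Tactic.RingSolver using (solve-∀)
  open import Data.List.Base using (List; []; _∷_; filter; length; applyUpTo)
  open import Data.List.Membership.Propositional using (_∈_)
  open import Data.List.Properties using (map-upTo)
  open import Data.List.Relation.Unary.All as All using (All; []; _∷_)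
  open import Data.List.Relation.Unary.Any using (here; there)
  open import Data.Nat.Base as ℕ using (ℕ; zero; suc; s≤s; z≤n)
  import Data.Nat.DivMod as ℕDM
  open import Data.Nat.ListAction using (product)
  open import Data.Nat.ListAction.Properties using (∈⇒∣product; product≢0)
  import Data.Nat.Properties as ℕP
  open import Data.Product.Base using (∃; _×_; _,_; proj₁; proj₂)
  open import Data.Rational.Base
  open import Data.Rational.Properties
  open import Data.Rational.Solver using (module +-*-Solver)
  import Data.Rational.Unnormalised.Base as ℚᵘ
  import Data.Rational.Unnormalised.Properties as ℚᵘP
  open import Data.Sum.Base using (inj₁; inj₂)
  open import Function.Base using (_∘_)
  open import Level using (0ℓ)
  open import Relation.Binary.PropositionalEquality
  open import Relation.Nullary using (Dec; yes; no; contradiction)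
  open import Relation.Unary using (Pred; Decidable)
  open +-*-Solver using (solve; _:+_; _:*_; _:-_; :-_; con; _:=_)

  indicator : ∀ {P : Set} → Dec P → ℕ
  indicator (yes _) = 1
  indicator (no  _) = 0

  indicator-cong : ∀ {P Q : Set} (P? : Dec P) (Q? : Dec Q) → (P → Q) → (Q → P) → indicator P? ≡ indicator Q?
  indicator-cong (yes p) (yes q) _ _ = refl
  indicator-cong (yes p) (no ¬q) f _ = contradiction (f p) ¬q
  indicator-cong (no ¬p) (yes q) _ g = contradiction (g q) ¬p
  indicator-cong (no ¬p) (no ¬q) _ _ = refl

  count : ∀ {A : Pred ℤ 0ℓ} → Decidable A → ℤ → ℕ → ℕ
  count A? s zero    = 0
  count A? s (suc n) = indicator (A? s) ℕ.+ count A? (s ℤ.+ + 1) n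

  +-suc-assoc : ∀ s m → (s ℤ.+ + 1) ℤ.+ + m ≡ s ℤ.+ + suc m
  +-suc-assoc s m = ℤP.+-assoc s (+ 1) (+ m)

  count-cong : ∀ {A B : Pred ℤ 0ℓ} (A? : Decidable A) (B? : Decidable B) →
               (∀ {a} → A a → B a) → (∀ {a} → B a → A a) → ∀ s n → count A? s n ≡ count B? s n
  count-cong A? B? f g s zero    = refl
  count-cong A? B? f g s (suc n) = cong₂ ℕ._+_ (indicator-cong (A? s) (B? s) f g) (count-cong A? B? f g (s ℤ.+ + 1) n)

  module _ {A : Pred ℤ 0ℓ} (A? : Decidable A) where

    filter-count : ∀ n (f : ℕ → ℤ) → (∀ i → f (suc i) ≡ f i ℤ.+ + 1) →
                   length (filter A? (applyUpTo f n)) ≡ count A? (f 0) n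
    filter-count zero    f h = refl
    filter-count (suc n) f h with A? (f 0)
    ... | yes _ = cong suc (trans (filter-count n (f ∘ suc) (h ∘ suc)) (cong (λ s → count A? s n) (h 0)))
    ... | no  _ = trans (filter-count n (f ∘ suc) (h ∘ suc)) (cong (λ s → count A? s n) (h 0))

    proportion-count : ∀ X → proportion A? X ≡ + count A? (ℤ.- + X) (suc (2 ℕ.* X)) / suc (2 ℕ.* X)
    proportion-count X = cong (λ c → + c / suc (2 ℕ.* X)) (trans
      (cong (length ∘ filter A?) (map-upTo (λ i → + i ℤ.- + X) (suc (2 ℕ.* X))))
      (trans (filter-count (suc (2 ℕ.* X)) (λ i → + i ℤ.- + X) λ i → e (+ i) (+ X))
        (cong (λ s → count A? s (suc (2 ℕ.* X))) (ℤP.+-identityˡ (ℤ.- + X)))))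
      where
      e : ∀ i X → (+ 1 ℤ.+ i) ℤ.- X ≡ (i ℤ.- X) ℤ.+ + 1
      e = solve-∀

    count≤ : ∀ s n → count A? s n ℕ.≤ n
    count≤ s zero    = z≤n
    count≤ s (suc n) with A? s
    ... | yes _ = s≤s (count≤ (s ℤ.+ + 1) n)
    ... | no  _ = ℕP.m≤n⇒m≤1+n (count≤ (s ℤ.+ + 1) n)

    count-+ : ∀ s m n → count A? s (m ℕ.+ n) ≡ count A? s m ℕ.+ count A? (s ℤ.+ + m) n
    count-+ s zero    n = cong (λ z → count A? z n) (sym (ℤP.+-identityʳ s))
    count-+ s (suc m) n = trans (cong (indicator (A? s) ℕ.+_) (trans (count-+ (s ℤ.+ + 1) m n)
        (cong (λ z → count A? (s ℤ.+ + 1) m ℕ.+ count A? z n) (+-suc-assoc s m))))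
      (sym (ℕP.+-assoc (indicator (A? s)) (count A? (s ℤ.+ + 1) m) (count A? (s ℤ.+ + suc m) n)))

    module Periodic (Q : ℕ) (1≤Q : 1 ℕ.≤ Q)
                    (up : ∀ {a} → A a → A (a ℤ.+ + Q)) (down : ∀ {a} → A (a ℤ.+ + Q) → A a) where

      K : ℕ
      K = count A? (+ 0) Q

      -- The `Q + 1` integers from `s` on are counted with either end split off; by periodicity the
      -- two ends agree.
      shift : ∀ s → count A? s Q ≡ count A? (s ℤ.+ + 1) Q
      shift s = ℕP.+-cancelˡ-≡ (indicator (A? s)) (count A? s Q) (count A? (s ℤ.+ + 1) Q) (begin
        indicator (A? s) ℕ.+ count A? s Q             ≡⟨ ℕP.+-comm (indicator (A? s)) (count A? s Q) ⟩
        count A? s Q ℕ.+ indicator (A? s)             ≡⟨ cong (count A? s Q ℕ.+_) (trans (indicator-cong (A? s) (A? (s ℤ.+ + Q)) up down)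
                                                           (sym (ℕP.+-identityʳ (indicator (A? (s ℤ.+ + Q)))))) ⟩
        count A? s Q ℕ.+ count A? (s ℤ.+ + Q) 1       ≡⟨ sym (count-+ s Q 1) ⟩
        count A? s (Q ℕ.+ 1)                          ≡⟨ cong (count A? s) (ℕP.+-comm Q 1) ⟩
        count A? s (1 ℕ.+ Q)                          ∎)
        where open ≡-Reasoning

      shifts : ∀ m s → count A? s Q ≡ count A? (s ℤ.+ + m) Q
      shifts zero    s = cong (λ z → count A? z Q) (sym (ℤP.+-identityʳ s))
      shifts (suc m) s = trans (shift s) (trans (shifts m (s ℤ.+ + 1)) (cong (λ z → count A? z Q) (+-suc-assoc s m)))

      count-period : ∀ s → count A? s Q ≡ K
      count-period (+ n) = sym (trans (shifts n (+ 0)) (cong (λ z → count A? z Q) (ℤP.+-identityˡ (+ n))))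
      count-period s@(ℤ.-[1+ n ]) = trans (shifts (suc n) s) (cong (λ z → count A? z Q) (ℤP.+-inverseˡ (+ suc n)))

      count-periods : ∀ q s → count A? s (q ℕ.* Q) ≡ q ℕ.* K
      count-periods zero    s = refl
      count-periods (suc q) s = trans (count-+ s Q (q ℕ.* Q)) (cong₂ ℕ._+_ (count-period s) (count-periods q (s ℤ.+ + Q)))

      1≤K : ∀ {a} → A a → 1 ℕ.≤ K
      1≤K {a} h = subst (1 ℕ.≤_) (count-period a) (first 1≤Q)
        where
        first : ∀ {Q} → 1 ℕ.≤ Q → 1 ℕ.≤ count A? a Q
        first {suc Q} _ with A? a
        ... | yes _ = s≤s z≤n
        ... | no ¬h = contradiction h ¬h

      count-remainder : ∀ s n → .{{_ : ℕ.NonZero Q}} → ∃ λ c → c ℕ.≤ Q × count A? s n ≡ c ℕ.+ (n ℕDM./ Q) ℕ.* K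
      count-remainder s n = count A? s (n ℕDM.% Q) , ℕP.≤-trans (count≤ s (n ℕDM.% Q)) (ℕP.<⇒≤ (ℕDM.m%n<n n Q)) ,
        trans (cong (count A? s) (ℕDM.m≡m%n+[m/n]*n n Q))
          (trans (count-+ s (n ℕDM.% Q) ((n ℕDM./ Q) ℕ.* Q))
            (cong (count A? s (n ℕDM.% Q) ℕ.+_) (count-periods (n ℕDM./ Q) (s ℤ.+ + (n ℕDM.% Q)))))

  /-inv : ∀ n k → + n / suc k ≡ ι n * inv k
  /-inv n k = toℚᵘ-injective (ℚᵘP.≃-trans (toℚᵘ-fromℚᵘ (ℚᵘ.mkℚᵘ (+ n) k))
    (ℚᵘP.≃-sym (ℚᵘP.≃-trans (toℚᵘ-homo-* (ι n) (inv k))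
      (ℚᵘP.≃-trans (ℚᵘP.*-cong (toℚᵘ-fromℚᵘ (ℚᵘ.mkℚᵘ (+ n) 0)) (toℚᵘ-fromℚᵘ (ℚᵘ.mkℚᵘ (+ 1) k)))
        (ℚᵘ.*≡* (cong₂ ℤ._*_ (ℤP.*-identityʳ (+ n)) (sym (ℤP.*-identityˡ (+ suc k)))))))))

  ∣-∣≤ : ∀ {x y b} → 0ℚ ≤ x → x ≤ b → 0ℚ ≤ y → y ≤ b → ∣ x - y ∣ ≤ b
  ∣-∣≤ {x} {y} {b} 0≤x x≤b 0≤y y≤b with ∣p∣≡p∨∣p∣≡-p (x - y)
  ... | inj₁ e = ≤-by-≡ˡ e (≤-trans (+-monoʳ-≤ x (neg-antimono-≤ 0≤y)) (≤-by-≡ˡ (+-identityʳ x) x≤b))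
  ... | inj₂ e = ≤-by-≡ˡ (trans e (solve 2 (λ x y → :- (x :- y) := y :- x) refl x y))
    (≤-trans (+-monoʳ-≤ y (neg-antimono-≤ 0≤x)) (≤-by-≡ˡ (+-identityʳ y) y≤b))

  -- With N = ρ + q Q and c + q K elements of density d = K / Q per period, the error is (c - d ρ) / N.
  proportion-close : ∀ {Q K c q ρ} {d : ℚ} k → 0ℚ ≤ d → d ≤ 1ℚ → d * ι Q ≡ ι K → c ℕ.≤ Q → ρ ℕ.≤ Q →
    suc k ≡ ρ ℕ.+ q ℕ.* Q → ∣ ι (c ℕ.+ q ℕ.* K) * inv k - d ∣ ≤ ι Q * inv k
  proportion-close {Q} {K} {c} {q} {ρ} {d} k 0≤d d≤1 dQ≡K c≤Q ρ≤Q N≡ = begin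
    ∣ ι (c ℕ.+ q ℕ.* K) * inv k - d ∣     ≡⟨ cong ∣_∣ difference ⟩
    ∣ (ι c - d * ι ρ) * inv k ∣           ≡⟨ ∣p*q∣≡∣p∣*∣q∣ (ι c - d * ι ρ) (inv k) ⟩
    ∣ ι c - d * ι ρ ∣ * ∣ inv k ∣         ≡⟨ cong (∣ ι c - d * ι ρ ∣ *_) (0≤p⇒∣p∣≡p (inv-nn k)) ⟩
    ∣ ι c - d * ι ρ ∣ * inv k             ≤⟨ *-monoˡ (inv-nn k) (∣-∣≤ (ι-nn c) (ι-mono c≤Q) (*-nn 0≤d (ι-nn ρ))
                                               (≤-trans (*-monoˡ (ι-nn ρ) d≤1) (≤-by-≡ˡ (*-identityˡ (ι ρ)) (ι-mono ρ≤Q)))) ⟩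
    ι Q * inv k                           ∎
    where
    open ≤-Reasoning
    difference : ι (c ℕ.+ q ℕ.* K) * inv k - d ≡ (ι c - d * ι ρ) * inv k
    difference = begin-equality
      ι (c ℕ.+ q ℕ.* K) * inv k - d
        ≡⟨ cong₂ (λ x y → x * inv k - y)
             (trans (ι-+ c (q ℕ.* K)) (cong (λ z → ι c + z) (trans (ι-* q K) (cong (ι q *_) (sym dQ≡K)))))
             (trans (sym (*-identityʳ d)) (cong (d *_) (sym (inv-inverse k)))) ⟩
      (ι c + ι q * (d * ι Q)) * inv k - d * (inv k * ι (suc k))
        ≡⟨ cong (λ z → (ι c + ι q * (d * ι Q)) * inv k - d * (inv k * z))
             (trans (cong ι N≡) (trans (ι-+ ρ (q ℕ.* Q)) (cong (λ z → ι ρ + z) (ι-* q Q)))) ⟩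
      (ι c + ι q * (d * ι Q)) * inv k - d * (inv k * (ι ρ + ι q * ι Q))
        ≡⟨ solve 6 (λ c q d Q I ρ → (c :+ q :* (d :* Q)) :* I :- d :* (I :* (ρ :+ q :* Q)) := (c :- d :* ρ) :* I)
             refl (ι c) (ι q) d (ι Q) (inv k) (ι ρ) ⟩
      (ι c - d * ι ρ) * inv k ∎

  module _ {Q : ℕ} (1≤Q : 1 ℕ.≤ Q) where

    per : ℕ → ℚ
    per K = ι K * recip (ι Q)

    per-mono : ∀ {K K′} → K ℕ.≤ K′ → per K ≤ per K′
    per-mono h = *-monoˡ (<⇒≤ (recip-pos (ι-pos 1≤Q))) (ι-mono h)

    per-pos : ∀ {K} → 1 ℕ.≤ K → 0ℚ < per K
    per-pos h = *-pos (ι-pos h) (recip-pos (ι-pos 1≤Q))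

    per-inverse : ∀ K → per K * ι Q ≡ ι K
    per-inverse K = trans (*-assoc (ι K) (recip (ι Q)) (ι Q)) (trans
      (cong (ι K *_) (trans (*-comm (recip (ι Q)) (ι Q)) (recip-inverse (ι-pos 1≤Q)))) (*-identityʳ (ι K)))

    0≤per : ∀ K → 0ℚ ≤ per K
    0≤per K = *-nn (ι-nn K) (<⇒≤ (recip-pos (ι-pos 1≤Q)))

    per≤1 : ∀ {K} → K ℕ.≤ Q → per K ≤ 1ℚ
    per≤1 h = ≤-trans (per-mono h) (≤-reflexive (recip-inverse (ι-pos 1≤Q)))

    module _ {A : Pred ℤ 0ℓ} (A? : Decidable A)
             (up : ∀ {a} → A a → A (a ℤ.+ + Q)) (down : ∀ {a} → A (a ℤ.+ + Q) → A a) where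

      private instance
        Q≢0 : ℕ.NonZero Q
        Q≢0 = ℕ.>-nonZero 1≤Q

      close : ∀ X → ∣ proportion A? X - per (count A? (+ 0) Q) ∣ ≤ ι Q * inv (2 ℕ.* X)
      close X =
        let N = suc (2 ℕ.* X)
            K = count A? (+ 0) Q
            c , c≤Q , e = Periodic.count-remainder A? Q 1≤Q up down (ℤ.- + X) N
        in subst (λ z → ∣ z - per K ∣ ≤ ι Q * inv (2 ℕ.* X))
          (sym (trans (proportion-count A? X) (trans (/-inv (count A? (ℤ.- + X) N) (2 ℕ.* X)) (cong (λ n → ι n * inv (2 ℕ.* X)) e))))
          (proportion-close {Q} {K} {c} {N ℕDM./ Q} {N ℕDM.% Q} (2 ℕ.* X) (0≤per K) (per≤1 (count≤ A? (+ 0) Q)) (per-inverse K)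
            c≤Q (ℕP.<⇒≤ (ℕDM.m%n<n N Q)) (ℕDM.m≡m%n+[m/n]*n N Q))

      hasDensity : HasDensity A? (fromℚ (per (count A? (+ 0) Q)))
      hasDensity ε 0<ε =
        let M , small = inv-small (ε * recip (ι Q)) (*-pos 0<ε (recip-pos (ι-pos 1≤Q)))
        in M , λ X M≤X → ≤-trans (close X) (≤-trans
          (*-monoʳ (ι-nn Q) (small (2 ℕ.* X) (ℕP.≤-trans M≤X (ℕP.m≤m+n X _))))
          (≤-reflexive (trans (solve 3 (λ q e r → q :* (e :* r) := (q :* r) :* e) refl (ι Q) ε (recip (ι Q)))
            (trans (cong (_* ε) (recip-inverse (ι-pos 1≤Q))) (*-identityˡ ε)))))

  argmin : ∀ n (f : ℕ → ℕ) → ∃ λ i → ∀ j → j ℕ.< suc n → f i ℕ.≤ f j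
  argmin zero    f = 0 , λ { zero _ → ℕP.≤-refl ; (suc _) (s≤s ()) }
  argmin (suc n) f with argmin n f
  ... | i , h with ℕP.≤-total (f i) (f (suc n))
  ...   | inj₁ le = i , λ j j< → case j (ℕP.m≤n⇒m<n∨m≡n (ℕP.≤-pred j<))
    where
    case : ∀ j → _ → f i ℕ.≤ f j
    case j (inj₁ lt)   = h j lt
    case j (inj₂ refl) = le
  ...   | inj₂ ge = suc n , λ j j< → case j (ℕP.m≤n⇒m<n∨m≡n (ℕP.≤-pred j<))
    where
    case : ∀ j → _ → f (suc n) ℕ.≤ f j
    case j (inj₁ lt)   = ℕP.≤-trans ge (h j lt)
    case j (inj₂ refl) = ℕP.≤-refl

  infix 4 _≈[_]_

  _≈[_]_ : (ℕ → ℤ) → List ℕ → (ℕ → ℤ) → Set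
  r ≈[ ns ] r′ = ∀ {m} → m ∈ ns → + m ∣ r m ℤ.- r′ m

  update : (ℕ → ℤ) → ℕ → ℕ → ℕ → ℤ
  update r n i m with m ℕP.≟ n
  ... | yes _ = + i
  ... | no  _ = r m

  ∣-self : ∀ m x → + m ∣ x ℤ.- x
  ∣-self m x = ∣-≡ (sym (ℤP.+-inverseʳ x)) (ℤD.divides (+ 0) (sym (ℤP.*-zeroˡ (+ m))))

  update-≈ : ∀ {r r′ n i ns} → r ≈[ ns ] r′ → update r n i ≈[ n ∷ ns ] update r′ n i
  update-≈ {n = n} {i} h {m} m∈ with m ℕP.≟ n
  ... | yes _ = ∣-self m (+ i)
  update-≈ h (here m≡n) | no m≢n = contradiction m≡n m≢n
  update-≈ h (there m∈) | no _   = h m∈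

  update-%ℕ : ∀ r n ns .{{_ : ℕ.NonZero n}} → r ≈[ ns ] update r n (r n %ℕ n)
  update-%ℕ r n ns {m} _ with m ℕP.≟ n
  ... | no  _    = ∣-self m (r m)
  ... | yes refl = ℤD.divides (r n /ℕ n) (trans (cong (ℤ._- + (r n %ℕ n)) (a≡a%ℕn+[a/ℕn]*n (r n) n))
    (e (+ (r n %ℕ n)) ((r n /ℕ n) ℤ.* + n)))
    where
    e : ∀ x y → (x ℤ.+ y) ℤ.- x ≡ y
    e = solve-∀

  -- A finite search: `F` sees only residues, so for each residue `i` modulo the first modulus an
  -- optimal choice for the others is found, and the best `i` is kept.
  minimum : ∀ {ns} → All ℕ.NonZero ns → (F : (ℕ → ℤ) → ℕ) → (∀ {r r′} → r ≈[ ns ] r′ → F r ≡ F r′) →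
            ∃ λ r* → ∀ r → F r* ℕ.≤ F r
  minimum [] F h = (λ _ → + 0) , λ r → ℕP.≤-reflexive (h λ ())
  minimum {n@(suc n-1) ∷ ns} (_ ∷ nz) F h =
    let i , imin = argmin n-1 λ i → F (update (proj₁ (best i)) n i)
    in update (proj₁ (best i)) n i , λ r → ℕP.≤-trans (imin (r n %ℕ n) (n%ℕd<d (r n) n))
         (subst (F (update (proj₁ (best (r n %ℕ n))) n (r n %ℕ n)) ℕ.≤_) (sym (h (update-%ℕ r n (n ∷ ns))))
           (proj₂ (best (r n %ℕ n)) r))
    where
    best : ∀ i → ∃ λ r* → ∀ r → F (update r* n i) ℕ.≤ F (update r n i)
    best i = minimum nz (λ r → F (update r n i)) λ r≈ → h (update-≈ {n = n} {i} r≈)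

  module _ (S : FiniteSet⁺) where

    Q : ℕ
    Q = product (elements S)

    1≤Q : 1 ℕ.≤ Q
    1≤Q = ℕ.>-nonZero⁻¹ Q {{product≢0 (nonZeros S)}}

    n∣Q : ∀ {n} → n ∈ elements S → + n ∣ + Q
    n∣Q n∈ = ℤD.∣ᵤ⇒∣ (∈⇒∣product n∈)

    -- Covers both translation of `a` by the period and a change of `r` within its residue classes.
    Uncovered-resp : ∀ {r r′ a a′} → (∀ {n} → n ∈ elements S → + n ∣ (a ℤ.- r n) ℤ.- (a′ ℤ.- r′ n)) →
                     Uncovered S r a → Uncovered S r′ a′
    Uncovered-resp {r} {r′} {a} {a′} h u = All.tabulate λ {n} n∈ n∣ → All.lookup u n∈
      (∣-≡ (e (a ℤ.- r n) (a′ ℤ.- r′ n)) (ℤD.∣m∣n⇒∣m+n (h n∈) n∣))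
      where
      e : ∀ x y → (x ℤ.- y) ℤ.+ y ≡ x
      e = solve-∀

    module _ (r : ℕ → ℤ) where

      up : ∀ {a} → Uncovered S r a → Uncovered S r (a ℤ.+ + Q)
      up {a} = Uncovered-resp {r} {r} {a} {a ℤ.+ + Q} λ {n} n∈ → ∣-≡ (sym (e a (r n) (+ Q))) (ℤD.∣m⇒∣-m (n∣Q n∈))
        where
        e : ∀ a r Q → (a ℤ.- r) ℤ.- ((a ℤ.+ Q) ℤ.- r) ≡ ℤ.- Q
        e = solve-∀

      down : ∀ {a} → Uncovered S r (a ℤ.+ + Q) → Uncovered S r a
      down {a} = Uncovered-resp {r} {r} {a ℤ.+ + Q} {a} λ {n} n∈ → ∣-≡ (sym (e a (r n) (+ Q))) (n∣Q n∈)
        where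
        e : ∀ a r Q → ((a ℤ.+ Q) ℤ.- r) ℤ.- (a ℤ.- r) ≡ Q
        e = solve-∀

    uncoveredCount : (ℕ → ℤ) → ℕ
    uncoveredCount r = count (uncovered? S r) (+ 0) Q

    uncoveredCount-cong : ∀ {r r′} → r ≈[ elements S ] r′ → uncoveredCount r ≡ uncoveredCount r′
    uncoveredCount-cong {r} {r′} h = count-cong (uncovered? S r) (uncovered? S r′)
      (λ {a} → Uncovered-resp {r} {r′} {a} {a} λ {n} n∈ → ∣-≡ (e₁ a (r n) (r′ n)) (ℤD.∣m⇒∣-m (h n∈)))
      (λ {a} → Uncovered-resp {r′} {r} {a} {a} λ {n} n∈ → ∣-≡ (e₂ a (r n) (r′ n)) (h n∈)) (+ 0) Q
      where
      e₁ : ∀ a x y → ℤ.- (x ℤ.- y) ≡ (a ℤ.- x) ℤ.- (a ℤ.- y)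
      e₁ = solve-∀
      e₂ : ∀ a x y → x ℤ.- y ≡ (a ℤ.- y) ℤ.- (a ℤ.- x)
      e₂ = solve-∀

    density : (ℕ → ℤ) → ℚ
    density r = per 1≤Q (uncoveredCount r)

    -- Both numbers are limits of the same proportions; each approximation gets half of `ε`.
    density-unique : ∀ r d → HasDensity (uncovered? S r) d → fromℚ (density r) ≤ℝ d
    density-unique r d h ε 0<ε =
      let M₁ , h₁ = h ε/2 0<ε/2
          M₂ , h₂ = hasDensity 1≤Q (uncovered? S r) (λ {a} → up r {a}) (λ {a} → down r {a}) ε/2 0<ε/2
          X = M₁ ℕ.⊔ M₂
      in X , λ n X≤n → begin
        density r
          ≡⟨ solve 2 (λ p x → x := (p :+ (x :- p))) refl (p n) (density r) ⟩
        p n + (density r - p n)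
          ≤⟨ +-monoʳ-≤ (p n) (≤-trans (p≤∣p∣ (density r - p n)) (≤-by-≡ˡ (∣-∣-comm (density r) (p n))
               (h₂ n (ℕP.≤-trans (ℕP.m≤n⊔m M₁ M₂) X≤n)))) ⟩
        p n + ε/2
          ≡⟨ solve 3 (λ p x e → p :+ e := x :+ ((p :- x) :+ e)) refl (p n) (seq d n) ε/2 ⟩
        seq d n + ((p n - seq d n) + ε/2)
          ≤⟨ +-monoʳ-≤ (seq d n) (+-monoˡ-≤ ε/2 (≤-trans (p≤∣p∣ (p n - seq d n)) (h₁ n (ℕP.≤-trans (ℕP.m≤m⊔n M₁ M₂) X≤n)))) ⟩
        seq d n + (ε/2 + ε/2)
          ≡⟨ cong (λ z → seq d n + z) (solve 1 (λ e → e :* con ½ :+ e :* con ½ := e) refl ε) ⟩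
        seq d n + ε ∎
      where
      open ≤-Reasoning
      ε/2 = ε * ½
      0<ε/2 : 0ℚ < ε/2
      0<ε/2 = *-pos 0<ε (positive⁻¹ ½)
      p : ℕ → ℚ
      p = proportion (uncovered? S r)
      p≤∣p∣ : ∀ x → x ≤ ∣ x ∣
      p≤∣p∣ x with ≤-total 0ℚ x
      ... | inj₁ 0≤x = ≤-reflexive (sym (0≤p⇒∣p∣≡p 0≤x))
      ... | inj₂ x≤0 = ≤-trans x≤0 (0≤∣p∣ x)

    -- All densities are counts over the common period `Q`, so the least count gives the least
    -- density, and one uncovered integer makes that count at least 1.
    minDensity-pos : (∀ r → ∃ (Uncovered S r)) → ∃ λ δ → IsMinDensity S δ × 0ℝ <ℝ δ
    minDensity-pos exists =
      let r* , least = minimum (nonZeros S) uncoveredCount uncoveredCount-cong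
          a , u = exists r*
          0<δ = per-pos 1≤Q (Periodic.1≤K (uncovered? S r*) Q 1≤Q (λ {a} → up r* {a}) (λ {a} → down r* {a}) {a} u)
      in fromℚ (density r*) ,
         ((r* , hasDensity 1≤Q (uncovered? S r*) (λ {a} → up r* {a}) (λ {a} → down r* {a})) ,
          λ r d h ε 0<ε → let M , le = density-unique r d h ε 0<ε in
            M , λ n M≤n → ≤-trans (per-mono 1≤Q (least r)) (le n M≤n)) ,
         density r* , 0<δ , 0 , λ _ _ → ≤-reflexive (+-identityˡ (density r*))

-- Lower bounds for iterated logarithms.

module Logarithm where

  open Sieve using (≤-by-≡ˡ; p≤p+q; q≤p+q; *-monoʳ; sumTo-mono)
  open import Defs
  open RealLemmas
  open import Data.Integer.Base using (+_)
  open import Data.Nat.Base as ℕ using (ℕ; zero; suc)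
  import Data.Nat.Properties as ℕP
  open import Data.Product.Base using (Σ; ∃; _,_)
  open import Data.Rational.Base
  open import Data.Rational.Properties
  open import Data.Rational.Solver using (module +-*-Solver)
  open import Data.Sum.Base using (inj₁; inj₂)
  open import Relation.Binary.PropositionalEquality
  open import Relation.Nullary.Decidable using (from-yes)
  open +-*-Solver using (solve; _:+_; _:*_; _:-_; :-_; con; _:=_)

  -- The difference is `(1 - c t)² / t`; for positive `c` the left side is the tangent line to `1/t`
  -- at `t = 1/c`.
  recip-tangent : ∀ {t} c → 0ℚ < t → ι 2 * c - c * c * t ≤ recip t
  recip-tangent {t} c 0<t = sub-≤ (subst (0ℚ ≤_) e (*-nn (<⇒≤ (recip-pos 0<t)) (square-nn (1ℚ - c * t))))
    where
    square-nn : ∀ x → 0ℚ ≤ x * x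
    square-nn x = subst (0ℚ ≤_) (∣p∣*∣p∣≡p*p x) (*-nn (0≤∣p∣ x) (0≤∣p∣ x))
      where
      ∣p∣*∣p∣≡p*p : ∀ x → ∣ x ∣ * ∣ x ∣ ≡ x * x
      ∣p∣*∣p∣≡p*p x with ∣p∣≡p∨∣p∣≡-p x
      ... | inj₁ e = cong₂ _*_ e e
      ... | inj₂ e = trans (cong₂ _*_ e e) (solve 1 (λ x → (:- x) :* (:- x) := x :* x) refl x)
    e : recip t * ((1ℚ - c * t) * (1ℚ - c * t)) ≡ recip t - (ι 2 * c - c * c * t)
    e = trans
      (solve 3 (λ r c t → r :* ((con 1ℚ :- c :* t) :* (con 1ℚ :- c :* t)) :=
         (r :- con (ι 2) :* (c :* (t :* r))) :+ (c :* c :* t) :* (t :* r)) refl (recip t) c t)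
      (trans (cong (λ z → (recip t - ι 2 * (c * z)) + (c * c * t) * z) (recip-inverse 0<t))
        (solve 3 (λ r c t → (r :- con (ι 2) :* (c :* con 1ℚ)) :+ (c :* c :* t) :* con 1ℚ := r :- (con (ι 2) :* c :- c :* c :* t))
          refl (recip t) c t))

  -- Tangent parabola to 1/t at t = 1 + u/2, the midpoint of [1, q].
  log-lower : ∀ {q} → 1ℚ ≤ q → ∀ k → ι 2 - ι 4 * recip (q + 1ℚ) ≤ riemann recip 1ℚ q k
  log-lower {q} 1≤q k = subst (_≤ riemann recip 1ℚ q k) value (≤-trans (go (suc k))
    (sumTo-mono (suc k) λ i _ → *-monoʳ 0≤h (recip-tangent c (0<t i))))
    where
    u h s c : ℚ
    u = q - 1ℚ
    h = u * inv k
    s = recip (q + 1ℚ)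
    c = ι 2 * s
    0≤u : 0ℚ ≤ u
    0≤u = ≤-by-≡ˡ (sym (+-inverseʳ 1ℚ)) (+-monoˡ-≤ (- 1ℚ) 1≤q)
    0≤h : 0ℚ ≤ h
    0≤h = *-nn 0≤u (inv-nn k)
    0<t : ∀ i → 0ℚ < 1ℚ + ι i * h
    0<t i = <-≤-trans 0<1 (p≤p+q (*-nn (ι-nn i) 0≤h))
    s-inverse : (q + 1ℚ) * s ≡ 1ℚ
    s-inverse = recip-inverse (<-≤-trans 0<1 (q≤p+q (≤-trans 0≤1 1≤q)))
    F : ℚ → ℚ
    F x = x * (ι 2 * c) - c * c * (x + ½ * (x * x))
    go : ∀ m → F (ι m * h) ≤ sumTo m (λ i → h * (ι 2 * c - c * c * (1ℚ + ι i * h)))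
    go zero    = ≤-reflexive (solve 2 (λ h c → (con 0ℚ :* h) :* (con (ι 2) :* c) :- c :* c :* ((con 0ℚ :* h) :+ con ½ :* ((con 0ℚ :* h) :* (con 0ℚ :* h)))
                   := con 0ℚ) refl h c)
    go (suc m) = begin
      F (ι (suc m) * h)
        ≡⟨ cong (λ z → F (z * h)) (ι-suc m) ⟩
      F ((ι m + 1ℚ) * h)
        ≡⟨ solve 3 (λ m h c → let F = λ x → x :* (con (ι 2) :* c) :- c :* c :* (x :+ con ½ :* (x :* x)) in
             F ((m :+ con 1ℚ) :* h) := (F (m :* h) :+ h :* (con (ι 2) :* c :- c :* c :* (con 1ℚ :+ m :* h))) :- con ½ :* ((c :* h) :* (c :* h)))
             refl (ι m) h c ⟩
      (F (ι m * h) + h * (ι 2 * c - c * c * (1ℚ + ι m * h))) - ½ * ((c * h) * (c * h))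
        ≤⟨ +-monoʳ-≤ (F (ι m * h) + h * (ι 2 * c - c * c * (1ℚ + ι m * h))) (neg-antimono-≤ (*-nn (from-yes (0ℚ ≤? ½)) (*-nn 0≤ch 0≤ch))) ⟩
      (F (ι m * h) + h * (ι 2 * c - c * c * (1ℚ + ι m * h))) + 0ℚ
        ≡⟨ +-identityʳ (F (ι m * h) + h * (ι 2 * c - c * c * (1ℚ + ι m * h))) ⟩
      F (ι m * h) + h * (ι 2 * c - c * c * (1ℚ + ι m * h))
        ≤⟨ +-monoˡ-≤ (h * (ι 2 * c - c * c * (1ℚ + ι m * h))) (go m) ⟩
      sumTo (suc m) (λ i → h * (ι 2 * c - c * c * (1ℚ + ι i * h))) ∎
      where
      open ≤-Reasoning
      0≤ch : 0ℚ ≤ c * h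
      0≤ch = *-nn (*-nn (ι-nn 2) (<⇒≤ (recip-pos (<-≤-trans 0<1 (q≤p+q (≤-trans 0≤1 1≤q)))))) 0≤h
    value : F (ι (suc k) * h) ≡ ι 2 - ι 4 * s
    value = begin
      F (ι (suc k) * h)
        ≡⟨ cong F (trans (solve 3 (λ n u i → n :* (u :* i) := u :* (i :* n)) refl (ι (suc k)) u (inv k))
             (trans (cong (u *_) (inv-inverse k)) (*-identityʳ u))) ⟩
      F u
        ≡⟨ solve 2 (λ q s → let u = q :- con 1ℚ; c = con (ι 2) :* s in
             u :* (con (ι 2) :* c) :- c :* c :* (u :+ con ½ :* (u :* u))
             := con (ι 4) :* (u :* s) :- con (ι 2) :* ((u :* s) :* ((q :+ con 1ℚ) :* s))) refl q s ⟩
      ι 4 * (u * s) - ι 2 * ((u * s) * ((q + 1ℚ) * s))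
        ≡⟨ cong (λ z → ι 4 * (u * s) - ι 2 * ((u * s) * z)) s-inverse ⟩
      ι 4 * (u * s) - ι 2 * ((u * s) * 1ℚ)
        ≡⟨ solve 2 (λ q s → let us = (q :- con 1ℚ) :* s in con (ι 4) :* us :- con (ι 2) :* (us :* con 1ℚ)
             := con (ι 2) :* ((q :+ con 1ℚ) :* s) :- con (ι 4) :* s) refl q s ⟩
      ι 2 * ((q + 1ℚ) * s) - ι 4 * s
        ≡⟨ cong (λ z → ι 2 * z - ι 4 * s) s-inverse ⟩
      ι 2 - ι 4 * s ∎
      where open ≡-Reasoning

  EventuallyAbove : ℚ → ℝ → Set
  EventuallyAbove b x = ∃ λ M → ∀ n → M ℕ.≤ n → b ≤ seq x n

  log-above : ∀ {b b′ x} x>0 → 1ℚ ≤ b → b′ ≤ ι 2 - ι 4 * recip (b + 1ℚ) →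
              EventuallyAbove b x → EventuallyAbove b′ (log x x>0)
  log-above {b} {x = x} (_ , _ , _ , _) 1≤b b′≤ (M , h) = M , λ n M≤n → ≤-trans b′≤ (≤-trans
    (+-monoʳ-≤ (ι 2) (neg-antimono-≤ (*-monoʳ (ι-nn 4)
      (recip-anti (<-≤-trans 0<1 (q≤p+q (≤-trans 0≤1 1≤b))) (+-monoˡ-≤ 1ℚ (h n M≤n))))))
    (log-lower (≤-trans 1≤b (h n M≤n)) n))

  above⇒pos : ∀ {b x} → 0ℚ < b → EventuallyAbove b x → 0ℝ <ℝ x
  above⇒pos {b} {x} 0<b (M , h) = b , 0<b , M , λ n M≤n → ≤-by-≡ˡ (+-identityˡ b) (h n M≤n)

  -- The bound `2 - 4 / (b + 1)` takes 9 to `8/5`, which still exceeds 1, so it can be applied again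
  -- and gives `6/13 > 0`.
  iterated-logs-positive : ∀ N → EventuallyAbove (ι 9) N →
    Σ (0ℝ <ℝ N) λ N>0 → Σ (0ℝ <ℝ log N N>0) λ logN>0 → 0ℝ <ℝ log (log N N>0) logN>0
  iterated-logs-positive N N≥9 = N>0 , logN>0 , above⇒pos {+ 6 / 13} {log (log N N>0) logN>0} (from-yes (0ℚ <? + 6 / 13)) loglogN≥
    where
    N>0 : 0ℝ <ℝ N
    N>0 = above⇒pos {ι 9} {N} (from-yes (0ℚ <? ι 9)) N≥9
    logN≥ : EventuallyAbove (+ 8 / 5) (log N N>0)
    logN≥ = log-above {ι 9} {+ 8 / 5} {N} N>0 (from-yes (1ℚ ≤? ι 9)) (from-yes (+ 8 / 5 ≤? ι 2 - ι 4 * recip (ι 9 + 1ℚ))) N≥9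
    logN>0 : 0ℝ <ℝ log N N>0
    logN>0 = above⇒pos {+ 8 / 5} {log N N>0} (from-yes (0ℚ <? + 8 / 5)) logN≥
    loglogN≥ : EventuallyAbove (+ 6 / 13) (log (log N N>0) logN>0)
    loglogN≥ = log-above {+ 8 / 5} {+ 6 / 13} {log N N>0} logN>0 (from-yes (1ℚ ≤? + 8 / 5))
      (from-yes (+ 6 / 13 ≤? ι 2 - ι 4 * recip (+ 8 / 5 + 1ℚ))) logN≥

  -- `≤ℝ` holds only up to an arbitrary `ε`; the extra unit in `suc n` absorbs `ε = 1`.
  ≤ℝ⇒above : ∀ {n N} → fromℕ (suc n) ≤ℝ N → EventuallyAbove (ι n) N
  ≤ℝ⇒above {n} {N} h = let M , le = h 1ℚ 0<1 in M , λ k M≤k → subst₂ _≤_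
    (trans (cong (_- 1ℚ) (ι-suc n)) (solve 1 (λ x → (x :+ con 1ℚ) :- con 1ℚ := x) refl (ι n)))
    (solve 1 (λ x → (x :+ con 1ℚ) :- con 1ℚ := x) refl (seq N k))
    (+-monoˡ-≤ (- 1ℚ) (le k M≤k))

  above-<ℝ⇒< : ∀ {m n N} → EventuallyAbove (ι m) N → N <ℝ fromℕ n → m ℕ.< n
  above-<ℝ⇒< {m} {n} {N} (M₁ , h) (ε , 0<ε , M₂ , lt) = ℕP.≰⇒> λ n≤m → <-irrefl refl (begin-strict
    ι m                     ≤⟨ h X (ℕP.m≤m⊔n M₁ M₂) ⟩
    seq N X                 ≡⟨ sym (+-identityʳ (seq N X)) ⟩
    seq N X + 0ℚ            <⟨ +-monoʳ-< (seq N X) 0<ε ⟩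
    seq N X + ε             ≤⟨ lt X (ℕP.m≤n⊔m M₁ M₂) ⟩
    ι n                     ≤⟨ ι-mono n≤m ⟩
    ι m                     ∎)
    where
    open ≤-Reasoning
    X = M₁ ℕ.⊔ M₂

open import Defs
open import Data.Integer.Base using (+_)
open import Data.List.Relation.Unary.All using (All)
open import Data.Product.Base using (Σ; ∃; _×_)
open import Data.Rational.Base using (_/_)
import Data.List.Relation.Unary.All as All
open import Data.Nat.Base using (suc; _+_)
open import Data.Nat.Properties using (m≤m+n; m≤n+m; ≤-refl; ≤-<-trans)
open import Data.Product.Base using (_,_)
import Data.Rational.Properties as ℚ
open Sieve using (Uncoverable; hough-from; rankin)
open Density using (minDensity-pos)
open Logarithm using (≤ℝ⇒above; above-<ℝ⇒<; iterated-logs-positive)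

hough : ∃ Uncoverable
hough = hough-from (rankin 384 ≤-refl)

theoremA : (c : ℝ) → 0ℝ <ℝ c → c <ℝ fromℚ (+ 1 / 3) →
    ∃ λ (N₀ : ℝ) → (N : ℝ) → N₀ ≤ℝ N →
    Σ (0ℝ <ℝ N) λ N>0 →
    Σ (0ℝ <ℝ log N N>0) λ logN>0 →
    Σ (0ℝ <ℝ log (log N N>0) logN>0) λ loglogN>0 →
      let logN       = log N N>0
          loglogN    = log logN logN>0
          logloglogN = log loglogN loglogN>0
      in (S : FiniteSet⁺) →
         All (λ n → N <ℝ fromℕ n) (elements S) →
         fromℚ (sumOfReciprocals S) ≤ℝ c *ℝ (logN *ℝ logloglogN *ℝ recipℝ loglogN loglogN>0) →
         ∃ λ (δ⁻ : ℝ) → IsMinDensity S δ⁻ × 0ℝ <ℝ δ⁻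
theoremA c _ _ =
  let n₀ , uncoverable = hough in
  -- `n₀` makes the moduli uncoverable, 9 makes the iterated logarithms positive, and `suc` is the
  -- slack consumed by `≤ℝ⇒above`.
  fromℕ (suc (n₀ + 9)) , λ N N₀≤N →
    let M , above = ≤ℝ⇒above {n₀ + 9} {N} N₀≤N
        N>0 , logN>0 , loglogN>0 =
          iterated-logs-positive N (M , λ k M≤k → ℚ.≤-trans (RealLemmas.ι-mono (m≤n+m 9 n₀)) (above k M≤k))
    in N>0 , logN>0 , loglogN>0 , λ S N<S _ → minDensity-pos S λ r →
       let a , uncovered = uncoverable (elements S) (unique S)
             (λ n∈ → ≤-<-trans (m≤m+n n₀ 9) (above-<ℝ⇒< {n₀ + 9} {_} {N} (M , above) (All.lookup N<S n∈))) r
       in a , All.tabulate uncovered
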